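{- Let $\mathcal{P}\subset(\mathbb{R}_{\ge0})^N$ be an integral polytope of dimension $d$ with vertices $\mathbf{v}_i=(v_{i1},\dots,v_{iN})$, $1\le i\le m$. Then there exists a polynomial $L_{\mathcal{P}}(x_1,\dots,x_N)\in\mathbb{Q}(\mathbf{q})[x_1,\dots,x_N]$ such that \[ L_{\mathcal{P}}([n]_{q_1},[n]_{q_2},\dots,[n]_{q_N})=\sigma_{n\mathcal{P}}(\mathbf{q})\quad\text{for all } n\in\mathbb{Z}_{>0}, \] and the total degree of $L_{\mathcal{P}}$ equals $\max\{\sum_{k=1}^N v_{ik}\mid 1\le i\le m\}$.
   Context: Let $q_1,\dots,q_N$ be indeterminates and $\mathbb{Q}(\mathbf{q})=\mathbb{Q}(q_1,\dots,q_N)$ the field of rational functions. For $\mathbf{a}\in\mathbb{Z}^N$, $\mathbf{q}^{\mathbf{a}}=q_1^{a_1}\cdots q_N^{a_N}$. For a polytope $S\subset\mathbb{R}^N$, $\sigma_S(\mathbf{q})=\sum_{\mathbf{a}\in S\cap\mathbb{Z}^N}\mathbf{q}^{\mathbf{a}}$. An integral polytope is a convex polytope with vertices in $\mathbb{Z}^N$; $n\mathcal{P}=\{n\alpha\mid\alpha\in\mathcal{P}\}$. The $q$-integer is $[n]_q=\frac{1-q^n}{1-q}$ for $n\in\mathbb{Z}$. -}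

module Defs where

open import Data.Nat as ℕ using (ℕ; zero; suc)
import Data.Nat.Properties as ℕP
open import Data.Integer using (+_)
open import Data.Rational as ℚ using (ℚ; 0ℚ; 1ℚ)
open import Data.Fin using (Fin; zero; suc)
open import Data.Vec as Vec using (Vec; _[_]≔_; replicate; zipWith; lookup)
open import Data.Vec.Properties using (≡-dec)
open import Data.List as List using (List; []; _∷_; _++_; concatMap; map)
open import Data.List.Relation.Unary.All using (All)
open import Data.List.Relation.Unary.Unique.Propositional using (Unique)
open import Data.List.Membership.Propositional using (_∈_)
open import Data.Product using (Σ; _×_; _,_; proj₁; ∃)
open import Function using (_∘_)
open import Relation.Nullary using (¬_; yes; no)
open import Relation.Binary.PropositionalEquality using (_≡_; _≢_)

ℕ→ℚ : ℕ → ℚ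
ℕ→ℚ n = (+ n) ℚ./ 1

sumFin : {m : ℕ} → (Fin m → ℚ) → ℚ
sumFin {zero} f = 0ℚ
sumFin {suc m} f = f zero ℚ.+ sumFin (λ i → f (suc i))

maxFin : {m : ℕ} → (Fin m → ℕ) → ℕ
maxFin {zero} f = 0
maxFin {suc m} f = f zero ℕ.⊔ maxFin (λ i → f (suc i))

Poly : ℕ → Set
Poly N = List (ℚ × Vec ℕ N)

coeffP : {N : ℕ} → Poly N → Vec ℕ N → ℚ
coeffP [] γ = 0ℚ
coeffP ((c , α) ∷ p) γ with ≡-dec ℕP._≟_ α γ
... | yes _ = c ℚ.+ coeffP p γ
... | no _ = coeffP p γ

_≈P_ : {N : ℕ} → Poly N → Poly N → Set
p ≈P r = ∀ γ → coeffP p γ ≡ coeffP r γ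

NonzeroP : {N : ℕ} → Poly N → Set
NonzeroP p = ∃ λ γ → coeffP p γ ≢ 0ℚ

addP : {N : ℕ} → Poly N → Poly N → Poly N
addP = _++_

negP : {N : ℕ} → Poly N → Poly N
negP = map (λ { (c , α) → (ℚ.- c , α) })

mulP : {N : ℕ} → Poly N → Poly N → Poly N
mulP p r = concatMap (λ { (c , α) → map (λ { (d , β) → (c ℚ.* d , zipWith ℕ._+_ α β) }) r }) p

constP : {N : ℕ} → ℚ → Poly N
constP {N} c = (c , replicate N 0) ∷ []

qPow : {N : ℕ} → Fin N → ℕ → Poly N
qPow {N} k e = (1ℚ , replicate N 0 [ k ]≔ e) ∷ []

record RatFun (N : ℕ) : Set where
  constructor _⟋_
  field
    num : Poly N
    den : Poly N
open RatFun public

ValidR : {N : ℕ} → RatFun N → Set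
ValidR r = NonzeroP (den r)

_≈R_ : {N : ℕ} → RatFun N → RatFun N → Set
r ≈R s = mulP (num r) (den s) ≈P mulP (num s) (den r)

zeroR : {N : ℕ} → RatFun N
zeroR = [] ⟋ constP 1ℚ

oneR : {N : ℕ} → RatFun N
oneR = constP 1ℚ ⟋ constP 1ℚ

fromPoly : {N : ℕ} → Poly N → RatFun N
fromPoly p = p ⟋ constP 1ℚ

addR : {N : ℕ} → RatFun N → RatFun N → RatFun N
addR (a ⟋ b) (c ⟋ d) = addP (mulP a d) (mulP c b) ⟋ mulP b d

mulR : {N : ℕ} → RatFun N → RatFun N → RatFun N
mulR (a ⟋ b) (c ⟋ d) = mulP a c ⟋ mulP b d

powR : {N : ℕ} → RatFun N → ℕ → RatFun N
powR r zero = oneR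
powR r (suc e) = mulR r (powR r e)

qInt : {N : ℕ} → Fin N → ℕ → RatFun N
qInt k n = addP (constP 1ℚ) (negP (qPow k n)) ⟋ addP (constP 1ℚ) (negP (qPow k 1))

PolyX : ℕ → Set
PolyX N = List (RatFun N × Vec ℕ N)

coeffX : {N : ℕ} → PolyX N → Vec ℕ N → RatFun N
coeffX [] β = zeroR
coeffX ((c , α) ∷ L) β with ≡-dec ℕP._≟_ α β
... | yes _ = addR c (coeffX L β)
... | no _ = coeffX L β

monoEval : {N : ℕ} → (Fin N → RatFun N) → {M : ℕ} → (Fin M → Fin N) → Vec ℕ M → RatFun N
monoEval t ι Vec.[] = oneR
monoEval t ι (e Vec.∷ β) = mulR (powR (t (ι zero)) e) (monoEval t (ι ∘ suc) β)

evalX : {N : ℕ} → PolyX N → (Fin N → RatFun N) → RatFun N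
evalX [] t = zeroR
evalX ((c , β) ∷ L) t = addR (mulR c (monoEval t (λ k → k) β)) (evalX L t)

ValidX : {N : ℕ} → PolyX N → Set
ValidX L = All (ValidR ∘ proj₁) L

TotalDegree : {N : ℕ} → PolyX N → ℕ → Set
TotalDegree L D =
  (∃ λ β → Vec.sum β ≡ D × ¬ (coeffX L β ≈R zeroR)) ×
  (∀ β → ¬ (coeffX L β ≈R zeroR) → Vec.sum β ℕ.≤ D)

-- Integral polytopes in (ℝ≥0)^N given by vertices v₁,…,v_m ∈ ℕ^N

ConvexWeights : {m : ℕ} → (Fin m → ℚ) → Set
ConvexWeights λs = (∀ i → 0ℚ ℚ.≤ λs i) × sumFin λs ≡ 1ℚ

InDilate : {N m : ℕ} → (Fin m → Vec ℕ N) → ℕ → Vec ℕ N → Set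
InDilate {N} v n a = ∃ λ (λs : Fin _ → ℚ) → ConvexWeights λs ×
  (∀ (k : Fin N) → ℕ→ℚ (lookup a k) ≡ ℕ→ℚ n ℚ.* sumFin (λ i → λs i ℚ.* ℕ→ℚ (lookup (v i) k)))

IsVertexList : {N m : ℕ} → (Fin m → Vec ℕ N) → Set
IsVertexList {N} v = ∀ i → ¬ (∃ λ (λs : Fin _ → ℚ) → ConvexWeights λs × λs i ≡ 0ℚ ×
  (∀ (k : Fin N) → ℕ→ℚ (lookup (v i) k) ≡ sumFin (λ j → λs j ℚ.* ℕ→ℚ (lookup (v j) k))))

LatticeEnum : {N m : ℕ} → (Fin m → Vec ℕ N) → ℕ → List (Vec ℕ N) → Set
LatticeEnum v n S = Unique S × (∀ a → (a ∈ S → InDilate v n a) × (InDilate v n a → a ∈ S))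

sigmaP : {N : ℕ} → List (Vec ℕ N) → Poly N
sigmaP = map (λ a → (1ℚ , a))

module Submission where

-- Let wᵢ = (1, vᵢ) and C the cone they generate, so that u n = σ_{nP} is the generating function of the lattice
-- points of C at height n.  Every a ∈ C has a lexicographically least representation a = Σ tᵢ wᵢ with tᵢ ≥ 0, and
-- being least only depends on the support of t.  Hence, for a fixed support T, subtracting the shift by wᵢ (i ∈ T)
-- from the indicator of the points with support T leaves those with 0 < tᵢ ≤ 1, and the product of all
-- operators (1 - shift by wᵢ) kills the indicator of C at heights above m.  For the generating functions this is
-- the linear recurrence Π (E - q^{vᵢ}) u = 0, valid from n = 1 on; its characteristic roots are distinct, so
-- σ_{nP} = Σ fᵢ q^{n vᵢ} with fᵢ ∈ ℚ(q).  Since q_k^n = 1 - (1 - q_k)[n]_{q_k}, substitution gives the polynomial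
-- L = Σ fᵢ Π_k (1 - (1 - q_k) x_k)^{v_ik}.  Its degree is as claimed because fᵢ ≠ 0: otherwise the recurrence
-- without the factor of i would hold, but its left side has coefficient 1 at a multiple of the vertex vᵢ.

-- The vertices need not be affinely independent, so a point of `C` has many representations.
-- Choosing the least one does the work of a triangulation. Leastness survives a change of a
-- positive coefficient: a better representation of the new point could be exchanged, in a small
-- multiple, into the old one. The price is that membership in `C` must be decidable and least
-- representations must exist. Fourier-Motzkin elimination gives both: it describes `C` by finitely
-- many inequalities, and so the least coefficient of a generator that leaves the remainder in the
-- cone of the later ones is either 0 or the solution of one linear equation. The bound `m` on
-- heights comes from `m` coefficients that are each at most 1. The coefficient 1 at a multiple of a
-- vertex arises because subtracting other generators from that multiple leaves the cone, so only
-- the unshifted term of the operator product contributes. The recurrence is solved by dividing by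
-- differences of its roots. Hence polynomials, given as unnormalised lists of terms, must first be
-- shown to have no zero divisors; a monomial order does that.

open import Defs
open import Data.Nat as ℕ using (ℕ; zero; suc)
import Data.Nat.Properties as ℕP
import Data.Integer as ℤ
import Data.Integer.Properties as ℤP
open import Data.Rational as ℚ using (ℚ; 0ℚ; 1ℚ)
import Data.Rational.Properties as ℚP
import Data.Rational.Unnormalised as ℚᵘ
import Data.Rational.Unnormalised.Properties as ℚᵘP
open import Data.Fin as Fin using (Fin; zero; suc)
open import Data.Vec as Vec using (Vec; []; _∷_; zipWith; replicate; lookup; _[_]≔_; head)
open import Data.Vec.Properties
  using (≡-dec; ∷-injective; lookup-map; lookup-zipWith; lookup-replicate; lookup∘tabulate; lookup∘update; lookup∘update′;
    []≔-lookup; tabulate∘lookup; tabulate-cong; zipWith-assoc; zipWith-comm; zipWith-identityˡ)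
open import Data.Vec.Relation.Unary.All as VAll using ([]; _∷_)
import Data.Vec.Relation.Unary.All.Properties as VAllP
open import Data.Vec.Relation.Binary.Pointwise.Inductive as Pw using (Pointwise; []; _∷_)
open import Data.List as List
  using (List; []; _∷_; _++_; allFin; cartesianProductWith; concat; filter; length; map; tabulate; upTo)
open import Data.List.Properties using (length-tabulate; map-tabulate; map-∘)
open import Data.List.Membership.Propositional using (_∈_; _∉_)
open import Data.List.Membership.Propositional.Properties
  using (∈-++⁺ˡ; ∈-++⁺ʳ; ∈-++⁻; ∈-filter⁺; ∈-filter⁻; ∈-cartesianProductWith⁺; ∈-cartesianProductWith⁻; ∈-map⁺; ∈-upTo⁺; ∈-allFin)
open import Data.List.Relation.Unary.All as All using (All; []; _∷_)
import Data.List.Relation.Unary.All.Properties as AllP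
open import Data.List.Relation.Unary.Any using (Any; here; there)
open import Data.List.Relation.Unary.AllPairs using ([]; _∷_)
open import Data.List.Relation.Unary.Unique.Propositional using (Unique)
import Data.List.Relation.Unary.Unique.Propositional.Properties as Uniq
open import Data.Product using (Σ; ∃; _×_; _,_; proj₁; proj₂)
open import Data.Sum using (_⊎_; inj₁; inj₂)
open import Data.Unit using (⊤; tt)
open import Data.Empty using (⊥; ⊥-elim)
open import Function using (_∘_; id)
open import Level using (0ℓ)
open import Algebra.Bundles using (CommutativeRing)
open import Relation.Nullary using (¬_; Dec; yes; no; ¬?)
open import Relation.Nullary.Decidable using (dec⇒maybe; decidable-stable; map′; _×-dec_)
open import Relation.Binary using (tri<; tri≈; tri>)
import Relation.Binary.PropositionalEquality as ≡
open import Tactic.RingSolver using (solve-∀)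
open import Tactic.RingSolver.Core.AlmostCommutativeRing using (AlmostCommutativeRing; fromCommutativeRing)

-- Linear recurrences

module Recurrence (R : CommutativeRing 0ℓ 0ℓ) where
  open CommutativeRing R hiding (zero)
  open import Relation.Binary.Reasoning.Setoid setoid
  open import Algebra.Properties.Semiring.Exp semiring public using (_^_)
  open import Algebra.Properties.Semiring.Sum semiring using (*-distribˡ-sum)
  open import Algebra.Properties.CommutativeMonoid.Sum +-commutativeMonoid public using (sum; sum-cong-≋; ∑-distrib-+; sum-replicate-zero)
  open import Algebra.Solver.Ring.NaturalCoefficients.Default commutativeSemiring using (solve; _:=_; _:+_; _:*_)

  shiftDiff : Carrier → (ℕ → Carrier) → ℕ → Carrier
  shiftDiff x u n = u (suc n) - x * u n

  annihilate : List Carrier → (ℕ → Carrier) → ℕ → Carrier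
  annihilate [] u = u
  annihilate (x ∷ xs) u = annihilate xs (shiftDiff x u)

  annihilate-cong : ∀ xs {u w : ℕ → Carrier} → (∀ n → u n ≈ w n) → ∀ n → annihilate xs u n ≈ annihilate xs w n
  annihilate-cong [] e = e
  annihilate-cong (x ∷ xs) e = annihilate-cong xs (λ n → +-cong (e (suc n)) (-‿cong (*-congˡ (e n))))

  expSum : {m : ℕ} → (Fin m → Carrier) → (Fin m → Carrier) → ℕ → Carrier
  expSum f x n = sum (λ i → f i * x i ^ n)

  +-minus-cancel : ∀ a b → (a - b) + b ≈ a
  +-minus-cancel a b = trans (+-assoc a (- b) b) (trans (+-congˡ (-‿inverseˡ b)) (+-identityʳ a))

  expSum-shift : {m : ℕ} (f x : Fin m → Carrier) (y : Carrier) (n : ℕ) →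
    shiftDiff y (expSum f x) n ≈ expSum (λ i → f i * (x i - y)) x n
  expSum-shift {m} f x y n = begin
    sum (λ i → f i * x i ^ suc n) - y * sum (λ i → f i * x i ^ n)
      ≈⟨ +-congʳ (sum-cong-≋ term) ⟩
    sum (λ i → f i * (x i - y) * x i ^ n + y * (f i * x i ^ n)) - y * sum (λ i → f i * x i ^ n)
      ≈⟨ +-cong (trans (∑-distrib-+ {m} _ _) (+-congˡ (sym (*-distribˡ-sum {m} y _)))) refl ⟩
    sum (λ i → f i * (x i - y) * x i ^ n) + y * sum (λ i → f i * x i ^ n) - y * sum (λ i → f i * x i ^ n)
      ≈⟨ trans (+-assoc _ _ _) (trans (+-congˡ (-‿inverseʳ _)) (+-identityʳ _)) ⟩
    sum (λ i → f i * (x i - y) * x i ^ n) ∎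
    where
    -- Here `d` stands for `x i - y`, so that `x i` reads `d + y` and only sums and products occur.
    l : ∀ a d y p → a * ((d + y) * p) ≈ a * d * p + y * (a * p)
    l = solve 4 (λ a d y p → a :* ((d :+ y) :* p) := a :* d :* p :+ y :* (a :* p)) refl
    term : ∀ i → f i * x i ^ suc n ≈ f i * (x i - y) * x i ^ n + y * (f i * x i ^ n)
    term i = trans (*-congˡ (*-congʳ (sym (+-minus-cancel (x i) y)))) (l (f i) (x i - y) y (x i ^ n))

  -- The operator of the root `x j` multiplies the i-th coefficient by `x i - x j`, so it kills
  -- index `j` and keeps zero coefficients zero. Indices with `f i ≈ 0` may be absent from `js`:
  -- this later refutes the vanishing of a coefficient.
  annihilate-expSum : {m : ℕ} (x : Fin m → Carrier) (js : List (Fin m)) (f : Fin m → Carrier) →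
    (∀ i → f i ≈ 0# ⊎ i ∈ js) → ∀ n → annihilate (List.map x js) (expSum f x) n ≈ 0#
  annihilate-expSum {m} x [] f z n = trans (sum-cong-≋ (λ i → zero-term i (z i))) (sum-replicate-zero m)
    where
    zero-term : ∀ i → f i ≈ 0# ⊎ i ∈ [] → f i * x i ^ n ≈ 0#
    zero-term i (inj₁ e) = trans (*-congʳ e) (zeroˡ _)
  annihilate-expSum x (j ∷ js) f z n = trans (annihilate-cong (List.map x js) (expSum-shift f x (x j)) n)
    (annihilate-expSum x js (λ i → f i * (x i - x j)) (λ i → still i (z i)) n)
    where
    still : ∀ i → f i ≈ 0# ⊎ i ∈ j ∷ js → f i * (x i - x j) ≈ 0# ⊎ i ∈ js
    still i (inj₁ e) = inj₁ (trans (*-congʳ e) (zeroˡ _))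
    still i (inj₂ (here ≡.refl)) = inj₁ (trans (*-congˡ (-‿inverseʳ (x i))) (zeroʳ _))
    still i (inj₂ (there i∈js)) = inj₂ i∈js

  -- Induction on the number of roots: `shiftDiff (x zero) u` obeys the recurrence of the other
  -- roots. Dividing its coefficients by `x i - x zero` undoes the operator up to a multiple of the
  -- powers of `x zero`, and the value `u 0` fixes that multiple.
  solveRecurrence : {m : ℕ} (x : Fin m → Carrier) → (∀ i j → i ≡.≢ j → ∃ λ y → y * (x i - x j) ≈ 1#) →
    (u : ℕ → Carrier) → (∀ n → annihilate (tabulate x) u n ≈ 0#) →
    Σ (Fin m → Carrier) λ f → ∀ n → u n ≈ expSum f x n
  solveRecurrence {zero} x inv u z = (λ ()) , z
  solveRecurrence {suc m} x inv u z
    with solveRecurrence (x ∘ suc) (λ i j i≢j → inv (suc i) (suc j) (λ { ≡.refl → i≢j ≡.refl })) (shiftDiff (x zero) u) z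
  ... | g , w≈ = f , u≈
    where
    difference⁻¹ : ∀ i → ∃ λ y → y * (x (suc i) - x zero) ≈ 1#
    difference⁻¹ i = inv (suc i) zero (λ ())
    h : Fin m → Carrier
    h i = g i * proj₁ (difference⁻¹ i)
    f : Fin (suc m) → Carrier
    f zero = u 0 - expSum h (x ∘ suc) 0
    f (suc i) = h i
    l₁ : ∀ g y d x₀ p → g * (y * d) * p + x₀ * (g * y * p) ≈ g * y * ((d + x₀) * p)
    l₁ = solve 5 (λ g y d x₀ p → g :* (y :* d) :* p :+ x₀ :* (g :* y :* p) := g :* y :* ((d :+ x₀) :* p)) refl
    l₂ : ∀ a x₀ f₀ p s → a + x₀ * (f₀ * p + s) ≈ f₀ * (x₀ * p) + (a + x₀ * s)
    l₂ = solve 5 (λ a x₀ f₀ p s → a :+ x₀ :* (f₀ :* p :+ s) := f₀ :* (x₀ :* p) :+ (a :+ x₀ :* s)) refl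
    term : ∀ n i → g i * x (suc i) ^ n + x zero * (h i * x (suc i) ^ n) ≈ h i * x (suc i) ^ suc n
    term n i with difference⁻¹ i
    ... | y , e = begin
      g i * x (suc i) ^ n + x zero * (g i * y * x (suc i) ^ n)
        ≈⟨ +-congʳ (*-congʳ (sym (trans (*-congˡ e) (*-identityʳ (g i))))) ⟩
      g i * (y * (x (suc i) - x zero)) * x (suc i) ^ n + x zero * (g i * y * x (suc i) ^ n)
        ≈⟨ l₁ (g i) y (x (suc i) - x zero) (x zero) (x (suc i) ^ n) ⟩
      g i * y * ((x (suc i) - x zero + x zero) * x (suc i) ^ n)
        ≈⟨ *-congˡ (*-congʳ (+-minus-cancel _ _)) ⟩
      g i * y * (x (suc i) * x (suc i) ^ n) ∎
    u≈ : ∀ n → u n ≈ expSum f x n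
    u≈ zero = sym (trans (+-congʳ (*-identityʳ _)) (+-minus-cancel _ _))
    u≈ (suc n) = begin
      u (suc n) ≈⟨ +-minus-cancel (u (suc n)) (x zero * u n) ⟨
      shiftDiff (x zero) u n + x zero * u n ≈⟨ +-cong (w≈ n) (*-congˡ (u≈ n)) ⟩
      expSum g (x ∘ suc) n + x zero * (f zero * x zero ^ n + expSum h (x ∘ suc) n)
        ≈⟨ l₂ _ (x zero) (f zero) (x zero ^ n) _ ⟩
      f zero * x zero ^ suc n + (expSum g (x ∘ suc) n + x zero * expSum h (x ∘ suc) n)
        ≈⟨ +-congˡ (trans (+-congˡ (*-distribˡ-sum {m} (x zero) _)) (trans (sym (∑-distrib-+ {m} _ _)) (sum-cong-≋ (term n)))) ⟩
      f zero * x zero ^ suc n + expSum h (x ∘ suc) (suc n) ∎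

-- A fraction a/b is treated here as the pair of its numerator and denominator, so that
-- every statement is an identity of cross products.
module FractionIdentities (R : CommutativeRing 0ℓ 0ℓ) where
  open CommutativeRing R
  open import Relation.Binary.Reasoning.Setoid setoid
  open import Algebra.Solver.Ring.NaturalCoefficients.Default commutativeSemiring using (solve; _:=_; _:+_; _:*_)

  -- Transitivity of cross multiplication holds only up to the middle denominator `d`. Cancelling
  -- `d` is the one place where the ring laws of fractions need the absence of zero divisors.
  trans-identity : ∀ a b c d e f → a * d ≈ c * b → c * f ≈ e * d → (a * f) * d ≈ (e * b) * d
  trans-identity a b c d e f ad≈cb cf≈ed = begin
    (a * f) * d ≈⟨ l₁ a f d ⟩
    (a * d) * f ≈⟨ *-congʳ ad≈cb ⟩
    (c * b) * f ≈⟨ l₁ c b f ⟩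
    (c * f) * b ≈⟨ *-congʳ cf≈ed ⟩
    (e * d) * b ≈⟨ l₁ e d b ⟩
    (e * b) * d ∎
    where
    l₁ : ∀ x y z → (x * y) * z ≈ (x * z) * y
    l₁ = solve 3 (λ x y z → (x :* y) :* z := (x :* z) :* y) refl

  +-cong-identity : ∀ a b c d a' b' c' d' → a * b' ≈ a' * b → c * d' ≈ c' * d →
    (a * d + c * b) * (b' * d') ≈ (a' * d' + c' * b') * (b * d)
  +-cong-identity a b c d a' b' c' d' e f = begin
    (a * d + c * b) * (b' * d') ≈⟨ l₁ a b c d b' d' ⟩
    (a * b') * (d * d') + (c * d') * (b * b') ≈⟨ +-cong (*-congʳ e) (*-congʳ f) ⟩
    (a' * b) * (d * d') + (c' * d) * (b * b') ≈⟨ l₂ a' b c' d b' d' ⟩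
    (a' * d' + c' * b') * (b * d) ∎
    where
    l₁ : ∀ a b c d b' d' → (a * d + c * b) * (b' * d') ≈ (a * b') * (d * d') + (c * d') * (b * b')
    l₁ = solve 6 (λ a b c d b' d' → (a :* d :+ c :* b) :* (b' :* d') := (a :* b') :* (d :* d') :+ (c :* d') :* (b :* b')) refl
    l₂ : ∀ a' b c' d b' d' → (a' * b) * (d * d') + (c' * d) * (b * b') ≈ (a' * d' + c' * b') * (b * d)
    l₂ = solve 6 (λ a' b c' d b' d' → (a' :* b) :* (d :* d') :+ (c' :* d) :* (b :* b') := (a' :* d' :+ c' :* b') :* (b :* d)) refl

  *-cong-identity : ∀ a b c d a' b' c' d' → a * b' ≈ a' * b → c * d' ≈ c' * d →
    (a * c) * (b' * d') ≈ (a' * c') * (b * d)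
  *-cong-identity a b c d a' b' c' d' e f = begin
    (a * c) * (b' * d') ≈⟨ l₁ a c b' d' ⟩
    (a * b') * (c * d') ≈⟨ *-cong e f ⟩
    (a' * b) * (c' * d) ≈⟨ l₁ a' b c' d ⟩
    (a' * c') * (b * d) ∎
    where
    l₁ : ∀ a c b' d' → (a * c) * (b' * d') ≈ (a * b') * (c * d')
    l₁ = solve 4 (λ a c b' d' → (a :* c) :* (b' :* d') := (a :* b') :* (c :* d')) refl

  +-assoc-identity : ∀ a b c d e f →
    ((a * d + c * b) * f + e * (b * d)) * (b * (d * f)) ≈ (a * (d * f) + (c * f + e * d) * b) * ((b * d) * f)
  +-assoc-identity = solve 6 (λ a b c d e f →
    ((a :* d :+ c :* b) :* f :+ e :* (b :* d)) :* (b :* (d :* f)) :=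
    (a :* (d :* f) :+ (c :* f :+ e :* d) :* b) :* ((b :* d) :* f)) refl

  +-comm-identity : ∀ a b c d → (a * d + c * b) * (d * b) ≈ (c * b + a * d) * (b * d)
  +-comm-identity = solve 4 (λ a b c d → (a :* d :+ c :* b) :* (d :* b) := (c :* b :+ a :* d) :* (b :* d)) refl

  +-identityˡ-identity : ∀ a b → (0# * b + a * 1#) * b ≈ a * (1# * b)
  +-identityˡ-identity a b = trans (*-congʳ (trans (+-cong (zeroˡ b) (*-identityʳ a)) (+-identityˡ a)))
    (sym (*-congˡ (*-identityˡ b)))

  +-inverseˡ-identity : ∀ a b → (- a * b + a * b) * 1# ≈ 0# * (b * b)
  +-inverseˡ-identity a b = begin
    (- a * b + a * b) * 1# ≈⟨ *-identityʳ _ ⟩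
    - a * b + a * b ≈⟨ l₁ (- a) a b ⟩
    (- a + a) * b ≈⟨ *-congʳ (-‿inverseˡ a) ⟩
    0# * b ≈⟨ zeroˡ b ⟩
    0# ≈⟨ zeroˡ (b * b) ⟨
    0# * (b * b) ∎
    where
    l₁ : ∀ a c b → a * b + c * b ≈ (a + c) * b
    l₁ = solve 3 (λ a c b → a :* b :+ c :* b := (a :+ c) :* b) refl

  *-assoc-identity : ∀ a b c d e f → ((a * c) * e) * (b * (d * f)) ≈ (a * (c * e)) * ((b * d) * f)
  *-assoc-identity = solve 6 (λ a b c d e f → ((a :* c) :* e) :* (b :* (d :* f)) := (a :* (c :* e)) :* ((b :* d) :* f)) refl

  *-comm-identity : ∀ a b c d → (a * c) * (d * b) ≈ (c * a) * (b * d)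
  *-comm-identity = solve 4 (λ a b c d → (a :* c) :* (d :* b) := (c :* a) :* (b :* d)) refl

  *-identityˡ-identity : ∀ a b → (1# * a) * b ≈ a * (1# * b)
  *-identityˡ-identity a b = trans (*-congʳ (*-identityˡ a)) (sym (*-congˡ (*-identityˡ b)))

  distribˡ-identity : ∀ a b c d e f →
    (a * (c * f + e * d)) * ((b * d) * (b * f)) ≈ ((a * c) * (b * f) + (a * e) * (b * d)) * (b * (d * f))
  distribˡ-identity = solve 6 (λ a b c d e f →
    (a :* (c :* f :+ e :* d)) :* ((b :* d) :* (b :* f)) :=
    ((a :* c) :* (b :* f) :+ (a :* e) :* (b :* d)) :* (b :* (d :* f))) refl

  inverse-identity : ∀ a b → (b * a) * 1# ≈ 1# * (a * b)
  inverse-identity a b = trans (*-identityʳ _) (trans (l₁ b a) (sym (*-identityˡ _)))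
    where
    l₁ : ∀ b a → b * a ≈ a * b
    l₁ = solve 2 (λ b a → b :* a := a :* b) refl

  fromPoly-+-identity : ∀ a b → (a * 1# + b * 1#) * 1# ≈ (a + b) * (1# * 1#)
  fromPoly-+-identity a b = trans (*-congʳ (+-cong (*-identityʳ a) (*-identityʳ b))) (sym (*-congˡ (*-identityʳ 1#)))

  fromPoly-*-identity : ∀ a b → (a * b) * 1# ≈ (a * b) * (1# * 1#)
  fromPoly-*-identity a b = sym (*-congˡ (*-identityʳ 1#))

module EvaluationIdentities (R : CommutativeRing 0ℓ 0ℓ) where
  open CommutativeRing R using (_≈_; _+_; _*_; commutativeSemiring) renaming (refl to ≈-refl)
  open import Algebra.Solver.Ring.NaturalCoefficients.Default commutativeSemiring using (solve; _:=_; _:+_; _:*_)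

  interchange : ∀ a b c d → (a * b) * (c * d) ≈ (a * c) * (b * d)
  interchange = solve 4 (λ a b c d → (a :* b) :* (c :* d) := (a :* c) :* (b :* d)) ≈-refl

  regroup : ∀ a b c d → (a * b) * (c * d) ≈ a * ((b * c) * d)
  regroup = solve 4 (λ a b c d → (a :* b) :* (c :* d) := a :* ((b :* c) :* d)) ≈-refl

  scale-identity : ∀ c d x e → c * d * x + c * e ≈ c * (d * x + e)
  scale-identity = solve 4 (λ c d x e → c :* d :* x :+ c :* e := c :* (d :* x :+ e)) ≈-refl

  shift-identity : ∀ s c x p b r → s * c * (x * p * b) + (s * x) * r ≈ (s * x) * (c * (p * b) + r)
  shift-identity = solve 6 (λ s c x p b r → s :* c :* (x :* p :* b) :+ (s :* x) :* r := (s :* x) :* (c :* (p :* b) :+ r)) ≈-refl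

open ≡ using (_≡_; _≢_; refl; sym; trans; cong; cong₂; subst; subst₂)

-- Polynomials

ℚring : AlmostCommutativeRing 0ℓ 0ℓ
ℚring = fromCommutativeRing ℚP.+-*-commutativeRing (λ x → dec⇒maybe (0ℚ ℚP.≟ x))

Exponent : ℕ → Set
Exponent = Vec ℕ

_⊕_ : {N : ℕ} → Exponent N → Exponent N → Exponent N
_⊕_ = zipWith ℕ._+_

infixl 6 _⊕_

⊕-assoc : {N : ℕ} (α β γ : Exponent N) → (α ⊕ β) ⊕ γ ≡ α ⊕ (β ⊕ γ)
⊕-assoc = zipWith-assoc ℕP.+-assoc

⊕-comm : {N : ℕ} (α β : Exponent N) → α ⊕ β ≡ β ⊕ α
⊕-comm = zipWith-comm ℕP.+-comm

-- The pairing of p with φ, i.e. the linear extension of φ from monomials to polynomials.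
⟦_⟧ : {N : ℕ} → Poly N → (Exponent N → ℚ) → ℚ
⟦ [] ⟧ φ = 0ℚ
⟦ (c , α) ∷ p ⟧ φ = c ℚ.* φ α ℚ.+ ⟦ p ⟧ φ

⟦⟧-ext : {N : ℕ} (p : Poly N) {φ ψ : Exponent N → ℚ} → (∀ α → φ α ≡ ψ α) → ⟦ p ⟧ φ ≡ ⟦ p ⟧ ψ
⟦⟧-ext [] e = refl
⟦⟧-ext ((c , α) ∷ p) e = cong₂ ℚ._+_ (cong (c ℚ.*_) (e α)) (⟦⟧-ext p e)

⟦⟧-vanish : {N : ℕ} (p : Poly N) {φ : Exponent N → ℚ} → All (λ t → φ (proj₂ t) ≡ 0ℚ) p → ⟦ p ⟧ φ ≡ 0ℚ
⟦⟧-vanish [] [] = refl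
⟦⟧-vanish ((c , α) ∷ p) (e ∷ es) =
  trans (cong₂ ℚ._+_ (trans (cong (c ℚ.*_) e) (ℚP.*-zeroʳ c)) (⟦⟧-vanish p es)) (ℚP.+-identityˡ 0ℚ)

⟦⟧-++ : {N : ℕ} (p r : Poly N) (φ : Exponent N → ℚ) → ⟦ p ++ r ⟧ φ ≡ ⟦ p ⟧ φ ℚ.+ ⟦ r ⟧ φ
⟦⟧-++ [] r φ = sym (ℚP.+-identityˡ _)
⟦⟧-++ ((c , α) ∷ p) r φ = trans (cong (c ℚ.* φ α ℚ.+_) (⟦⟧-++ p r φ)) (sym (ℚP.+-assoc (c ℚ.* φ α) _ _))

⟦⟧-neg : {N : ℕ} (p : Poly N) (φ : Exponent N → ℚ) → ⟦ negP p ⟧ φ ≡ ℚ.- ⟦ p ⟧ φ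
⟦⟧-neg [] φ = refl
⟦⟧-neg ((c , α) ∷ p) φ = trans (cong (ℚ.- c ℚ.* φ α ℚ.+_) (⟦⟧-neg p φ)) (lemma c (φ α) (⟦ p ⟧ φ))
  where
  lemma : ∀ a b c → ℚ.- a ℚ.* b ℚ.+ ℚ.- c ≡ ℚ.- (a ℚ.* b ℚ.+ c)
  lemma = solve-∀ ℚring

⟦⟧-scale : {N : ℕ} (c : ℚ) (α : Exponent N) (r : Poly N) (φ : Exponent N → ℚ) →
  ⟦ map (λ { (d , β) → (c ℚ.* d , zipWith ℕ._+_ α β) }) r ⟧ φ ≡ c ℚ.* ⟦ r ⟧ (λ β → φ (α ⊕ β))
⟦⟧-scale c α [] φ = sym (ℚP.*-zeroʳ c)
⟦⟧-scale c α ((d , β) ∷ r) φ =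
  trans (cong (c ℚ.* d ℚ.* φ (α ⊕ β) ℚ.+_) (⟦⟧-scale c α r φ)) (lemma c d (φ (α ⊕ β)) _)
  where
  lemma : ∀ a b c d → a ℚ.* b ℚ.* c ℚ.+ a ℚ.* d ≡ a ℚ.* (b ℚ.* c ℚ.+ d)
  lemma = solve-∀ ℚring

⟦⟧-mul : {N : ℕ} (p r : Poly N) (φ : Exponent N → ℚ) →
  ⟦ mulP p r ⟧ φ ≡ ⟦ p ⟧ (λ α → ⟦ r ⟧ (λ β → φ (α ⊕ β)))
⟦⟧-mul [] r φ = refl
⟦⟧-mul ((c , α) ∷ p) r φ =
  trans (⟦⟧-++ (map (λ { (d , β) → (c ℚ.* d , zipWith ℕ._+_ α β) }) r) (mulP p r) φ)
    (cong₂ ℚ._+_ (⟦⟧-scale c α r φ) (⟦⟧-mul p r φ))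

⟦⟧-add : {N : ℕ} (p : Poly N) (φ ψ : Exponent N → ℚ) → ⟦ p ⟧ (λ α → φ α ℚ.+ ψ α) ≡ ⟦ p ⟧ φ ℚ.+ ⟦ p ⟧ ψ
⟦⟧-add [] φ ψ = refl
⟦⟧-add ((c , α) ∷ p) φ ψ =
  trans (cong (c ℚ.* (φ α ℚ.+ ψ α) ℚ.+_) (⟦⟧-add p φ ψ)) (lemma c (φ α) (ψ α) (⟦ p ⟧ φ) (⟦ p ⟧ ψ))
  where
  lemma : ∀ c a b d e → c ℚ.* (a ℚ.+ b) ℚ.+ (d ℚ.+ e) ≡ (c ℚ.* a ℚ.+ d) ℚ.+ (c ℚ.* b ℚ.+ e)
  lemma = solve-∀ ℚring

⟦⟧-mulʳ : {N : ℕ} (p : Poly N) (φ : Exponent N → ℚ) (d : ℚ) → ⟦ p ⟧ (λ α → d ℚ.* φ α) ≡ d ℚ.* ⟦ p ⟧ φ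
⟦⟧-mulʳ [] φ d = sym (ℚP.*-zeroʳ d)
⟦⟧-mulʳ ((c , α) ∷ p) φ d = trans (cong (c ℚ.* (d ℚ.* φ α) ℚ.+_) (⟦⟧-mulʳ p φ d)) (lemma c d (φ α) (⟦ p ⟧ φ))
  where
  lemma : ∀ c d a e → c ℚ.* (d ℚ.* a) ℚ.+ d ℚ.* e ≡ d ℚ.* (c ℚ.* a ℚ.+ e)
  lemma = solve-∀ ℚring

-- Fubini for finite sums; commutativity of the product comes from it.
⟦⟧-swap : {N : ℕ} (p r : Poly N) (ψ : Exponent N → Exponent N → ℚ) →
  ⟦ p ⟧ (λ α → ⟦ r ⟧ (ψ α)) ≡ ⟦ r ⟧ (λ β → ⟦ p ⟧ (λ α → ψ α β))
⟦⟧-swap [] r ψ = sym (⟦⟧-vanish r (All.universal (λ _ → refl) r))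
⟦⟧-swap ((c , α) ∷ p) r ψ =
  trans (cong₂ ℚ._+_ (sym (⟦⟧-mulʳ r (ψ α) c)) (⟦⟧-swap p r ψ))
    (sym (⟦⟧-add r (λ β → c ℚ.* ψ α β) (λ β → ⟦ p ⟧ (λ α → ψ α β))))

-- Equality under all linear functionals, under which the ring laws are immediate; ≈P⇒≋ shows that it is ≈P.
record _≋_ {N : ℕ} (p r : Poly N) : Set where
  constructor wrap
  field pair : ∀ φ → ⟦ p ⟧ φ ≡ ⟦ r ⟧ φ
open _≋_ public

infix 4 _≋_

Poly-commutativeRing : ℕ → CommutativeRing 0ℓ 0ℓ
Poly-commutativeRing N = record
  { Carrier = Poly N
  ; _≈_ = _≋_
  ; _+_ = addP
  ; _*_ = mulP
  ; -_ = negP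
  ; 0# = []
  ; 1# = constP 1ℚ
  ; isCommutativeRing = record
    { isRing = record
      { +-isAbelianGroup = record
        { isGroup = record
          { isMonoid = record
            { isSemigroup = record
              { isMagma = record
                { isEquivalence = record
                  { refl = wrap (λ _ → refl)
                  ; sym = λ e → wrap (λ φ → sym (pair e φ))
                  ; trans = λ e f → wrap (λ φ → trans (pair e φ) (pair f φ)) }
                ; ∙-cong = λ {p} {p'} {r} {r'} e f → wrap (λ φ → trans (⟦⟧-++ p r φ)
                    (trans (cong₂ ℚ._+_ (pair e φ) (pair f φ)) (sym (⟦⟧-++ p' r' φ)))) }
              ; assoc = λ p r s → wrap (λ φ → trans (⟦⟧-++ (p ++ r) s φ) (trans (cong (ℚ._+ ⟦ s ⟧ φ) (⟦⟧-++ p r φ))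
                  (trans (ℚP.+-assoc (⟦ p ⟧ φ) _ _) (trans (cong (⟦ p ⟧ φ ℚ.+_) (sym (⟦⟧-++ r s φ)))
                    (sym (⟦⟧-++ p (r ++ s) φ)))))) }
            ; identity = (λ p → wrap (λ φ → refl))
                , (λ p → wrap (λ φ → trans (⟦⟧-++ p [] φ) (ℚP.+-identityʳ _))) }
          ; inverse = (λ p → wrap (λ φ → trans (⟦⟧-++ (negP p) p φ)
                (trans (cong (ℚ._+ ⟦ p ⟧ φ) (⟦⟧-neg p φ)) (ℚP.+-inverseˡ (⟦ p ⟧ φ)))))
              , (λ p → wrap (λ φ → trans (⟦⟧-++ p (negP p) φ)
                (trans (cong (⟦ p ⟧ φ ℚ.+_) (⟦⟧-neg p φ)) (ℚP.+-inverseʳ (⟦ p ⟧ φ)))))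
          ; ⁻¹-cong = λ {p} {r} e → wrap (λ φ → trans (⟦⟧-neg p φ) (trans (cong ℚ.-_ (pair e φ)) (sym (⟦⟧-neg r φ)))) }
        ; comm = λ p r → wrap (λ φ → trans (⟦⟧-++ p r φ) (trans (ℚP.+-comm (⟦ p ⟧ φ) _) (sym (⟦⟧-++ r p φ)))) }
      ; *-cong = λ {p} {p'} {r} {r'} e f → wrap (λ φ → trans (⟦⟧-mul p r φ)
          (trans (pair e _) (trans (⟦⟧-ext p' (λ α → pair f _)) (sym (⟦⟧-mul p' r' φ)))))
      ; *-assoc = λ p r s → wrap (λ φ → trans (⟦⟧-mul (mulP p r) s φ) (trans (⟦⟧-mul p r _)
          (trans (⟦⟧-ext p (λ α → trans (⟦⟧-ext r (λ β → ⟦⟧-ext s (λ γ → cong φ (⊕-assoc α β γ))))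
              (sym (⟦⟧-mul r s _))))
            (sym (⟦⟧-mul p (mulP r s) φ)))))
      ; *-identity = *-identityˡ , (λ p → wrap (λ φ → trans (pair (*-comm p _) φ) (pair (*-identityˡ p) φ)))
      ; distrib = *-distribˡ , (λ p r s → wrap (λ φ → trans (pair (*-comm (r ++ s) p) φ)
          (trans (pair (*-distribˡ p r s) φ) (trans (⟦⟧-++ (mulP p r) (mulP p s) φ)
          (trans (cong₂ ℚ._+_ (pair (*-comm p r) φ) (pair (*-comm p s) φ)) (sym (⟦⟧-++ (mulP r p) (mulP s p) φ))))))) }
    ; *-comm = *-comm } }
  where
  *-comm : (p r : Poly N) → mulP p r ≋ mulP r p
  *-comm p r = wrap (λ φ → trans (⟦⟧-mul p r φ) (trans (⟦⟧-swap p r _)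
    (trans (⟦⟧-ext r (λ β → ⟦⟧-ext p (λ α → cong φ (⊕-comm α β)))) (sym (⟦⟧-mul r p φ)))))
  *-identityˡ : (p : Poly N) → mulP (constP 1ℚ) p ≋ p
  *-identityˡ p = wrap (λ φ → trans (⟦⟧-mul (constP 1ℚ) p φ) (trans (ℚP.+-identityʳ _) (trans (ℚP.*-identityˡ _)
    (⟦⟧-ext p (λ β → cong φ (zipWith-identityˡ ℕP.+-identityˡ β))))))
  *-distribˡ : (p r s : Poly N) → mulP p (r ++ s) ≋ mulP p r ++ mulP p s
  *-distribˡ p r s = wrap (λ φ → trans (⟦⟧-mul p (r ++ s) φ) (trans (⟦⟧-ext p (λ α → ⟦⟧-++ r s _))
    (trans (⟦⟧-add p _ _) (trans (cong₂ ℚ._+_ (sym (⟦⟧-mul p r φ)) (sym (⟦⟧-mul p s φ)))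
      (sym (⟦⟧-++ (mulP p r) (mulP p s) φ))))))

-- Coefficients and equality of polynomials

δ : {N : ℕ} → Exponent N → Exponent N → ℚ
δ γ α with ≡-dec ℕP._≟_ α γ
... | yes _ = 1ℚ
... | no _ = 0ℚ

δ-refl : {N : ℕ} (γ : Exponent N) → δ γ γ ≡ 1ℚ
δ-refl γ with ≡-dec ℕP._≟_ γ γ
... | yes _ = refl
... | no γ≢γ = ⊥-elim (γ≢γ refl)

δ-≢ : {N : ℕ} {γ α : Exponent N} → α ≢ γ → δ γ α ≡ 0ℚ
δ-≢ {γ = γ} {α} α≢γ with ≡-dec ℕP._≟_ α γ
... | yes α≡γ = ⊥-elim (α≢γ α≡γ)
... | no _ = refl

-- Coefficients are particular pairings, so the rules for pairings become rules for coefficients.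
coeffP-δ : {N : ℕ} (p : Poly N) (γ : Exponent N) → coeffP p γ ≡ ⟦ p ⟧ (δ γ)
coeffP-δ [] γ = refl
coeffP-δ ((c , α) ∷ p) γ with ≡-dec ℕP._≟_ α γ
... | yes _ = cong₂ ℚ._+_ (sym (ℚP.*-identityʳ c)) (coeffP-δ p γ)
... | no _ = trans (coeffP-δ p γ) (sym (trans (cong (ℚ._+ ⟦ p ⟧ (δ γ)) (ℚP.*-zeroʳ c)) (ℚP.+-identityˡ _)))

≋⇒≈P : {N : ℕ} {p r : Poly N} → p ≋ r → p ≈P r
≋⇒≈P {p = p} {r} e γ = trans (coeffP-δ p γ) (trans (pair e (δ γ)) (sym (coeffP-δ r γ)))

_∖_ : {N : ℕ} → Poly N → Exponent N → Poly N
[] ∖ γ = []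
((c , α) ∷ p) ∖ γ with ≡-dec ℕP._≟_ α γ
... | yes _ = p ∖ γ
... | no _ = (c , α) ∷ (p ∖ γ)

∖-length : {N : ℕ} (p : Poly N) (γ : Exponent N) → length (p ∖ γ) ℕ.≤ length p
∖-length [] γ = ℕ.z≤n
∖-length ((c , α) ∷ p) γ with ≡-dec ℕP._≟_ α γ
... | yes _ = ℕP.m≤n⇒m≤1+n (∖-length p γ)
... | no _ = ℕ.s≤s (∖-length p γ)

∖-head : {N : ℕ} (c : ℚ) (γ : Exponent N) (p : Poly N) → ((c , γ) ∷ p) ∖ γ ≡ p ∖ γ
∖-head c γ p with ≡-dec ℕP._≟_ γ γ
... | yes _ = refl
... | no γ≢γ = ⊥-elim (γ≢γ refl)

∖-All : {N : ℕ} {P : Exponent N → Set} (p : Poly N) (γ : Exponent N) →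
  All (P ∘ proj₂) p → All (λ t → P (proj₂ t) × proj₂ t ≢ γ) (p ∖ γ)
∖-All [] γ [] = []
∖-All ((c , α) ∷ p) γ (x ∷ xs) with ≡-dec ℕP._≟_ α γ
... | yes _ = ∖-All p γ xs
... | no α≢γ = (x , α≢γ) ∷ ∖-All p γ xs

-- A list may repeat an exponent. Here its terms at `γ` are gathered into one, and the remaining
-- list is free of `γ`.
extract : {N : ℕ} (p : Poly N) (γ : Exponent N) → p ≋ (coeffP p γ , γ) ∷ (p ∖ γ)
extract p γ = wrap (go p)
  where
  yes-case : ∀ c a d b → c ℚ.* a ℚ.+ (d ℚ.* a ℚ.+ b) ≡ (c ℚ.+ d) ℚ.* a ℚ.+ b
  yes-case = solve-∀ ℚring
  no-case : ∀ c a d b → c ℚ.+ (d ℚ.* a ℚ.+ b) ≡ d ℚ.* a ℚ.+ (c ℚ.+ b)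
  no-case = solve-∀ ℚring
  go : ∀ p φ → ⟦ p ⟧ φ ≡ ⟦ (coeffP p γ , γ) ∷ (p ∖ γ) ⟧ φ
  go [] φ = sym (trans (ℚP.+-identityʳ _) (ℚP.*-zeroˡ (φ γ)))
  go ((c , α) ∷ p) φ with ≡-dec ℕP._≟_ α γ
  ... | yes refl = trans (cong (c ℚ.* φ α ℚ.+_) (go p φ)) (yes-case c (φ α) (coeffP p γ) (⟦ p ∖ γ ⟧ φ))
  ... | no _ = trans (cong (c ℚ.* φ α ℚ.+_) (go p φ)) (no-case (c ℚ.* φ α) (φ γ) (coeffP p γ) (⟦ p ∖ γ ⟧ φ))

module PolyRing (N : ℕ) = CommutativeRing (Poly-commutativeRing N)

drop-zero-term : {N : ℕ} {c : ℚ} (γ : Exponent N) (p : Poly N) → c ≡ 0ℚ → (c , γ) ∷ p ≋ p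
drop-zero-term γ p refl = wrap (λ φ → trans (cong (ℚ._+ ⟦ p ⟧ φ) (ℚP.*-zeroˡ (φ γ))) (ℚP.+-identityˡ _))

≈0⇒≋[] : {N : ℕ} (p : Poly N) → (∀ γ → coeffP p γ ≡ 0ℚ) → p ≋ []
≈0⇒≋[] {N} p = go (length p) p ℕP.≤-refl
  where
  open PolyRing N using () renaming (trans to ≋-trans; sym to ≋-sym)
  go : ∀ n p → length p ℕ.≤ n → (∀ γ → coeffP p γ ≡ 0ℚ) → p ≋ []
  go n [] _ _ = wrap (λ _ → refl)
  go (suc n) p₀@((c , α) ∷ p) (ℕ.s≤s l) z = ≋-trans step
    (go n (p₀ ∖ α) (subst (λ r → length r ℕ.≤ n) (sym (∖-head c α p)) (ℕP.≤-trans (∖-length p α) l))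
      (λ γ → trans (sym (≋⇒≈P step γ)) (z γ)))
    where
    step : p₀ ≋ p₀ ∖ α
    step = ≋-trans (extract p₀ α) (drop-zero-term α (p₀ ∖ α) (z α))

coeffP-++ : {N : ℕ} (p r : Poly N) (γ : Exponent N) → coeffP (p ++ r) γ ≡ coeffP p γ ℚ.+ coeffP r γ
coeffP-++ p r γ = trans (coeffP-δ (p ++ r) γ) (trans (⟦⟧-++ p r (δ γ))
  (sym (cong₂ ℚ._+_ (coeffP-δ p γ) (coeffP-δ r γ))))

coeffP-neg : {N : ℕ} (p : Poly N) (γ : Exponent N) → coeffP (negP p) γ ≡ ℚ.- coeffP p γ
coeffP-neg p γ = trans (coeffP-δ (negP p) γ) (trans (⟦⟧-neg p (δ γ)) (sym (cong ℚ.-_ (coeffP-δ p γ))))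

≈P⇒≋ : {N : ℕ} {p r : Poly N} → p ≈P r → p ≋ r
≈P⇒≋ {N} {p} {r} e = x∙y⁻¹≈ε⇒x≈y p r (≈0⇒≋[] (p ++ negP r) (λ γ → trans (coeffP-++ p (negP r) γ)
    (trans (cong₂ ℚ._+_ (e γ) (coeffP-neg r γ)) (ℚP.+-inverseʳ (coeffP r γ)))))
  where
  open PolyRing N using (+-group)
  open import Algebra.Properties.Group +-group using (x∙y⁻¹≈ε⇒x≈y)

-- The lexicographic monomial order and the absence of zero divisors

_≺_ : {N : ℕ} → Exponent N → Exponent N → Set
[] ≺ [] = ⊥
(a ∷ α) ≺ (b ∷ β) = a ℕ.< b ⊎ (a ≡ b × α ≺ β)

infix 4 _≺_ _≼_

_≼_ : {N : ℕ} → Exponent N → Exponent N → Set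
α ≼ β = α ≺ β ⊎ α ≡ β

≺-cmp : {N : ℕ} → (α β : Exponent N) → α ≺ β ⊎ α ≡ β ⊎ β ≺ α
≺-cmp [] [] = inj₂ (inj₁ refl)
≺-cmp (a ∷ α) (b ∷ β) with ℕP.<-cmp a b
... | tri< a<b _ _ = inj₁ (inj₁ a<b)
... | tri> _ _ b<a = inj₂ (inj₂ (inj₁ b<a))
... | tri≈ _ refl _ with ≺-cmp α β
...   | inj₁ α≺β = inj₁ (inj₂ (refl , α≺β))
...   | inj₂ (inj₁ refl) = inj₂ (inj₁ refl)
...   | inj₂ (inj₂ β≺α) = inj₂ (inj₂ (inj₂ (refl , β≺α)))

≺-irrefl : {N : ℕ} (α : Exponent N) → ¬ (α ≺ α)
≺-irrefl (a ∷ α) (inj₁ a<a) = ℕP.<-irrefl refl a<a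
≺-irrefl (a ∷ α) (inj₂ (_ , α≺α)) = ≺-irrefl α α≺α

≺-trans : {N : ℕ} {α β γ : Exponent N} → α ≺ β → β ≺ γ → α ≺ γ
≺-trans {α = []} {[]} {[]} () _
≺-trans {α = _ ∷ _} {_ ∷ _} {_ ∷ _} (inj₁ a<b) (inj₁ b<c) = inj₁ (ℕP.<-trans a<b b<c)
≺-trans {α = _ ∷ _} {_ ∷ _} {_ ∷ _} (inj₁ a<b) (inj₂ (refl , _)) = inj₁ a<b
≺-trans {α = _ ∷ _} {_ ∷ _} {_ ∷ _} (inj₂ (refl , _)) (inj₁ b<c) = inj₁ b<c
≺-trans {α = _ ∷ _} {_ ∷ _} {_ ∷ _} (inj₂ (refl , p)) (inj₂ (refl , q)) = inj₂ (refl , ≺-trans p q)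

⊕-monoˡ-≺ : {N : ℕ} {α α' : Exponent N} (β : Exponent N) → α ≺ α' → α ⊕ β ≺ α' ⊕ β
⊕-monoˡ-≺ {α = []} {[]} [] ()
⊕-monoˡ-≺ {α = _ ∷ _} {_ ∷ _} (b ∷ β) (inj₁ a<a') = inj₁ (ℕP.+-monoˡ-< b a<a')
⊕-monoˡ-≺ {α = _ ∷ _} {_ ∷ _} (b ∷ β) (inj₂ (refl , p)) = inj₂ (refl , ⊕-monoˡ-≺ β p)

⊕-monoʳ-≺ : {N : ℕ} (α : Exponent N) {β β' : Exponent N} → β ≺ β' → α ⊕ β ≺ α ⊕ β'
⊕-monoʳ-≺ α {β} {β'} p = subst₂ _≺_ (⊕-comm β α) (⊕-comm β' α) (⊕-monoˡ-≺ α p)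

record LeadingTerm {N : ℕ} (p : Poly N) : Set where
  constructor leading
  field
    coeff : ℚ
    expo : Exponent N
    tail : Poly N
    split : p ≋ (coeff , expo) ∷ tail
    below : All (λ t → proj₂ t ≺ expo) tail
    nonzero : coeff ≢ 0ℚ

maxExponent : {N : ℕ} (t : ℚ × Exponent N) (p : Poly N) →
  Σ (Exponent N) λ γ → Any (λ s → proj₂ s ≡ γ) (t ∷ p) × All (λ s → proj₂ s ≼ γ) (t ∷ p)
maxExponent (c , α) [] = α , here refl , inj₂ refl ∷ []
maxExponent {N} (c , α) (t ∷ p) with maxExponent t p
... | γ , γ∈ , p≼γ with ≺-cmp α γ
...   | inj₁ α≺γ = γ , there γ∈ , inj₁ α≺γ ∷ p≼γ
...   | inj₂ (inj₁ α≡γ) = γ , there γ∈ , inj₂ α≡γ ∷ p≼γ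
...   | inj₂ (inj₂ γ≺α) = α , here refl , inj₂ refl ∷ All.map up p≼γ
  where
  up : {ζ : Exponent N} → ζ ≼ γ → ζ ≼ α
  up (inj₁ ζ≺γ) = inj₁ (≺-trans ζ≺γ γ≺α)
  up (inj₂ refl) = inj₁ γ≺α

∖-shorter : {N : ℕ} (p : Poly N) {γ : Exponent N} → Any (λ s → proj₂ s ≡ γ) p → length (p ∖ γ) ℕ.< length p
∖-shorter ((c , γ) ∷ p) (here refl) = ℕ.s≤s (subst (λ r → length r ℕ.≤ length p) (sym (∖-head c γ p)) (∖-length p γ))
∖-shorter ((c , α) ∷ p) {γ} (there a) with ≡-dec ℕP._≟_ α γ
... | yes _ = ℕ.s≤s (∖-length p γ)
... | no _ = ℕ.s≤s (∖-shorter p a)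

-- The largest exponent in the list may have coefficient zero by cancellation. Its terms are then
-- dropped and the search goes on in a shorter list.
leadingTerm : {N : ℕ} (p : Poly N) → NonzeroP p → LeadingTerm p
leadingTerm {N} p₀ = go (length p₀) p₀ ℕP.≤-refl
  where
  open PolyRing N using () renaming (trans to ≋-trans; sym to ≋-sym)
  strict : {α γ : Exponent N} → α ≼ γ × α ≢ γ → α ≺ γ
  strict (inj₁ α≺γ , _) = α≺γ
  strict (inj₂ α≡γ , α≢γ) = ⊥-elim (α≢γ α≡γ)
  drop : ∀ p γ → coeffP p γ ≡ 0ℚ → p ≋ p ∖ γ
  drop p γ c≡0 = ≋-trans (extract p γ) (drop-zero-term γ (p ∖ γ) c≡0)
  go : ∀ n p → length p ℕ.≤ n → NonzeroP p → LeadingTerm p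
  go n [] _ (γ , nz) = ⊥-elim (nz refl)
  go (suc n) p@(t ∷ q) l (ζ , nz) with maxExponent t q
  ... | γ , γ∈ , p≼γ with coeffP p γ ℚP.≟ 0ℚ
  ...   | no c≢0 = leading (coeffP p γ) γ (p ∖ γ) (extract p γ) (All.map strict (∖-All p γ p≼γ)) c≢0
  ...   | yes c≡0 with go n (p ∖ γ) (ℕP.≤-pred (ℕP.≤-trans (∖-shorter p γ∈) l)) (ζ , λ z → nz (trans (≋⇒≈P (drop p γ c≡0) ζ) z))
  ...     | leading c ε r e b nz' = leading c ε r (≋-trans (drop p γ c≡0) e) b nz'

pq≡0⇒q≡0 : ∀ p q → p ≢ 0ℚ → p ℚ.* q ≡ 0ℚ → q ≡ 0ℚ
pq≡0⇒q≡0 p q p≢0 e = trans (sym (ℚP.*-identityˡ q)) (trans (cong (ℚ._* q) (sym (ℚP.*-inverseˡ p)))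
  (trans (ℚP.*-assoc (ℚ.1/ p) p q) (trans (cong (ℚ.1/ p ℚ.*_) e) (ℚP.*-zeroʳ (ℚ.1/ p)))))
  where
  instance
    _ : ℚ.NonZero p
    _ = ℚ.≢-nonZero p≢0

NonzeroP-resp-≋ : {N : ℕ} {p r : Poly N} → p ≋ r → NonzeroP p → NonzeroP r
NonzeroP-resp-≋ e (γ , nz) = γ , λ z → nz (trans (≋⇒≈P e γ) z)

abstract
  -- The sum of the leading exponents is reached by no other pair of terms, so the coefficient there
  -- is the product of the leading coefficients. The proof is part of every sum and product of
  -- fractions, and `abstract` keeps it folded.
  mulP-nonzero : {N : ℕ} {p r : Poly N} → NonzeroP p → NonzeroP r → NonzeroP (mulP p r)
  mulP-nonzero {N} {p} {r} p≢0 r≢0 with leadingTerm p p≢0 | leadingTerm r r≢0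
  ... | leading c γ t e b c≢0 | leading d ε s f b' d≢0 =
    NonzeroP-resp-≋ (≋-sym (*-cong e f)) (γ ⊕ ε , λ z → d≢0 (pq≡0⇒q≡0 c d c≢0 (trans (sym value) z)))
    where
    open PolyRing N using (*-cong) renaming (sym to ≋-sym)
    top : ∀ α → α ≼ γ → ⟦ s ⟧ (λ β → δ (γ ⊕ ε) (α ⊕ β)) ≡ 0ℚ
    top α α≼γ = ⟦⟧-vanish s (All.map (λ {u} β≺ε → δ-≢ (λ eq → ≺-irrefl (γ ⊕ ε)
      (subst (_≺ γ ⊕ ε) eq (lower (proj₂ u) α≼γ β≺ε)))) b')
      where
      lower : ∀ β → α ≼ γ → β ≺ ε → α ⊕ β ≺ γ ⊕ ε
      lower β (inj₁ α≺γ) β≺ε = ≺-trans (⊕-monoˡ-≺ β α≺γ) (⊕-monoʳ-≺ γ β≺ε)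
      lower β (inj₂ refl) β≺ε = ⊕-monoʳ-≺ α β≺ε
    inner : Exponent N → ℚ
    inner α = ⟦ (d , ε) ∷ s ⟧ (λ β → δ (γ ⊕ ε) (α ⊕ β))
    inner-top : inner γ ≡ d
    inner-top = trans (cong₂ ℚ._+_ (trans (cong (d ℚ.*_) (δ-refl (γ ⊕ ε))) (ℚP.*-identityʳ d)) (top γ (inj₂ refl)))
      (ℚP.+-identityʳ d)
    inner-below : ∀ α → α ≺ γ → inner α ≡ 0ℚ
    inner-below α α≺γ = trans (cong₂ ℚ._+_ (trans (cong (d ℚ.*_) (δ-≢ (λ eq → ≺-irrefl (γ ⊕ ε)
      (subst (_≺ γ ⊕ ε) eq (⊕-monoˡ-≺ ε α≺γ))))) (ℚP.*-zeroʳ d)) (top α (inj₁ α≺γ))) (ℚP.+-identityʳ 0ℚ)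
    value : coeffP (mulP ((c , γ) ∷ t) ((d , ε) ∷ s)) (γ ⊕ ε) ≡ c ℚ.* d
    value = trans (coeffP-δ (mulP ((c , γ) ∷ t) ((d , ε) ∷ s)) (γ ⊕ ε))
      (trans (⟦⟧-mul ((c , γ) ∷ t) ((d , ε) ∷ s) (δ (γ ⊕ ε)))
      (trans (cong₂ ℚ._+_ (cong (c ℚ.*_) inner-top) (⟦⟧-vanish t (All.map (λ {u} → inner-below (proj₂ u)) b)))
        (ℚP.+-identityʳ _)))

mulP-zero⇒zero : {N : ℕ} (p r : Poly N) → NonzeroP r → mulP p r ≋ [] → p ≋ []
mulP-zero⇒zero p r r≢0 e = ≈0⇒≋[] p (λ γ → decidable-stable (coeffP p γ ℚP.≟ 0ℚ)
  (λ c≢0 → let (ζ , nz) = mulP-nonzero {p = p} (γ , c≢0) r≢0 in nz (≋⇒≈P e ζ)))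

mulP-cancelʳ : {N : ℕ} (p p' r : Poly N) → NonzeroP r → mulP p r ≋ mulP p' r → p ≋ p'
mulP-cancelʳ {N} p p' r r≢0 e = x∙y⁻¹≈ε⇒x≈y p p' (mulP-zero⇒zero _ r r≢0
  (≋-trans (distribʳ r p (negP p')) (≋-trans (+-congˡ (≋-sym (-‿distribˡ-* p' r))) (x≈y⇒x∙y⁻¹≈ε e))))
  where
  open PolyRing N using (+-group; ring; distribʳ; +-congˡ) renaming (trans to ≋-trans; sym to ≋-sym)
  open import Algebra.Properties.Group +-group using (x∙y⁻¹≈ε⇒x≈y; x≈y⇒x∙y⁻¹≈ε)
  open import Algebra.Properties.Ring ring using (-‿distribˡ-*)

-- Rational functions

Rational : ℕ → Set
Rational N = Σ (RatFun N) ValidR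

-- The cross multiplication of `_≈R_`, stated with `_≋_` so that the ring laws of polynomials apply.
record _≃_ {N : ℕ} (x y : Rational N) : Set where
  constructor wrap
  field cross : mulP (num (proj₁ x)) (den (proj₁ y)) ≋ mulP (num (proj₁ y)) (den (proj₁ x))
open _≃_ public

infix 4 _≃_

≃⇒≈R : {N : ℕ} {x y : Rational N} → x ≃ y → proj₁ x ≈R proj₁ y
≃⇒≈R e = ≋⇒≈P (cross e)

≈R⇒≃ : {N : ℕ} {x y : Rational N} → proj₁ x ≈R proj₁ y → x ≃ y
≈R⇒≃ e = wrap (≈P⇒≋ e)

abstract
  NonzeroP-constP : {N : ℕ} → NonzeroP (constP {N} 1ℚ)
  NonzeroP-constP {N} = replicate N 0 , λ z → ℚP.1≢0 (trans (sym value) z)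
    where
    value : coeffP (constP {N} 1ℚ) (replicate N 0) ≡ 1ℚ
    value = trans (coeffP-δ (constP 1ℚ) (replicate N 0)) (cong (λ x → 1ℚ ℚ.* x ℚ.+ 0ℚ) (δ-refl (replicate N 0)))

infixl 6 _⊞_
infixl 7 _⊠_
infix 8 ⊟_

_⊞_ _⊠_ : {N : ℕ} → Rational N → Rational N → Rational N
x ⊞ y = addR (proj₁ x) (proj₁ y) , mulP-nonzero {p = den (proj₁ x)} (proj₂ x) (proj₂ y)
x ⊠ y = mulR (proj₁ x) (proj₁ y) , mulP-nonzero {p = den (proj₁ x)} (proj₂ x) (proj₂ y)

⊟_ : {N : ℕ} → Rational N → Rational N
⊟ ((a ⟋ b) , b≢0) = (negP a ⟋ b) , b≢0

fromPolyK : {N : ℕ} → Poly N → Rational N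
fromPolyK p = fromPoly p , NonzeroP-constP

0K 1K : {N : ℕ} → Rational N
0K = zeroR , NonzeroP-constP
1K = oneR , NonzeroP-constP

Rational-commutativeRing : ℕ → CommutativeRing 0ℓ 0ℓ
Rational-commutativeRing N = record
  { Carrier = Rational N
  ; _≈_ = _≃_
  ; _+_ = _⊞_
  ; _*_ = _⊠_
  ; -_ = ⊟_
  ; 0# = 0K
  ; 1# = 1K
  ; isCommutativeRing = record
    { isRing = record
      { +-isAbelianGroup = record
        { isGroup = record
          { isMonoid = record
            { isSemigroup = record
              { isMagma = record
                { isEquivalence = record { refl = wrap ≋-refl ; sym = λ e → wrap (≋-sym (cross e)) ; trans = ≃-trans }
                ; ∙-cong = ⊞-cong }
              ; assoc = λ { ((a ⟋ b) , _) ((c ⟋ d) , _) ((e ⟋ f) , _) → wrap (I.+-assoc-identity a b c d e f) } }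
            ; identity = +-identityˡ , (λ x → ≃-trans (⊞-comm x 0K) (+-identityˡ x)) }
          ; inverse = +-inverseˡ , (λ x → ≃-trans (⊞-comm x (⊟ x)) (+-inverseˡ x))
          ; ⁻¹-cong = λ { {(a ⟋ b) , _} {(a' ⟋ b') , _} p → wrap
              (≋-trans (≋-sym (-‿distribˡ-* a b')) (≋-trans (-‿cong (cross p)) (-‿distribˡ-* a' b))) } }
        ; comm = ⊞-comm }
      ; *-cong = ⊠-cong
      ; *-assoc = λ { ((a ⟋ b) , _) ((c ⟋ d) , _) ((e ⟋ f) , _) → wrap (I.*-assoc-identity a b c d e f) }
      ; *-identity = *-identityˡ , (λ x → ≃-trans (⊠-comm x 1K) (*-identityˡ x))
      ; distrib = distribˡ , (λ x y z → ≃-trans (⊠-comm (y ⊞ z) x) (≃-trans (distribˡ x y z)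
          (⊞-cong (⊠-comm x y) (⊠-comm x z)))) }
    ; *-comm = ⊠-comm } }
  where
  module I = FractionIdentities (Poly-commutativeRing N)
  open PolyRing N using (ring; -‿cong) renaming (trans to ≋-trans; sym to ≋-sym; refl to ≋-refl)
  open import Algebra.Properties.Ring ring using (-‿distribˡ-*)
  ≃-trans : {x y z : Rational N} → x ≃ y → y ≃ z → x ≃ z
  ≃-trans {(a ⟋ b) , _} {(c ⟋ d) , d≢0} {(e ⟋ f) , _} p q =
    wrap (mulP-cancelʳ _ _ d d≢0 (I.trans-identity a b c d e f (cross p) (cross q)))
  ⊞-cong : {x x' y y' : Rational N} → x ≃ x' → y ≃ y' → x ⊞ y ≃ x' ⊞ y'
  ⊞-cong {(a ⟋ b) , _} {(a' ⟋ b') , _} {(c ⟋ d) , _} {(c' ⟋ d') , _} p q =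
    wrap (I.+-cong-identity a b c d a' b' c' d' (cross p) (cross q))
  ⊠-cong : {x x' y y' : Rational N} → x ≃ x' → y ≃ y' → x ⊠ y ≃ x' ⊠ y'
  ⊠-cong {(a ⟋ b) , _} {(a' ⟋ b') , _} {(c ⟋ d) , _} {(c' ⟋ d') , _} p q =
    wrap (I.*-cong-identity a b c d a' b' c' d' (cross p) (cross q))
  ⊞-comm : (x y : Rational N) → x ⊞ y ≃ y ⊞ x
  ⊞-comm ((a ⟋ b) , _) ((c ⟋ d) , _) = wrap (I.+-comm-identity a b c d)
  ⊠-comm : (x y : Rational N) → x ⊠ y ≃ y ⊠ x
  ⊠-comm ((a ⟋ b) , _) ((c ⟋ d) , _) = wrap (I.*-comm-identity a b c d)
  +-identityˡ : (x : Rational N) → 0K ⊞ x ≃ x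
  +-identityˡ ((a ⟋ b) , _) = wrap (I.+-identityˡ-identity a b)
  +-inverseˡ : (x : Rational N) → ⊟ x ⊞ x ≃ 0K
  +-inverseˡ ((a ⟋ b) , _) = wrap (I.+-inverseˡ-identity a b)
  *-identityˡ : (x : Rational N) → 1K ⊠ x ≃ x
  *-identityˡ ((a ⟋ b) , _) = wrap (I.*-identityˡ-identity a b)
  distribˡ : (x y z : Rational N) → x ⊠ (y ⊞ z) ≃ (x ⊠ y) ⊞ (x ⊠ z)
  distribˡ ((a ⟋ b) , _) ((c ⟋ d) , _) ((e ⟋ f) , _) = wrap (I.distribˡ-identity a b c d e f)

module RationalRing (N : ℕ) = CommutativeRing (Rational-commutativeRing N)

module _ {N : ℕ} where
  open PolyRing N using (*-identityʳ; *-congʳ) renaming (trans to ≋-trans; sym to ≋-sym)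
  private
    module I = FractionIdentities (Poly-commutativeRing N)

  inverse : (x : Rational N) → NonzeroP (num (proj₁ x)) → Rational N
  inverse ((a ⟋ b) , _) a≢0 = (b ⟋ a) , a≢0

  inverseˡ : (x : Rational N) (x≢0 : NonzeroP (num (proj₁ x))) → inverse x x≢0 ⊠ x ≃ 1K
  inverseˡ ((a ⟋ b) , _) _ = wrap (I.inverse-identity a b)

  fromPolyK-cong : {p r : Poly N} → p ≋ r → fromPolyK p ≃ fromPolyK r
  fromPolyK-cong e = wrap (*-congʳ e)

  fromPolyK-injective : {p r : Poly N} → fromPolyK p ≃ fromPolyK r → p ≋ r
  fromPolyK-injective {p} {r} e = ≋-trans (≋-sym (*-identityʳ p)) (≋-trans (cross e) (*-identityʳ r))

  fromPolyK-+ : (p r : Poly N) → fromPolyK p ⊞ fromPolyK r ≃ fromPolyK (addP p r)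
  fromPolyK-+ p r = wrap (I.fromPoly-+-identity p r)

  fromPolyK-* : (p r : Poly N) → fromPolyK p ⊠ fromPolyK r ≃ fromPolyK (mulP p r)
  fromPolyK-* p r = wrap (I.fromPoly-*-identity p r)

  fromPolyK-neg : (p : Poly N) → ⊟ fromPolyK p ≃ fromPolyK (negP p)
  fromPolyK-neg p = wrap (PolyRing.refl N)

-- Cones over ℚ and their lattice points

module Geometry where
  open import Data.Rational using (_+_; _*_; _-_; -_; _≤_; _<_; _≤?_; _<?_)

  ≤⇒0≤- : ∀ {a b} → a ≤ b → 0ℚ ≤ b - a
  ≤⇒0≤- {a} {b} a≤b = subst (_≤ b - a) (ℚP.+-inverseʳ a) (ℚP.+-monoˡ-≤ (- a) a≤b)

  <⇒0<- : ∀ {a b} → a < b → 0ℚ < b - a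
  <⇒0<- {a} {b} a<b = subst (_< b - a) (ℚP.+-inverseʳ a) (ℚP.+-monoˡ-< (- a) a<b)

  minus-plus : ∀ b a → b - a + a ≡ b
  minus-plus = solve-∀ ℚring

  0≤-⇒≤ : ∀ {a b} → 0ℚ ≤ b - a → a ≤ b
  0≤-⇒≤ {a} {b} h = subst₂ _≤_ (ℚP.+-identityˡ a) (minus-plus b a) (ℚP.+-monoˡ-≤ a h)

  0<-⇒< : ∀ {a b} → 0ℚ < b - a → a < b
  0<-⇒< {a} {b} h = subst₂ _<_ (ℚP.+-identityˡ a) (minus-plus b a) (ℚP.+-monoˡ-< a h)

  0≤+ : ∀ {a b} → 0ℚ ≤ a → 0ℚ ≤ b → 0ℚ ≤ a + b
  0≤+ {a} {b} p q = ℚP.+-mono-≤ {0ℚ} {a} {0ℚ} {b} p q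

  0≤* : ∀ {a b} → 0ℚ ≤ a → 0ℚ ≤ b → 0ℚ ≤ a * b
  0≤* {a} {b} p q = subst (_≤ a * b) (ℚP.*-zeroʳ a) (ℚP.*-monoˡ-≤-nonNeg a {{ℚ.nonNegative p}} q)

  0<* : ∀ {a b} → 0ℚ < a → 0ℚ < b → 0ℚ < a * b
  0<* {a} {b} p q = subst (_< a * b) (ℚP.*-zeroʳ a) (ℚP.*-monoʳ-<-pos a {{ℚ.positive p}} q)

  0≤*-cancel : ∀ {c a} → 0ℚ < c → 0ℚ ≤ c * a → 0ℚ ≤ a
  0≤*-cancel {c} {a} p q = ℚP.*-cancelˡ-≤-pos c {{ℚ.positive p}} (subst (_≤ c * a) (sym (ℚP.*-zeroʳ c)) q)

  0≤-resp : ∀ {a b} → a ≡ b → 0ℚ ≤ a → 0ℚ ≤ b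
  0≤-resp = subst (0ℚ ≤_)

  <0⇒0<- : ∀ {b} → b < 0ℚ → 0ℚ < - b
  <0⇒0<- = ℚP.neg-antimono-<

  divide : ∀ a b → 0ℚ < b → ∃ λ c → c * b ≡ a
  divide a b 0<b = a * ℚ.1/ b , trans (ℚP.*-assoc a (ℚ.1/ b) b) (trans (cong (a *_) (ℚP.*-inverseˡ b)) (ℚP.*-identityʳ a))
    where
    instance
      _ : ℚ.NonZero b
      _ = ℚP.pos⇒nonZero b {{ℚ.positive 0<b}}

  Point : ℕ → Set
  Point = Vec ℚ

  infixl 6 _+ᵥ_ _-ᵥ_
  infixr 7 _·_

  _+ᵥ_ _-ᵥ_ : {k : ℕ} → Point k → Point k → Point k
  _+ᵥ_ = zipWith _+_
  _-ᵥ_ = zipWith _-_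

  _·_ : {k : ℕ} → ℚ → Point k → Point k
  c · a = Vec.map (c *_) a

  0ᵥ : {k : ℕ} → Point k
  0ᵥ = replicate _ 0ℚ

  dot : {k : ℕ} → Point k → Point k → ℚ
  dot [] [] = 0ℚ
  dot (x ∷ ℓ) (y ∷ a) = x * y + dot ℓ a

  dot-minus-scale : {k : ℕ} (ℓ a w : Point k) (t : ℚ) → dot ℓ (a -ᵥ t · w) ≡ dot ℓ a - t * dot ℓ w
  dot-minus-scale [] [] [] t = lemma t
    where
    lemma : ∀ t → 0ℚ ≡ 0ℚ - t * 0ℚ
    lemma = solve-∀ ℚring
  dot-minus-scale (x ∷ ℓ) (y ∷ a) (z ∷ w) t =
    trans (cong (x * (y - t * z) +_) (dot-minus-scale ℓ a w t)) (lemma x y z t (dot ℓ a) (dot ℓ w))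
    where
    lemma : ∀ x y z t d e → x * (y - t * z) + (d - t * e) ≡ (x * y + d) - t * (x * z + e)
    lemma = solve-∀ ℚring

  dot-combine : {k : ℕ} (ℓ ℓ' a : Point k) (c d : ℚ) → dot (c · ℓ -ᵥ d · ℓ') a ≡ c * dot ℓ a - d * dot ℓ' a
  dot-combine [] [] [] c d = lemma c d
    where
    lemma : ∀ c d → 0ℚ ≡ c * 0ℚ - d * 0ℚ
    lemma = solve-∀ ℚring
  dot-combine (x ∷ ℓ) (y ∷ ℓ') (z ∷ a) c d =
    trans (cong ((c * x - d * y) * z +_) (dot-combine ℓ ℓ' a c d)) (lemma c d x y z (dot ℓ a) (dot ℓ' a))
    where
    lemma : ∀ c d x y z e f → (c * x - d * y) * z + (c * e - d * f) ≡ c * (x * z + e) - d * (y * z + f)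
    lemma = solve-∀ ℚring

  comb : {k m : ℕ} → Vec ℚ m → Vec (Point k) m → Point k
  comb [] [] = 0ᵥ
  comb (t ∷ ts) (w ∷ W) = t · w +ᵥ comb ts W

  Nonneg : {m : ℕ} → Vec ℚ m → Set
  Nonneg = VAll.All (0ℚ ≤_)

  InCone : {k m : ℕ} → Vec (Point k) m → Point k → Set
  InCone W a = ∃ λ ts → Nonneg ts × comb ts W ≡ a

  Satisfies : {k : ℕ} → List (Point k) → Point k → Set
  Satisfies F a = ∀ {ℓ} → ℓ ∈ F → 0ℚ ≤ dot ℓ a

  -- The description of a finitely generated cone by finitely many half-spaces. It makes membership
  -- decidable and turns the search for a least coefficient into finitely many linear inequalities.
  record Facets {k m : ℕ} (W : Vec (Point k) m) : Set where
    field
      forms : List (Point k)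
      sound : ∀ {a} → InCone W a → Satisfies forms a
      complete : ∀ {a} → Satisfies forms a → InCone W a
  open Facets

  -- No generators span only the origin, cut out by `x ≥ 0` and `- x ≥ 0` for each coordinate.
  originForms : (k : ℕ) → List (Point k)
  originForms zero = []
  originForms (suc k) = (1ℚ ∷ 0ᵥ) ∷ (- 1ℚ ∷ 0ᵥ) ∷ List.map (0ℚ ∷_) (originForms k)

  dot-0ᵥˡ : {k : ℕ} (a : Point k) → dot 0ᵥ a ≡ 0ℚ
  dot-0ᵥˡ [] = refl
  dot-0ᵥˡ (x ∷ a) = trans (cong₂ _+_ (ℚP.*-zeroˡ x) (dot-0ᵥˡ a)) (ℚP.+-identityˡ 0ℚ)

  dot-0ᵥʳ : {k : ℕ} (ℓ : Point k) → dot ℓ 0ᵥ ≡ 0ℚ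
  dot-0ᵥʳ [] = refl
  dot-0ᵥʳ (x ∷ a) = trans (cong₂ _+_ (ℚP.*-zeroʳ x) (dot-0ᵥʳ a)) (ℚP.+-identityˡ 0ℚ)

  originForms-complete : {k : ℕ} (a : Point k) → Satisfies (originForms k) a → 0ᵥ ≡ a
  originForms-complete [] s = refl
  originForms-complete (x ∷ a) s = cong₂ _∷_ (ℚP.≤-antisym 0≤x x≤0) (originForms-complete a
    (λ {ℓ} ℓ∈ → 0≤-resp (trans (cong (_+ dot ℓ a) (ℚP.*-zeroˡ x)) (ℚP.+-identityˡ _)) (s (there (there (∈-map⁺ (0ℚ ∷_) ℓ∈))))))
    where
    first : ∀ c → c * x + dot 0ᵥ a ≡ c * x
    first c = trans (cong (c * x +_) (dot-0ᵥˡ a)) (ℚP.+-identityʳ _)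
    0≤x : 0ℚ ≤ x
    0≤x = 0≤-resp (trans (first 1ℚ) (ℚP.*-identityˡ x)) (s (here refl))
    lemma : ∀ x → - 1ℚ * x ≡ 0ℚ - x
    lemma = solve-∀ ℚring
    x≤0 : x ≤ 0ℚ
    x≤0 = 0≤-⇒≤ (0≤-resp (trans (first (- 1ℚ)) (lemma x)) (s (there (here refl))))

  -- The constraint 0 ≤ α - t β with β < 0 reads t ≥ α / β.
  tightest : {k : ℕ} (L : List (Point k)) (a w : Point k) → (∀ {ℓ} → ℓ ∈ L → dot ℓ w < 0ℚ) →
    ∃ λ t → 0ℚ ≤ t × (∀ {ℓ} → ℓ ∈ L → 0ℚ ≤ dot ℓ a - t * dot ℓ w) ×
      (t ≡ 0ℚ ⊎ ∃ λ ℓ → ℓ ∈ L × dot ℓ a ≡ t * dot ℓ w)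
  tightest [] a w neg = 0ℚ , ℚP.≤-refl , (λ ()) , inj₁ refl
  tightest (ℓ ∷ L) a w neg with tightest L a w (λ ℓ∈ → neg (there ℓ∈))
  ... | t , 0≤t , ok , tight with 0ℚ ≤? dot ℓ a - t * dot ℓ w
  ...   | yes p = t , 0≤t , (λ { (here refl) → p ; (there ℓ∈) → ok ℓ∈ }) , weaken tight
    where
    weaken : _ → _
    weaken (inj₁ e) = inj₁ e
    weaken (inj₂ (ℓ' , ℓ'∈ , e)) = inj₂ (ℓ' , there ℓ'∈ , e)
  -- The new constraint fails at `t`, so `t` is raised to the value that makes it an equality. The
  -- constraints handled before only become slacker, since their value at `w` is negative.
  ...   | no ¬p = t' , ℚP.≤-trans 0≤t (ℚP.<⇒≤ t<t') , ok' , inj₂ (ℓ , here refl , tight')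
    where
    α β : ℚ
    α = dot ℓ a
    β = dot ℓ w
    q = divide (- α) (- β) (<0⇒0<- (neg (here refl)))
    t' : ℚ
    t' = proj₁ q
    lemma₁ : ∀ t β → - (t * - β) ≡ t * β
    lemma₁ = solve-∀ ℚring
    lemma₂ : ∀ α → - - α ≡ α
    lemma₂ = solve-∀ ℚring
    tight' : α ≡ t' * β
    tight' = trans (sym (lemma₂ α)) (trans (cong -_ (sym (proj₂ q))) (lemma₁ t' β))
    lemma₃ : ∀ t t' β → 0ℚ - (t' * β - t * β) ≡ (- β) * (t' - t)
    lemma₃ = solve-∀ ℚring
    lemma₄ : ∀ t t' β α → (α - t * β) + (- β) * (t' - t) ≡ α - t' * β
    lemma₄ = solve-∀ ℚring
    t<t' : t < t'
    t<t' = 0<-⇒< (ℚP.*-cancelˡ-<-nonNeg (- β) {{ℚ.nonNegative (ℚP.<⇒≤ (<0⇒0<- (neg (here refl))))}}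
      (subst₂ _<_ (sym (ℚP.*-zeroʳ (- β))) (trans (cong (λ x → 0ℚ - (x - t * β)) tight') (lemma₃ t t' β))
        (<⇒0<- (ℚP.≰⇒> ¬p))))
    ok' : ∀ {ℓ'} → ℓ' ∈ ℓ ∷ L → 0ℚ ≤ dot ℓ' a - t' * dot ℓ' w
    ok' (here refl) = ℚP.≤-reflexive (sym (trans (cong (_- t' * β) tight') (ℚP.+-inverseʳ (t' * β))))
    ok' {ℓ'} (there ℓ∈) = 0≤-resp (lemma₄ t t' (dot ℓ' w) (dot ℓ' a))
      (0≤+ (ok ℓ∈) (0≤* (ℚP.<⇒≤ (<0⇒0<- (neg (there ℓ∈)))) (≤⇒0≤- (ℚP.<⇒≤ t<t'))))

  plus-minusᵥ : {k : ℕ} (x y : Point k) → x +ᵥ (y -ᵥ x) ≡ y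
  plus-minusᵥ [] [] = refl
  plus-minusᵥ (x ∷ xs) (y ∷ ys) = cong₂ _∷_ (lemma x y) (plus-minusᵥ xs ys)
    where
    lemma : ∀ x y → x + (y - x) ≡ y
    lemma = solve-∀ ℚring

  minus-plusᵥ : {k : ℕ} (x y : Point k) → (x +ᵥ y) -ᵥ x ≡ y
  minus-plusᵥ [] [] = refl
  minus-plusᵥ (x ∷ xs) (y ∷ ys) = cong₂ _∷_ (lemma x y) (minus-plusᵥ xs ys)
    where
    lemma : ∀ x y → x + y - x ≡ y
    lemma = solve-∀ ℚring

  InCone-∷⁺ : {k m : ℕ} {w : Point k} {W : Vec (Point k) m} {a : Point k} {t : ℚ} →
    0ℚ ≤ t → InCone W (a -ᵥ t · w) → InCone (w ∷ W) a
  InCone-∷⁺ {w = w} {a = a} {t} 0≤t (ts , ts≥0 , e) = t ∷ ts , 0≤t ∷ ts≥0 , trans (cong (t · w +ᵥ_) e) (plus-minusᵥ _ a)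

  InCone-∷⁻ : {k m : ℕ} {w : Point k} {W : Vec (Point k) m} {a : Point k} →
    InCone (w ∷ W) a → ∃ λ t → 0ℚ ≤ t × InCone W (a -ᵥ t · w)
  InCone-∷⁻ {w = w} (t ∷ ts , 0≤t ∷ ts≥0 , refl) = t , 0≤t , ts , ts≥0 , sym (minus-plusᵥ _ _)

  -- Fourier–Motzkin: the forms of the cone of w ∷ W are obtained by eliminating the coefficient of w.
  module Elimination {k m : ℕ} {W : Vec (Point k) m} (F : Facets W) (w : Point k) where
    lower upper : List (Point k)
    lower = filter (λ ℓ → dot ℓ w <? 0ℚ) (forms F)
    upper = filter (λ ℓ → 0ℚ ≤? dot ℓ w) (forms F)

    lower⁻ : ∀ {ℓ} → ℓ ∈ lower → ℓ ∈ forms F × dot ℓ w < 0ℚ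
    lower⁻ = ∈-filter⁻ (λ ℓ → dot ℓ w <? 0ℚ)

    upper⁻ : ∀ {ℓ} → ℓ ∈ upper → ℓ ∈ forms F × 0ℚ ≤ dot ℓ w
    upper⁻ = ∈-filter⁻ (λ ℓ → 0ℚ ≤? dot ℓ w)

    -- For a lower form `ℓ` and an upper form `ℓ'` this is a nonnegative combination that vanishes
    -- at `w`, hence a constraint without the coefficient of `w`.
    eliminate : Point k → Point k → Point k
    eliminate ℓ ℓ' = dot ℓ' w · ℓ -ᵥ dot ℓ w · ℓ'

    feasible⁻ : ∀ {a} t → InCone W (a -ᵥ t · w) → ∀ {ℓ} → ℓ ∈ forms F → 0ℚ ≤ dot ℓ a - t * dot ℓ w
    feasible⁻ {a} t c {ℓ} ℓ∈ = 0≤-resp (dot-minus-scale ℓ a w t) (sound F c ℓ∈)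

    feasible⁺ : ∀ {a} t → (∀ {ℓ} → ℓ ∈ lower → 0ℚ ≤ dot ℓ a - t * dot ℓ w) →
      (∀ {ℓ} → ℓ ∈ upper → 0ℚ ≤ dot ℓ a - t * dot ℓ w) → InCone W (a -ᵥ t · w)
    feasible⁺ {a} t lo up = complete F satisfied
      where
      satisfied : Satisfies (forms F) (a -ᵥ t · w)
      satisfied {ℓ} ℓ∈ with 0ℚ ≤? dot ℓ w
      ... | yes 0≤β = 0≤-resp (sym (dot-minus-scale ℓ a w t)) (up (∈-filter⁺ (λ ℓ → 0ℚ ≤? dot ℓ w) ℓ∈ 0≤β))
      ... | no ¬0≤β = 0≤-resp (sym (dot-minus-scale ℓ a w t)) (lo (∈-filter⁺ (λ ℓ → dot ℓ w <? 0ℚ) ℓ∈ (ℚP.≰⇒> ¬0≤β)))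

    -- The `t` of `tightest` is 0 or is forced by a lower form, so no feasible coefficient is
    -- smaller. The upper forms hold at the given feasible `s`, hence also at `t ≤ s`.
    least : ∀ {a s} → 0ℚ ≤ s → InCone W (a -ᵥ s · w) →
      ∃ λ t → 0ℚ ≤ t × InCone W (a -ᵥ t · w) × (∀ s → 0ℚ ≤ s → InCone W (a -ᵥ s · w) → t ≤ s)
    least {a} {s} 0≤s c with tightest lower a w (λ ℓ∈ → proj₂ (lower⁻ ℓ∈))
    ... | t , 0≤t , ok , tight = t , 0≤t , feasible⁺ t ok up , minimal tight
      where
      lemma₁ : ∀ t s β → t * β - s * β ≡ (- β) * (s - t)
      lemma₁ = solve-∀ ℚring
      lemma₂ : ∀ t s β α → (α - s * β) + β * (s - t) ≡ α - t * β
      lemma₂ = solve-∀ ℚring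
      minimal : _ → ∀ s → 0ℚ ≤ s → InCone W (a -ᵥ s · w) → t ≤ s
      minimal (inj₁ refl) s 0≤s _ = 0≤s
      minimal (inj₂ (ℓ , ℓ∈ , e)) s _ c = 0≤-⇒≤ (0≤*-cancel (<0⇒0<- (proj₂ (lower⁻ ℓ∈)))
        (0≤-resp (trans (cong (_- s * dot ℓ w) e) (lemma₁ t s (dot ℓ w))) (feasible⁻ s c (proj₁ (lower⁻ ℓ∈)))))
      up : ∀ {ℓ} → ℓ ∈ upper → 0ℚ ≤ dot ℓ a - t * dot ℓ w
      up {ℓ} ℓ∈ = 0≤-resp (lemma₂ t s (dot ℓ w) (dot ℓ a))
        (0≤+ (feasible⁻ s c (proj₁ (upper⁻ ℓ∈))) (0≤* (proj₂ (upper⁻ ℓ∈)) (≤⇒0≤- (minimal tight s 0≤s c))))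

    eliminated : Facets (w ∷ W)
    -- The upper forms stay on their own: they are the result of eliminating against the constraint
    -- `t ≥ 0`.
    eliminated = record { forms = upper ++ cartesianProductWith eliminate lower upper ; sound = sound' ; complete = complete' }
      where
      sound' : ∀ {a} → InCone (w ∷ W) a → Satisfies (upper ++ cartesianProductWith eliminate lower upper) a
      sound' {a} c {ℓ} ℓ∈ with InCone-∷⁻ c | ∈-++⁻ upper ℓ∈
      ... | t , 0≤t , c' | inj₁ ℓ∈up = 0≤-resp (minus-plus _ (t * dot ℓ w))
        (0≤+ (feasible⁻ t c' (proj₁ (upper⁻ ℓ∈up))) (0≤* 0≤t (proj₂ (upper⁻ ℓ∈up))))
      ... | t , 0≤t , c' | inj₂ ℓ∈lu with ∈-cartesianProductWith⁻ eliminate lower upper ℓ∈lu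
      ...   | ℓ₁ , ℓ₂ , ℓ₁∈ , ℓ₂∈ , refl = 0≤-resp
        (trans (lemma (dot ℓ₂ w) (dot ℓ₁ a) (dot ℓ₁ w) (dot ℓ₂ a) t) (sym (dot-combine ℓ₁ ℓ₂ a (dot ℓ₂ w) (dot ℓ₁ w))))
        (0≤+ (0≤* (proj₂ (upper⁻ ℓ₂∈)) (feasible⁻ t c' (proj₁ (lower⁻ ℓ₁∈))))
             (0≤* (ℚP.<⇒≤ (<0⇒0<- (proj₂ (lower⁻ ℓ₁∈)))) (feasible⁻ t c' (proj₁ (upper⁻ ℓ₂∈)))))
        where
        lemma : ∀ β₂ α₁ β₁ α₂ t → β₂ * (α₁ - t * β₁) + (- β₁) * (α₂ - t * β₂) ≡ β₂ * α₁ - β₁ * α₂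
        lemma = solve-∀ ℚring
      complete' : ∀ {a} → Satisfies (upper ++ cartesianProductWith eliminate lower upper) a → InCone (w ∷ W) a
      complete' {a} s with tightest lower a w (λ ℓ∈ → proj₂ (lower⁻ ℓ∈))
      ... | t , 0≤t , ok , tight = InCone-∷⁺ {t = t} 0≤t (feasible⁺ t ok (up tight))
        where
        lemma₁ : ∀ α β → α ≡ α - 0ℚ * β
        lemma₁ = solve-∀ ℚring
        lemma₂ : ∀ β₂ β₁ α₂ t → β₂ * (t * β₁) - β₁ * α₂ ≡ (- β₁) * (α₂ - t * β₂)
        lemma₂ = solve-∀ ℚring
        -- At `t = 0` the upper form is itself a constraint on `a`. Otherwise its elimination with
        -- the tight form `ℓ₁` is a positive multiple of the inequality sought.
        up : _ → ∀ {ℓ} → ℓ ∈ upper → 0ℚ ≤ dot ℓ a - t * dot ℓ w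
        up (inj₁ refl) {ℓ} ℓ∈ = 0≤-resp (lemma₁ (dot ℓ a) (dot ℓ w)) (s (∈-++⁺ˡ ℓ∈))
        up (inj₂ (ℓ₁ , ℓ₁∈ , e)) {ℓ} ℓ∈ = 0≤*-cancel (<0⇒0<- (proj₂ (lower⁻ ℓ₁∈)))
          (0≤-resp (trans (dot-combine ℓ₁ ℓ a (dot ℓ w) (dot ℓ₁ w)) (trans (cong (λ x → dot ℓ w * x - dot ℓ₁ w * dot ℓ a) e)
            (lemma₂ (dot ℓ w) (dot ℓ₁ w) (dot ℓ a) t)))
            (s (∈-++⁺ʳ upper (∈-cartesianProductWith⁺ eliminate ℓ₁∈ ℓ∈))))

  abstract
    -- The forms multiply quickly with each elimination; `abstract` leaves only their two properties
    -- visible.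
    facets : {k m : ℕ} (W : Vec (Point k) m) → Facets W
    facets [] = record
      { forms = originForms _
      ; sound = λ { ([] , [] , refl) {ℓ} _ → ℚP.≤-reflexive (sym (dot-0ᵥʳ ℓ)) }
      ; complete = λ {a} s → [] , [] , originForms-complete a s }
    facets (w ∷ W) = Elimination.eliminated (facets W) w

  inCone? : {k m : ℕ} (W : Vec (Point k) m) (a : Point k) → Dec (InCone W a)
  inCone? W a = map′ (λ p → complete (facets W) (All.lookup p)) (λ c → All.tabulate (sound (facets W) c))
    (All.all? (λ ℓ → 0ℚ ≤? dot ℓ a) (forms (facets W)))

  -- The lexicographically least representation of a as a nonnegative combination of W.
  Canonical : {k m : ℕ} → Vec (Point k) m → Point k → Vec ℚ m → Set
  Canonical [] a [] = 0ᵥ ≡ a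
  Canonical (w ∷ W) a (t ∷ ts) =
    0ℚ ≤ t × Canonical W (a -ᵥ t · w) ts × (∀ s → 0ℚ ≤ s → InCone W (a -ᵥ s · w) → t ≤ s)

  canonical-nonneg : {k m : ℕ} (W : Vec (Point k) m) {a : Point k} {ts : Vec ℚ m} → Canonical W a ts → Nonneg ts
  canonical-nonneg [] {ts = []} c = []
  canonical-nonneg (w ∷ W) {ts = t ∷ ts} (0≤t , c , _) = 0≤t ∷ canonical-nonneg W c

  canonical-comb : {k m : ℕ} (W : Vec (Point k) m) {a : Point k} {ts : Vec ℚ m} → Canonical W a ts → comb ts W ≡ a
  canonical-comb [] {ts = []} c = c
  canonical-comb (w ∷ W) {ts = t ∷ ts} (_ , c , _) = trans (cong (t · w +ᵥ_) (canonical-comb W c)) (plus-minusᵥ _ _)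

  canonical-inCone : {k m : ℕ} (W : Vec (Point k) m) {a : Point k} {ts : Vec ℚ m} → Canonical W a ts → InCone W a
  canonical-inCone W c = _ , canonical-nonneg W c , canonical-comb W c

  canonical-unique : {k m : ℕ} (W : Vec (Point k) m) {a : Point k} {ts us : Vec ℚ m} →
    Canonical W a ts → Canonical W a us → ts ≡ us
  canonical-unique [] {ts = []} {[]} _ _ = refl
  canonical-unique (w ∷ W) {ts = t ∷ ts} {u ∷ us} (0≤t , c , t-least) (0≤u , d , u-least)
    with ℚP.≤-antisym (t-least u 0≤u (canonical-inCone W d)) (u-least t 0≤t (canonical-inCone W c))
  ... | refl = cong (t ∷_) (canonical-unique W c d)

  canonical-exists : {k m : ℕ} (W : Vec (Point k) m) {a : Point k} → InCone W a → ∃ (Canonical W a)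
  canonical-exists [] ([] , _ , e) = [] , e
  canonical-exists (w ∷ W) c =
    let s , 0≤s , d = InCone-∷⁻ c
        t , 0≤t , e , t-least = Elimination.least (facets W) w {s = s} 0≤s d
        ts , f = canonical-exists W e
    in t ∷ ts , 0≤t , f , t-least

  SupportedOn : {m : ℕ} → Vec ℚ m → Vec ℚ m → Set
  SupportedOn = Pointwise (λ t u → 0ℚ < u → 0ℚ < t)

  -- `ε` is the least of 1 and the ratios `t / u` with `u > 0`. It is positive because `ts` is
  -- positive wherever `us` is.
  scaledBelow : {m : ℕ} (ts us : Vec ℚ m) → SupportedOn ts us → Nonneg ts → Nonneg us →
    ∃ λ ε → 0ℚ < ε × Pointwise (λ t u → 0ℚ ≤ t - ε * u) ts us
  scaledBelow [] [] [] [] [] = 1ℚ , ℚP.positive⁻¹ 1ℚ , []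
  scaledBelow (t ∷ ts) (u ∷ us) (supp ∷ supps) (0≤t ∷ ts≥0) (0≤u ∷ us≥0) with scaledBelow ts us supps ts≥0 us≥0
  ... | ε , 0<ε , below with 0ℚ ≤? t - ε * u
  ...   | yes p = ε , 0<ε , p ∷ below
  ...   | no ¬p = ε' , 0<ε' , ℚP.≤-reflexive (sym (trans (cong (_-_ t) (proj₂ q)) (ℚP.+-inverseʳ t))) ∷ lower us≥0 below
    where
    t<εu : t < ε * u
    t<εu = subst₂ _<_ (lemma t (ε * u)) (ℚP.+-identityˡ (ε * u)) (ℚP.+-monoˡ-< (ε * u) (ℚP.≰⇒> ¬p))
      where
      lemma : ∀ t x → t - x + x ≡ t
      lemma = solve-∀ ℚring
    0<u : 0ℚ < u
    0<u = ℚP.*-cancelˡ-<-nonNeg ε {{ℚ.nonNegative (ℚP.<⇒≤ 0<ε)}}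
      (subst (_< ε * u) (sym (ℚP.*-zeroʳ ε)) (ℚP.≤-<-trans 0≤t t<εu))
    q = divide t u 0<u
    ε' : ℚ
    ε' = proj₁ q
    0<ε' : 0ℚ < ε'
    0<ε' = ℚP.*-cancelʳ-<-nonNeg u {{ℚ.nonNegative 0≤u}} (subst₂ _<_ (sym (ℚP.*-zeroˡ u)) (sym (proj₂ q)) (supp 0<u))
    ε'<ε : ε' < ε
    ε'<ε = ℚP.*-cancelʳ-<-nonNeg u {{ℚ.nonNegative 0≤u}} (subst (_< ε * u) (sym (proj₂ q)) t<εu)
    lemma : ∀ ε ε' t u → (t - ε * u) + (ε - ε') * u ≡ t - ε' * u
    lemma = solve-∀ ℚring
    lower : ∀ {n} {xs ys : Vec ℚ n} → Nonneg ys →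
      Pointwise (λ t u → 0ℚ ≤ t - ε * u) xs ys → Pointwise (λ t u → 0ℚ ≤ t - ε' * u) xs ys
    lower [] [] = []
    lower {xs = x ∷ _} {y ∷ _} (y≥0 ∷ ys≥0) (p ∷ ps) =
      0≤-resp (lemma ε ε' x y) (0≤+ p (0≤* (≤⇒0≤- (ℚP.<⇒≤ ε'<ε)) y≥0)) ∷ lower ys≥0 ps

  -- Exchanges the part `ε · us` of the representation `ts` for `ε · xs`.
  combine : {m : ℕ} → ℚ → Vec ℚ m → Vec ℚ m → Vec ℚ m → Vec ℚ m
  combine ε ts us xs = (ts -ᵥ ε · us) +ᵥ ε · xs

  combine-nonneg : {m : ℕ} {ε : ℚ} {ts us xs : Vec ℚ m} → 0ℚ < ε → Pointwise (λ t u → 0ℚ ≤ t - ε * u) ts us →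
    Nonneg xs → Nonneg (combine ε ts us xs)
  combine-nonneg 0<ε [] [] = []
  combine-nonneg 0<ε (p ∷ ps) (q ∷ qs) = 0≤+ p (0≤* (ℚP.<⇒≤ 0<ε) q) ∷ combine-nonneg 0<ε ps qs

  comb-combine : {k m : ℕ} (W : Vec (Point k) m) (ε : ℚ) (ts us xs : Vec ℚ m) →
    comb (combine ε ts us xs) W ≡ (comb ts W -ᵥ ε · comb us W) +ᵥ ε · comb xs W
  comb-combine [] ε [] [] [] = base _
    where
    lemma : ∀ ε → 0ℚ ≡ 0ℚ - ε * 0ℚ + ε * 0ℚ
    lemma = solve-∀ ℚring
    base : ∀ k → 0ᵥ {k} ≡ (0ᵥ -ᵥ ε · 0ᵥ) +ᵥ ε · 0ᵥ
    base zero = refl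
    base (suc k) = cong₂ _∷_ (lemma ε) (base k)
  comb-combine (w ∷ W) ε (t ∷ ts) (u ∷ us) (x ∷ xs) =
    trans (cong ((t - ε * u + ε * x) · w +ᵥ_) (comb-combine W ε ts us xs)) (step w (comb ts W) (comb us W) (comb xs W))
    where
    lemma : ∀ ε t u x w a b c → (t - ε * u + ε * x) * w + (a - ε * b + ε * c) ≡ t * w + a - ε * (u * w + b) + ε * (x * w + c)
    lemma = solve-∀ ℚring
    step : ∀ {k} (w a b c : Point k) → (t - ε * u + ε * x) · w +ᵥ ((a -ᵥ ε · b) +ᵥ ε · c) ≡
      ((t · w +ᵥ a) -ᵥ ε · (u · w +ᵥ b)) +ᵥ ε · (x · w +ᵥ c)
    step [] [] [] [] = refl
    step (w ∷ ws) (a ∷ as) (b ∷ bs) (c ∷ cs) = cong₂ _∷_ (lemma ε t u x w a b c) (step ws as bs cs)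

  -- Otherwise a smaller leading coefficient for us would, after scaling by ε, give one for ts.
  canonical-support : {k m : ℕ} (W : Vec (Point k) m) {a : Point k} {ts us : Vec ℚ m} →
    Canonical W a ts → SupportedOn ts us → Nonneg us → Canonical W (comb us W) us
  canonical-support [] {us = []} c supp us≥0 = refl
  canonical-support {k} (w ∷ W) {a} {t ∷ ts} {u ∷ us} c@(0≤t , d , t-least) supp@(_ ∷ supps) us≥0@(0≤u ∷ us≥0') =
    0≤u , subst (λ b → Canonical W b us) (sym (minus-plusᵥ (u · w) (comb us W))) (canonical-support W d supps us≥0') , u-least
    where
    u-least : ∀ s → 0ℚ ≤ s → InCone W (u · w +ᵥ comb us W -ᵥ s · w) → u ≤ s
    u-least s 0≤s (xs , xs≥0 , e) with u ≤? s
    ... | yes u≤s = u≤s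
    ... | no u≰s with scaledBelow (t ∷ ts) (u ∷ us) supp (canonical-nonneg (w ∷ W) c) us≥0
    ...   | ε , 0<ε , p ∷ below = ⊥-elim (ℚP.<-irrefl refl (ℚP.<-≤-trans smaller
      (t-least s' 0≤s' (combine ε ts us xs , combine-nonneg 0<ε below xs≥0 , reached))))
      where
      s' : ℚ
      s' = t - ε * (u - s)
      lemma₁ : ∀ t ε u s → (t - ε * u) + ε * s ≡ t - ε * (u - s)
      lemma₁ = solve-∀ ℚring
      0≤s' : 0ℚ ≤ s'
      0≤s' = 0≤-resp (lemma₁ t ε u s) (0≤+ p (0≤* (ℚP.<⇒≤ 0<ε) 0≤s))
      lemma₂ : ∀ t x → x ≡ t - (t - x)
      lemma₂ = solve-∀ ℚring
      smaller : s' < t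
      smaller = 0<-⇒< (subst (0ℚ <_) (lemma₂ t (ε * (u - s))) (0<* 0<ε (<⇒0<- (ℚP.≰⇒> u≰s))))
      lemma₃ : ∀ ε t u s a w b → (a - t * w - ε * b) + ε * (u * w + b - s * w) ≡ a - (t - ε * (u - s)) * w
      lemma₃ = solve-∀ ℚring
      step : ∀ {k} (a w b : Point k) →
        (a -ᵥ t · w -ᵥ ε · b) +ᵥ ε · (u · w +ᵥ b -ᵥ s · w) ≡ a -ᵥ s' · w
      step [] [] [] = refl
      step (a ∷ as) (w ∷ ws) (b ∷ bs) = cong₂ _∷_ (lemma₃ ε t u s a w b) (step as ws bs)
      reached : comb (combine ε ts us xs) W ≡ a -ᵥ s' · w
      reached = trans (comb-combine W ε ts us xs)
        (trans (cong₂ (λ x y → (x -ᵥ ε · comb us W) +ᵥ ε · y) (canonical-comb W d) e) (step a w (comb us W)))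

  comb-update : {k m : ℕ} (W : Vec (Point k) m) (ts : Vec ℚ m) (i : Fin m) (s : ℚ) →
    comb (ts [ i ]≔ s) W ≡ comb ts W +ᵥ (s - lookup ts i) · lookup W i
  comb-update (w ∷ W) (t ∷ ts) zero s = step w (comb ts W)
    where
    lemma : ∀ s t w a → s * w + a ≡ t * w + a + (s - t) * w
    lemma = solve-∀ ℚring
    step : ∀ {k} (w a : Point k) → s · w +ᵥ a ≡ t · w +ᵥ a +ᵥ (s - t) · w
    step [] [] = refl
    step (w ∷ ws) (a ∷ as) = cong₂ _∷_ (lemma s t w a) (step ws as)
  comb-update (w ∷ W) (t ∷ ts) (suc i) s = trans (cong (t · w +ᵥ_) (comb-update W ts i s))
    (step (t · w) (comb ts W) ((s - lookup ts i) · lookup W i))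
    where
    step : ∀ {k} (a b c : Point k) → a +ᵥ (b +ᵥ c) ≡ a +ᵥ b +ᵥ c
    step [] [] [] = refl
    step (a ∷ as) (b ∷ bs) (c ∷ cs) = cong₂ _∷_ (sym (ℚP.+-assoc a b c)) (step as bs cs)

  -- Indicator functions, coefficient patterns and difference operators

  indicator : {P : Set} → Dec P → ℚ
  indicator (yes _) = 1ℚ
  indicator (no _) = 0ℚ

  indicator-yes : {P : Set} (P? : Dec P) → P → indicator P? ≡ 1ℚ
  indicator-yes (yes _) p = refl
  indicator-yes (no ¬p) p = ⊥-elim (¬p p)

  indicator-no : {P : Set} (P? : Dec P) → ¬ P → indicator P? ≡ 0ℚ
  indicator-no (yes p) ¬p = ⊥-elim (¬p p)
  indicator-no (no _) ¬p = refl

  indicator-cong : {P Q : Set} (P? : Dec P) (Q? : Dec Q) → (P → Q) → (Q → P) → indicator P? ≡ indicator Q?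
  indicator-cong (yes p) Q? f g = sym (indicator-yes Q? (f p))
  indicator-cong (no ¬p) Q? f g = sym (indicator-no Q? (¬p ∘ g))

  indicator-disjoint : {P Q R : Set} (P? : Dec P) (Q? : Dec Q) (R? : Dec R) →
    (P → Q ⊎ R) → (Q → P) → (R → P) → (Q → R → ⊥) → indicator P? ≡ indicator Q? + indicator R?
  indicator-disjoint (yes p) Q? R? f g h d with f p
  ... | inj₁ q = sym (cong₂ _+_ (indicator-yes Q? q) (indicator-no R? (d q)))
  ... | inj₂ r = sym (cong₂ _+_ (indicator-no Q? (λ q → d q r)) (indicator-yes R? r))
  indicator-disjoint (no ¬p) Q? R? f g h d = sym (cong₂ _+_ (indicator-no Q? (¬p ∘ g)) (indicator-no R? (¬p ∘ h)))

  -- Conditions on a single coefficient of the canonical representation. A choice of `zer` or `pos`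
  -- at every index fixes the support, `any` leaves the choice open, and `box` is what remains of
  -- `pos` after its shift by one generator is subtracted.
  data Pattern : Set where
    any zer pos box : Pattern

  Fits : Pattern → ℚ → Set
  Fits any t = ⊤
  Fits zer t = t ≡ 0ℚ
  Fits pos t = 0ℚ < t
  Fits box t = 0ℚ < t × t ≤ 1ℚ

  fits? : ∀ x t → Dec (Fits x t)
  fits? any t = yes tt
  fits? zer t = t ℚP.≟ 0ℚ
  fits? pos t = 0ℚ <? t
  fits? box t = (0ℚ <? t) ×-dec (t ≤? 1ℚ)

  Match : {m : ℕ} → Vec Pattern m → Vec ℚ m → Set
  Match = Pointwise Fits

  match-change : {m : ℕ} (p : Vec Pattern m) (ts : Vec ℚ m) (i : Fin m) {x y : Pattern} {s : ℚ} →
    Match (p [ i ]≔ x) ts → Fits y s → Match (p [ i ]≔ y) (ts [ i ]≔ s)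
  match-change (_ ∷ p) (t ∷ ts) zero (_ ∷ ms) f = f ∷ ms
  match-change (_ ∷ p) (t ∷ ts) (suc i) (m ∷ ms) f = m ∷ match-change p ts i ms f

  match-lookup : {m : ℕ} (p : Vec Pattern m) (ts : Vec ℚ m) (i : Fin m) {x : Pattern} →
    Match (p [ i ]≔ x) ts → Fits x (lookup ts i)
  match-lookup (_ ∷ p) (t ∷ ts) zero (m ∷ ms) = m
  match-lookup (_ ∷ p) (t ∷ ts) (suc i) (m ∷ ms) = match-lookup p ts i ms

  match-change-pattern : {m : ℕ} (p : Vec Pattern m) (ts : Vec ℚ m) (i : Fin m) {x y : Pattern} →
    Match (p [ i ]≔ x) ts → Fits y (lookup ts i) → Match (p [ i ]≔ y) ts
  match-change-pattern p ts i {y = y} ms f = subst (Match (p [ i ]≔ y)) ([]≔-lookup ts i) (match-change p ts i ms f)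

  supportedOn-update : {m : ℕ} (ts : Vec ℚ m) (i : Fin m) (s : ℚ) → 0ℚ < lookup ts i → SupportedOn ts (ts [ i ]≔ s)
  supportedOn-update (t ∷ ts) zero s 0<t = (λ _ → 0<t) ∷ Pw.refl id
  supportedOn-update (t ∷ ts) (suc i) s 0<t = id ∷ supportedOn-update ts i s 0<t

  nonneg-update : {m : ℕ} {ts : Vec ℚ m} (i : Fin m) {s : ℚ} → Nonneg ts → 0ℚ ≤ s → Nonneg (ts [ i ]≔ s)
  nonneg-update zero (_ ∷ ts≥0) 0≤s = 0≤s ∷ ts≥0
  nonneg-update (suc i) (0≤t ∷ ts≥0) 0≤s = 0≤t ∷ nonneg-update i ts≥0 0≤s

  -- The operator `1 - shift by w` on functions of points. On coefficients it is the counterpart of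
  -- `shiftDiff`, with the height as a coordinate of the point.
  difference : {k : ℕ} → Point k → (Point k → ℚ) → Point k → ℚ
  difference w f a = f a - f (a -ᵥ w)

  differences : {k : ℕ} → List (Point k) → (Point k → ℚ) → Point k → ℚ
  differences [] f = f
  differences (w ∷ ws) f = differences ws (difference w f)

  differences-cong : {k : ℕ} (ws : List (Point k)) {f g : Point k → ℚ} → (∀ a → f a ≡ g a) →
    ∀ a → differences ws f a ≡ differences ws g a
  differences-cong [] e = e
  differences-cong (w ∷ ws) e = differences-cong ws (λ a → cong₂ _-_ (e a) (e (a -ᵥ w)))

  differences-+ : {k : ℕ} (ws : List (Point k)) (f g : Point k → ℚ) →
    ∀ a → differences ws (λ b → f b + g b) a ≡ differences ws f a + differences ws g a
  differences-+ [] f g a = refl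
  differences-+ (w ∷ ws) f g a = trans (differences-cong ws (λ b → lemma (f b) (g b) (f (b -ᵥ w)) (g (b -ᵥ w))) a)
    (differences-+ ws (difference w f) (difference w g) a)
    where
    lemma : ∀ x y z u → (x + y) - (z + u) ≡ (x - z) + (y - u)
    lemma = solve-∀ ℚring

  -- The operators commute. Moving one to the outside lets it compare two values of the remaining
  -- product, to which an induction hypothesis applies.
  differences-difference : {k : ℕ} (ws : List (Point k)) (w : Point k) (f : Point k → ℚ) →
    ∀ a → differences ws (difference w f) a ≡ difference w (differences ws f) a
  differences-difference [] w f a = refl
  differences-difference (v ∷ ws) w f a = trans (differences-cong ws swap a) (differences-difference ws w (difference v f) a)
    where
    lemma₁ : ∀ a v w → a - v - w ≡ a - w - v
    lemma₁ = solve-∀ ℚring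
    step : ∀ {k} (a v w : Point k) → a -ᵥ v -ᵥ w ≡ a -ᵥ w -ᵥ v
    step [] [] [] = refl
    step (a ∷ as) (v ∷ vs) (w ∷ ws) = cong₂ _∷_ (lemma₁ a v w) (step as vs ws)
    lemma₂ : ∀ x y z u → (x - y) - (z - u) ≡ (x - z) - (y - u)
    lemma₂ = solve-∀ ℚring
    swap : ∀ b → difference v (difference w f) b ≡ difference w (difference v f) b
    swap b = trans (cong (λ x → (f b - f (b -ᵥ w)) - (f (b -ᵥ v) - f x)) (step b v w))
      (lemma₂ (f b) (f (b -ᵥ w)) (f (b -ᵥ v)) (f (b -ᵥ w -ᵥ v)))

  -- `ℚ./` normalises, so the sum is compared among unnormalised fractions with denominator 1.
  ℕ→ℚ-+ : ∀ a b → ℕ→ℚ (a ℕ.+ b) ≡ ℕ→ℚ a + ℕ→ℚ b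
  ℕ→ℚ-+ a b = ℚP.toℚᵘ-injective (ℚᵘP.≃-trans (embed (a ℕ.+ b)) (ℚᵘP.≃-trans sum-embed (ℚᵘP.≃-sym
    (ℚᵘP.≃-trans (ℚP.toℚᵘ-homo-+ (ℕ→ℚ a) (ℕ→ℚ b)) (ℚᵘP.+-cong (embed a) (embed b))))))
    where
    embed : ∀ n → ℚ.toℚᵘ (ℕ→ℚ n) ℚᵘ.≃ ℚᵘ.mkℚᵘ (ℤ.+ n) 0
    embed n = ℚP.toℚᵘ-fromℚᵘ (ℚᵘ.mkℚᵘ (ℤ.+ n) 0)
    sum-embed : ℚᵘ.mkℚᵘ (ℤ.+ (a ℕ.+ b)) 0 ℚᵘ.≃ ℚᵘ.mkℚᵘ (ℤ.+ a) 0 ℚᵘ.+ ℚᵘ.mkℚᵘ (ℤ.+ b) 0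
    sum-embed = ℚᵘP.≃-reflexive (cong (λ x → ℚᵘ.mkℚᵘ x 0) (trans (ℤP.pos-+ a b)
      (sym (cong₂ ℤ._+_ (ℤP.*-identityʳ (ℤ.+ a)) (ℤP.*-identityʳ (ℤ.+ b))))))

  ℕ→ℚ-suc : ∀ n → ℕ→ℚ (suc n) ≡ ℕ→ℚ n + 1ℚ
  ℕ→ℚ-suc n = trans (ℕ→ℚ-+ 1 n) (ℚP.+-comm 1ℚ (ℕ→ℚ n))

  ℕ→ℚ-nonneg : ∀ n → 0ℚ ≤ ℕ→ℚ n
  ℕ→ℚ-nonneg zero = ℚP.≤-refl
  ℕ→ℚ-nonneg (suc n) = 0≤-resp (sym (ℕ→ℚ-suc n)) (0≤+ (ℕ→ℚ-nonneg n) (ℚP.<⇒≤ (ℚP.positive⁻¹ 1ℚ)))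

  ℕ→ℚ-pos : ∀ n → 0ℚ < ℕ→ℚ (suc n)
  ℕ→ℚ-pos n = subst (0ℚ <_) (sym (ℕ→ℚ-suc n)) (ℚP.+-mono-≤-< {0ℚ} {ℕ→ℚ n} (ℕ→ℚ-nonneg n) (ℚP.positive⁻¹ 1ℚ))

  weight : Pattern → ℚ
  weight box = 1ℚ
  weight _ = 0ℚ

  -- Bounds the height of a representation once each of its coefficients fits zer or box.
  capacity : {m : ℕ} → Vec Pattern m → ℚ
  capacity [] = 0ℚ
  capacity (x ∷ p) = weight x + capacity p

  capacity-update : {m : ℕ} (p : Vec Pattern m) (i : Fin m) (x : Pattern) →
    capacity (p [ i ]≔ x) ≡ weight x - weight (lookup p i) + capacity p
  capacity-update (y ∷ p) zero x = lemma (weight x) (weight y) (capacity p)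
    where
    lemma : ∀ x y c → x + c ≡ x - y + (y + c)
    lemma = solve-∀ ℚring
  capacity-update (y ∷ p) (suc i) x = trans (cong (_+_ (weight y)) (capacity-update p i x))
    (lemma (weight x) (weight (lookup p i)) (weight y) (capacity p))
    where
    lemma : ∀ x l y c → y + (x - l + c) ≡ x - l + (y + c)
    lemma = solve-∀ ℚring

  nonneg-+ : ∀ {n} {ts us : Vec ℚ n} → Nonneg ts → Nonneg us → Nonneg (ts +ᵥ us)
  nonneg-+ [] [] = []
  nonneg-+ (p ∷ ps) (q ∷ qs) = 0≤+ p q ∷ nonneg-+ ps qs

  nonneg-· : ∀ {n} {c} {ts : Vec ℚ n} → 0ℚ ≤ c → Nonneg ts → Nonneg (c · ts)
  nonneg-· 0≤c [] = []
  nonneg-· 0≤c (p ∷ ps) = 0≤* 0≤c p ∷ nonneg-· 0≤c ps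

  comb-+ : ∀ {k n} (V : Vec (Point k) n) (ts us : Vec ℚ n) → comb (ts +ᵥ us) V ≡ comb ts V +ᵥ comb us V
  comb-+ [] [] [] = base _
    where
    base : ∀ k → 0ᵥ {k} ≡ 0ᵥ +ᵥ 0ᵥ
    base zero = refl
    base (suc k) = cong (0ℚ ∷_) (base k)
  comb-+ (w ∷ V) (t ∷ ts) (u ∷ us) = trans (cong ((t + u) · w +ᵥ_) (comb-+ V ts us)) (step w (comb ts V) (comb us V))
    where
    lemma : ∀ t u w a b → (t + u) * w + (a + b) ≡ t * w + a + (u * w + b)
    lemma = solve-∀ ℚring
    step : ∀ {k} (w a b : Point k) → (t + u) · w +ᵥ (a +ᵥ b) ≡ t · w +ᵥ a +ᵥ (u · w +ᵥ b)
    step [] [] [] = refl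
    step (w ∷ ws) (a ∷ as) (b ∷ bs) = cong₂ _∷_ (lemma t u w a b) (step ws as bs)

  comb-· : ∀ {k n} (V : Vec (Point k) n) (c : ℚ) (ts : Vec ℚ n) → comb (c · ts) V ≡ c · comb ts V
  comb-· [] c [] = base _
    where
    base : ∀ k → 0ᵥ {k} ≡ c · 0ᵥ
    base zero = refl
    base (suc k) = cong₂ _∷_ (sym (ℚP.*-zeroʳ c)) (base k)
  comb-· (w ∷ V) c (t ∷ ts) = trans (cong ((c * t) · w +ᵥ_) (comb-· V c ts)) (step w (comb ts V))
    where
    lemma : ∀ c t w a → c * t * w + c * a ≡ c * (t * w + a)
    lemma = solve-∀ ℚring
    step : ∀ {k} (w a : Point k) → (c * t) · w +ᵥ c · a ≡ c · (t · w +ᵥ a)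
    step [] [] = refl
    step (w ∷ ws) (a ∷ as) = cong₂ _∷_ (lemma c t w a) (step ws as)

  zeros : ∀ n → Nonneg (replicate n 0ℚ)
  zeros zero = []
  zeros (suc n) = ℚP.≤-refl ∷ zeros n

  comb-zero : ∀ {k n} (V : Vec (Point k) n) → comb 0ᵥ V ≡ 0ᵥ
  comb-zero [] = refl
  comb-zero (w ∷ V) = trans (cong (0ℚ · w +ᵥ_) (comb-zero V)) (step w)
    where
    lemma : ∀ w → 0ℚ * w + 0ℚ ≡ 0ℚ
    lemma = solve-∀ ℚring
    step : ∀ {k} (w : Point k) → 0ℚ · w +ᵥ 0ᵥ ≡ 0ᵥ
    step [] = refl
    step (w ∷ ws) = cong₂ _∷_ (lemma w) (step ws)

  comb-unit : ∀ {k n} (V : Vec (Point k) n) (j : Fin n) (s : ℚ) → comb (0ᵥ [ j ]≔ s) V ≡ s · lookup V j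
  comb-unit V j s = trans (comb-update V 0ᵥ j s) (trans (cong₂ (λ x y → x +ᵥ (s - y) · lookup V j) (comb-zero V) (lookup-replicate j 0ℚ))
    (step (lookup V j)))
    where
    lemma : ∀ s w → 0ℚ + (s - 0ℚ) * w ≡ s * w
    lemma = solve-∀ ℚring
    step : ∀ {k} (w : Point k) → 0ᵥ +ᵥ (s - 0ℚ) · w ≡ s · w
    step [] = refl
    step (w ∷ ws) = cong₂ _∷_ (lemma s w) (step ws)

  ·-identityˡ : ∀ {k} (w : Point k) → 1ℚ · w ≡ w
  ·-identityˡ [] = refl
  ·-identityˡ (w ∷ ws) = cong₂ _∷_ (ℚP.*-identityˡ w) (·-identityˡ ws)

  head-+ : ∀ {k} (a b : Point (suc k)) → head (a +ᵥ b) ≡ head a + head b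
  head-+ (x ∷ a) (y ∷ b) = refl

  head-· : ∀ {k} c (a : Point (suc k)) → head (c · a) ≡ c * head a
  head-· c (x ∷ a) = refl

  -- Differences of the indicator of a cone with generators of height one

  module Cone {N m : ℕ} (W : Vec (Point (suc N)) m) (heads : VAll.All (λ w → head w ≡ 1ℚ) W) where

    HasRep : Vec Pattern m → Point (suc N) → Set
    HasRep p a = ∃ λ ts → Canonical W a ts × Match p ts

    hasRep? : ∀ p a → Dec (HasRep p a)
    hasRep? p a with inCone? W a
    ... | no ¬c = no λ (ts , c , _) → ¬c (canonical-inCone W c)
    ... | yes c with canonical-exists W c
    ...   | ts , d = map′ (λ f → ts , d , f) (λ (us , e , f) → subst (Match p) (canonical-unique W e d) f)
      (Pw.decidable fits? p ts)

    χ : Vec Pattern m → Point (suc N) → ℚ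
    χ p a = indicator (hasRep? p a)

    cone : Point (suc N) → ℚ
    cone a = indicator (inCone? W a)

    match-any : ∀ {n} (ts : Vec ℚ n) → Match (replicate n any) ts
    match-any [] = []
    match-any (t ∷ ts) = tt ∷ match-any ts

    cone-χ : ∀ a → cone a ≡ χ (replicate m any) a
    cone-χ a = indicator-cong (inCone? W a) (hasRep? (replicate m any) a)
      (λ c → let (ts , d) = canonical-exists W c in ts , d , match-any ts)
      (λ (ts , d , _) → canonical-inCone W d)

    χ-split : ∀ p i a → χ (p [ i ]≔ any) a ≡ χ (p [ i ]≔ zer) a + χ (p [ i ]≔ pos) a
    χ-split p i a = indicator-disjoint (hasRep? (p [ i ]≔ any) a) (hasRep? (p [ i ]≔ zer) a) (hasRep? (p [ i ]≔ pos) a)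
      split (λ (ts , c , f) → ts , c , match-change-pattern p ts i f tt)
      (λ (ts , c , f) → ts , c , match-change-pattern p ts i f tt) disjoint
      where
      split : HasRep (p [ i ]≔ any) a → HasRep (p [ i ]≔ zer) a ⊎ HasRep (p [ i ]≔ pos) a
      split (ts , c , f) with 0ℚ <? lookup ts i
      ... | yes 0<t = inj₂ (ts , c , match-change-pattern p ts i f 0<t)
      ... | no 0≮t = inj₁ (ts , c , match-change-pattern p ts i f
        (ℚP.≤-antisym (ℚP.≮⇒≥ 0≮t) (VAllP.lookup⁺ (canonical-nonneg W c) i)))
      disjoint : HasRep (p [ i ]≔ zer) a → HasRep (p [ i ]≔ pos) a → ⊥
      disjoint (ts , c , f) (us , d , g) with canonical-unique W c d
      ... | refl = ℚP.<-irrefl (sym (match-lookup p ts i f)) (match-lookup p ts i g)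

    -- A positive coefficient may be replaced by any nonnegative one: the support does not grow, so
    -- the representation stays least.
    shift : ∀ {a ts} (i : Fin m) (s : ℚ) → Canonical W a ts → 0ℚ < lookup ts i → 0ℚ ≤ s →
      Canonical W (a +ᵥ (s - lookup ts i) · lookup W i) (ts [ i ]≔ s)
    shift {a} {ts} i s c 0<t 0≤s = subst (λ b → Canonical W b (ts [ i ]≔ s))
      (trans (comb-update W ts i s) (cong (_+ᵥ _) (canonical-comb W c)))
      (canonical-support W c (supportedOn-update ts i s 0<t) (nonneg-update i (canonical-nonneg W c) 0≤s))

    -- The points a with a - wᵢ represented by tᵢ > 0 are those represented by tᵢ > 1.
    χ-difference : ∀ p i a → difference (lookup W i) (χ (p [ i ]≔ pos)) a ≡ χ (p [ i ]≔ box) a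
    χ-difference p i a = trans (cong (_- χ (p [ i ]≔ pos) (a -ᵥ w)) split) (plus-minus (χ (p [ i ]≔ box) a) _)
      where
      w = lookup W i
      plus-minus : ∀ a b → a + b - b ≡ a
      plus-minus = solve-∀ ℚring
      lemma₁ : ∀ t a w → a + (t - 1ℚ - t) * w ≡ a - w
      lemma₁ = solve-∀ ℚring
      step₁ : ∀ {k} t (a w : Point k) → a +ᵥ (t - 1ℚ - t) · w ≡ a -ᵥ w
      step₁ t [] [] = refl
      step₁ t (a ∷ as) (w ∷ ws) = cong₂ _∷_ (lemma₁ t a w) (step₁ t as ws)
      lemma₂ : ∀ t a w → a - w + (t + 1ℚ - t) * w ≡ a
      lemma₂ = solve-∀ ℚring
      step₂ : ∀ {k} t (a w : Point k) → a -ᵥ w +ᵥ (t + 1ℚ - t) · w ≡ a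
      step₂ t [] [] = refl
      step₂ t (a ∷ as) (w ∷ ws) = cong₂ _∷_ (lemma₂ t a w) (step₂ t as ws)
      0<1 : 0ℚ < 1ℚ
      0<1 = ℚP.positive⁻¹ 1ℚ
      1<1+ : ∀ {t} → 0ℚ < t → 1ℚ < t + 1ℚ
      1<1+ {t} 0<t = subst (_< t + 1ℚ) (ℚP.+-identityˡ 1ℚ) (ℚP.+-monoˡ-< 1ℚ 0<t)
      raise : HasRep (p [ i ]≔ pos) (a -ᵥ w) → ∃ λ ts → Canonical W a ts × Match (p [ i ]≔ pos) ts × 1ℚ < lookup ts i
      raise (ts , c , f) = ts [ i ]≔ (t + 1ℚ) ,
        subst (λ b → Canonical W b (ts [ i ]≔ (t + 1ℚ))) (step₂ t a w) (shift i (t + 1ℚ) c 0<t (ℚP.<⇒≤ 0<t+1)) ,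
        match-change p ts i f 0<t+1 , subst (1ℚ <_) (sym (lookup∘update i ts (t + 1ℚ))) (1<1+ 0<t)
        where
        t = lookup ts i
        0<t : 0ℚ < t
        0<t = match-lookup p ts i f
        0<t+1 : 0ℚ < t + 1ℚ
        0<t+1 = ℚP.<-trans 0<1 (1<1+ 0<t)
      to : HasRep (p [ i ]≔ pos) a → HasRep (p [ i ]≔ box) a ⊎ HasRep (p [ i ]≔ pos) (a -ᵥ w)
      to (ts , c , f) with lookup ts i ≤? 1ℚ
      ... | yes t≤1 = inj₁ (ts , c , match-change-pattern p ts i f (match-lookup p ts i f , t≤1))
      ... | no t≰1 = inj₂ (ts [ i ]≔ (t - 1ℚ) ,
        subst (λ b → Canonical W b (ts [ i ]≔ (t - 1ℚ))) (step₁ t a w) (shift i (t - 1ℚ) c (match-lookup p ts i f) (ℚP.<⇒≤ 0<t-1)) ,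
        match-change p ts i f 0<t-1)
        where
        t = lookup ts i
        0<t-1 : 0ℚ < t - 1ℚ
        0<t-1 = <⇒0<- (ℚP.≰⇒> t≰1)
      split : χ (p [ i ]≔ pos) a ≡ χ (p [ i ]≔ box) a + χ (p [ i ]≔ pos) (a -ᵥ w)
      split = indicator-disjoint (hasRep? (p [ i ]≔ pos) a) (hasRep? (p [ i ]≔ box) a) (hasRep? (p [ i ]≔ pos) (a -ᵥ w)) to
        (λ (ts , c , f) → ts , c , match-change-pattern p ts i f (proj₁ (match-lookup p ts i f)))
        (λ r → let (ts , c , f , _) = raise r in ts , c , f)
        disjoint
        where
        disjoint : HasRep (p [ i ]≔ box) a → HasRep (p [ i ]≔ pos) (a -ᵥ w) → ⊥
        disjoint (ts , c , f) r with raise r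
        ... | us , d , _ , 1<u with canonical-unique W c d
        ...   | refl = ℚP.<-irrefl refl (ℚP.<-≤-trans 1<u (proj₂ (match-lookup p ts i f)))

    points : List (Fin m) → List (Point (suc N))
    points = List.map (lookup W)

    head-minus : ∀ a i → head (a -ᵥ lookup W i) ≡ head a - 1ℚ
    head-minus (x ∷ a) i with lookup W i | VAllP.lookup⁺ heads i
    ... | y ∷ _ | refl = refl

    -- Generators have height one, so the height of a combination is the sum of its coefficients,
    -- here at most 1 at `box` and 0 at `zer`.
    match-bound : ∀ {n} {V : Vec (Point (suc N)) n} → VAll.All (λ w → head w ≡ 1ℚ) V →
      (p : Vec Pattern n) (ts : Vec ℚ n) → (∀ j → lookup p j ≢ any × lookup p j ≢ pos) →
      Match p ts → head (comb ts V) ≤ capacity p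
    match-bound [] [] [] ok [] = ℚP.≤-refl
    match-bound {V = (y ∷ w) ∷ V} (refl ∷ hs) (x ∷ p) (t ∷ ts) ok (f ∷ fs) with comb ts V | match-bound hs p ts (ok ∘ suc) fs
    ... | z ∷ _ | z≤ = ℚP.+-mono-≤ (subst (_≤ weight x) (sym (ℚP.*-identityʳ t)) (bound x (ok zero) f)) z≤
      where
      bound : ∀ x → x ≢ any × x ≢ pos → Fits x t → t ≤ weight x
      bound any (¬any , _) _ = ⊥-elim (¬any refl)
      bound zer _ refl = ℚP.≤-refl
      bound pos (_ , ¬pos) _ = ⊥-elim (¬pos refl)
      bound box _ (_ , t≤1) = t≤1

    -- Every `any` is split into `zer` and `pos`, and the operator of its index turns `pos` into
    -- `box`. This raises the capacity by one while one operator is used up, so the bound is kept.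
    -- When no operators are left, only `zer` and `box` remain, and no representation is as high as
    -- `a`.
    χ-vanish : (is : List (Fin m)) (p : Vec Pattern m) → (∀ j → lookup p j ≡ any → j ∈ is) → (∀ j → lookup p j ≢ pos) →
      ∀ a → capacity p + ℕ→ℚ (length is) < head a → differences (points is) (χ p) a ≡ 0ℚ
    χ-vanish [] p all-any no-pos a big = indicator-no (hasRep? p a) λ (ts , c , f) → ℚP.<-irrefl refl
      (ℚP.<-≤-trans (subst (_< head a) (ℚP.+-identityʳ _) big) (subst (λ b → head b ≤ capacity p) (canonical-comb W c)
        (match-bound heads p ts (λ j → (λ e → none (all-any j e)) , no-pos j) f)))
      where
      none : {A : Set} {j : A} → ¬ (j ∈ [])
      none ()
    χ-vanish (i ∷ is) p all-any no-pos a big = by-pattern (lookup p i) refl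
      where
      w = lookup W i
      ws = points is
      lower-bound : ∀ c → c + ℕ→ℚ (length is) + 1ℚ ≡ c + ℕ→ℚ (length (i ∷ is))
      lower-bound c = trans (ℚP.+-assoc c (ℕ→ℚ (length is)) 1ℚ) (cong (_+_ c) (sym (ℕ→ℚ-suc (length is))))
      plain : ∀ q → (∀ j → lookup q j ≡ any → j ∈ is) → (∀ j → lookup q j ≢ pos) → capacity q ≤ capacity p →
        differences ws (difference w (χ q)) a ≡ 0ℚ
      plain q all-any' no-pos' c≤ = trans (differences-difference ws w (χ q) a)
        (trans (cong₂ _-_ (χ-vanish is q all-any' no-pos' a (ℚP.<-trans small decrease))
          (χ-vanish is q all-any' no-pos' (a -ᵥ w) (subst (below <_) (sym (head-minus a i)) small))) (ℚP.+-inverseʳ 0ℚ))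
        where
        below : ℚ
        below = capacity q + ℕ→ℚ (length is)
        plus-minus : ∀ b → b + 1ℚ - 1ℚ ≡ b
        plus-minus = solve-∀ ℚring
        small : below < head a - 1ℚ
        small = subst (_< head a - 1ℚ) (plus-minus below) (ℚP.+-monoˡ-< (- 1ℚ)
          (subst (_< head a) (sym (lower-bound (capacity q))) (ℚP.≤-<-trans (ℚP.+-monoˡ-≤ (ℕ→ℚ (length (i ∷ is))) c≤) big)))
        gap : ∀ x → 1ℚ ≡ x - (x - 1ℚ)
        gap = solve-∀ ℚring
        decrease : head a - 1ℚ < head a
        decrease = 0<-⇒< (subst (0ℚ <_) (gap (head a)) (ℚP.positive⁻¹ 1ℚ))
      not-here : ∀ {x} → lookup p i ≡ x → x ≢ any → ∀ j → lookup p j ≡ any → j ∈ is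
      not-here e x≢any j e' with all-any j e'
      ... | here refl = ⊥-elim (x≢any (trans (sym e) e'))
      ... | there j∈ = j∈
      updated-any : ∀ x → x ≢ any → ∀ j → lookup (p [ i ]≔ x) j ≡ any → j ∈ is
      updated-any x x≢any j e with j Fin.≟ i
      ... | yes refl = ⊥-elim (x≢any (trans (sym (lookup∘update i p x)) e))
      ... | no j≢i with all-any j (trans (sym (lookup∘update′ j≢i p x)) e)
      ...   | here j≡i = ⊥-elim (j≢i j≡i)
      ...   | there j∈ = j∈
      updated-pos : ∀ x → x ≢ pos → ∀ j → lookup (p [ i ]≔ x) j ≢ pos
      updated-pos x x≢pos j e with j Fin.≟ i
      ... | yes refl = x≢pos (trans (sym (lookup∘update i p x)) e)
      ... | no j≢i = no-pos j (trans (sym (lookup∘update′ j≢i p x)) e)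
      by-pattern : ∀ x → lookup p i ≡ x → differences ws (difference w (χ p)) a ≡ 0ℚ
      by-pattern zer e = plain p (not-here e (λ ())) no-pos ℚP.≤-refl
      by-pattern pos e = ⊥-elim (no-pos i e)
      by-pattern box e = plain p (not-here e (λ ())) no-pos ℚP.≤-refl
      by-pattern any e = trans (differences-cong ws split a)
        (trans (differences-+ ws (difference w (χ (p [ i ]≔ zer))) (χ (p [ i ]≔ box)) a)
        (trans (cong₂ _+_
          (plain (p [ i ]≔ zer) (updated-any zer (λ ())) (updated-pos zer (λ ())) (ℚP.≤-reflexive zer-capacity))
          (χ-vanish is (p [ i ]≔ box) (updated-any box (λ ())) (updated-pos box (λ ())) a
            (subst (_< head a) box-capacity big)))
          (ℚP.+-identityˡ 0ℚ)))
        where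
        regroup : ∀ x y z u → (x + y) - (z + u) ≡ (x - z) + (y - u)
        regroup = solve-∀ ℚring
        p-any : p ≡ p [ i ]≔ any
        p-any = trans (sym ([]≔-lookup p i)) (cong (p [ i ]≔_) e)
        χ-p : ∀ b → χ p b ≡ χ (p [ i ]≔ zer) b + χ (p [ i ]≔ pos) b
        χ-p b = trans (cong (λ q → χ q b) p-any) (χ-split p i b)
        split : ∀ b → difference w (χ p) b ≡ difference w (χ (p [ i ]≔ zer)) b + χ (p [ i ]≔ box) b
        split b = trans (cong₂ _-_ (χ-p b) (χ-p (b -ᵥ w)))
          (trans (regroup (χ (p [ i ]≔ zer) b) (χ (p [ i ]≔ pos) b) (χ (p [ i ]≔ zer) (b -ᵥ w)) (χ (p [ i ]≔ pos) (b -ᵥ w)))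
            (cong (_+_ (difference w (χ (p [ i ]≔ zer)) b)) (χ-difference p i b)))
        capacity-any : ∀ x → capacity (p [ i ]≔ x) ≡ weight x - 0ℚ + capacity p
        capacity-any x = trans (capacity-update p i x) (cong (λ y → weight x - weight y + capacity p) e)
        zero-lemma : ∀ c → 0ℚ - 0ℚ + c ≡ c
        zero-lemma = solve-∀ ℚring
        zer-capacity : capacity (p [ i ]≔ zer) ≡ capacity p
        zer-capacity = trans (capacity-any zer) (zero-lemma (capacity p))
        one-lemma : ∀ c l → c + (l + 1ℚ) ≡ (1ℚ - 0ℚ + c) + l
        one-lemma = solve-∀ ℚring
        box-capacity : capacity p + ℕ→ℚ (length (i ∷ is)) ≡ capacity (p [ i ]≔ box) + ℕ→ℚ (length is)
        box-capacity = trans (cong (_+_ (capacity p)) (ℕ→ℚ-suc (length is)))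
          (trans (one-lemma (capacity p) (ℕ→ℚ (length is))) (cong (_+ ℕ→ℚ (length is)) (sym (capacity-any box))))

    capacity-any : ∀ n → capacity (replicate n any) ≡ 0ℚ
    capacity-any zero = refl
    capacity-any (suc n) = trans (ℚP.+-identityˡ _) (capacity-any n)

    -- At the start every index is `any`, so the capacity is 0 and the bound is the number of
    -- operators.
    cone-vanish : ∀ a → ℕ→ℚ m < head a → differences (points (allFin m)) cone a ≡ 0ℚ
    cone-vanish a big = trans (differences-cong (points (allFin m)) cone-χ a)
      (χ-vanish (allFin m) (replicate m any) (λ j _ → ∈-allFin j) no-pos a
        (subst (_< head a) (sym (trans (cong₂ _+_ (capacity-any m) (cong ℕ→ℚ (length-tabulate {n = m} id))) (ℚP.+-identityˡ (ℕ→ℚ m)))) big))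
      where
      no-pos : ∀ j → lookup (replicate m any) j ≢ pos
      no-pos j e with trans (sym (lookup-replicate j any)) e
      ... | ()

    -- All generators have height one, which forces the coefficients `ts` to sum to 1; so this is
    -- extremality within the polytope.
    Vertex : Fin m → Set
    Vertex i₀ = ¬ ∃ λ ts → Nonneg ts × lookup ts i₀ ≡ 0ℚ × comb ts W ≡ lookup W i₀

    module AtVertex (i₀ : Fin m) (vertex : Vertex i₀) where

      -- Points that reach the ray of the vertex i₀ only after adding a nonzero combination of the other generators.
      Missing : Point (suc N) → Set
      Missing a = ∃ λ ts → Nonneg ts × lookup ts i₀ ≡ 0ℚ × 0ℚ < head (comb ts W) × ∃ λ s → a +ᵥ comb ts W ≡ s · lookup W i₀

      head-nonneg : ∀ {n} {V : Vec (Point (suc N)) n} → VAll.All (λ w → head w ≡ 1ℚ) V →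
        {ts : Vec ℚ n} → Nonneg ts → 0ℚ ≤ head (comb ts V)
      head-nonneg [] [] = ℚP.≤-refl
      head-nonneg {V = (y ∷ w) ∷ V} (refl ∷ hs) {t ∷ ts} (0≤t ∷ ts≥0) with comb ts V | head-nonneg hs ts≥0
      ... | z ∷ _ | 0≤z = 0≤+ (0≤-resp (sym (ℚP.*-identityʳ t)) 0≤t) 0≤z

      w₀ : Point (suc N)
      w₀ = lookup W i₀

      -- If `a` were in the cone, adding the two combinations and moving all of `w₀` to one side
      -- would write `c · w₀` by the other generators. Comparing heights gives `c > 0`, and dividing
      -- by `c` contradicts extremality.
      missing⇒∉cone : ∀ {a} → Missing a → ¬ InCone W a
      missing⇒∉cone {a} (ts , ts≥0 , ts₀ , ts>0 , s , e) (us , us≥0 , refl) = vertex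
        (c⁻¹ · xs , nonneg-· (ℚP.<⇒≤ 0<c⁻¹) xs≥0 , lookup-xs , trans (comb-· W c⁻¹ xs) (trans (cong (c⁻¹ ·_) comb-xs) (rescale w₀)))
        where
        c : ℚ
        c = s - lookup us i₀
        xs : Vec ℚ m
        xs = (us [ i₀ ]≔ 0ℚ) +ᵥ ts
        removed≥0 : Nonneg (us [ i₀ ]≔ 0ℚ)
        removed≥0 = nonneg-update i₀ us≥0 ℚP.≤-refl
        xs≥0 : Nonneg xs
        xs≥0 = nonneg-+ removed≥0 ts≥0
        lemma₁ : ∀ a t u w s → a + t ≡ s * w → a + (0ℚ - u) * w + t ≡ (s - u) * w
        lemma₁ a t u w s e = trans (regroup a t u w) (trans (cong (_- u * w) e) (factor s u w))
          where
          regroup : ∀ a t u w → a + (0ℚ - u) * w + t ≡ a + t - u * w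
          regroup = solve-∀ ℚring
          factor : ∀ s u w → s * w - u * w ≡ (s - u) * w
          factor = solve-∀ ℚring
        step : ∀ {k} (a t w : Point k) u → a +ᵥ t ≡ s · w → a +ᵥ (0ℚ - u) · w +ᵥ t ≡ (s - u) · w
        step [] [] [] u e = refl
        step (a ∷ as) (t ∷ ts) (w ∷ ws) u e = cong₂ _∷_ (lemma₁ a t u w s (cong head e)) (step as ts ws u (cong Vec.tail e))
        comb-xs : comb xs W ≡ c · w₀
        comb-xs = trans (comb-+ W (us [ i₀ ]≔ 0ℚ) ts) (trans (cong (_+ᵥ comb ts W) (comb-update W us i₀ 0ℚ))
          (step (comb us W) (comb ts W) w₀ (lookup us i₀) e))
        head-xs : head (comb xs W) ≡ c
        head-xs = trans (cong head comb-xs) (trans (head-· c w₀) (trans (cong (c *_) (VAllP.lookup⁺ heads i₀)) (ℚP.*-identityʳ c)))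
        0<c : 0ℚ < c
        0<c = subst (0ℚ <_) (trans (sym (trans (cong head (comb-+ W (us [ i₀ ]≔ 0ℚ) ts)) (head-+ (comb (us [ i₀ ]≔ 0ℚ) W) (comb ts W)))) head-xs)
          (ℚP.+-mono-≤-< {0ℚ} {head (comb (us [ i₀ ]≔ 0ℚ) W)} (head-nonneg heads removed≥0) ts>0)
        q = divide 1ℚ c 0<c
        c⁻¹ : ℚ
        c⁻¹ = proj₁ q
        0<c⁻¹ : 0ℚ < c⁻¹
        0<c⁻¹ = ℚP.*-cancelʳ-<-nonNeg c {{ℚ.nonNegative (ℚP.<⇒≤ 0<c)}}
          (subst₂ _<_ (sym (ℚP.*-zeroˡ c)) (sym (proj₂ q)) (ℚP.positive⁻¹ 1ℚ))
        rescale : ∀ {k} (w : Point k) → c⁻¹ · (c · w) ≡ w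
        rescale [] = refl
        rescale (w ∷ ws) = cong₂ _∷_ (trans (sym (ℚP.*-assoc c⁻¹ c w)) (trans (cong (_* w) (proj₂ q)) (ℚP.*-identityˡ w))) (rescale ws)
        lookup-· : ∀ {n} c (a : Vec ℚ n) i → lookup (c · a) i ≡ c * lookup a i
        lookup-· c (x ∷ a) zero = refl
        lookup-· c (x ∷ a) (suc i) = lookup-· c a i
        lookup-xs : lookup (c⁻¹ · xs) i₀ ≡ 0ℚ
        lookup-xs = trans (lookup-· c⁻¹ xs i₀) (trans (cong (c⁻¹ *_) (trans (lookup-zipWith _+_ i₀ (us [ i₀ ]≔ 0ℚ) ts)
          (trans (cong₂ _+_ (lookup∘update i₀ us 0ℚ) ts₀) (ℚP.+-identityʳ 0ℚ)))) (ℚP.*-zeroʳ c⁻¹))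

      missing-minus : ∀ {a} j → j ≢ i₀ → Missing a → Missing (a -ᵥ lookup W j)
      missing-minus {a} j j≢i₀ (ts , ts≥0 , ts₀ , ts>0 , s , e) =
        us , nonneg-update j ts≥0 us-j≥0 , trans (lookup∘update′ (j≢i₀ ∘ sym) ts _) ts₀ , us>0 ,
          s , trans (cong ((a -ᵥ w) +ᵥ_) comb-us) (trans (step₁ a (comb ts W) w) e)
        where
        w = lookup W j
        us : Vec ℚ m
        us = ts [ j ]≔ (lookup ts j + 1ℚ)
        us-j≥0 : 0ℚ ≤ lookup ts j + 1ℚ
        us-j≥0 = 0≤+ (VAllP.lookup⁺ ts≥0 j) (ℚP.<⇒≤ (ℚP.positive⁻¹ 1ℚ))
        lemma₁ : ∀ a x w → a - w + (x + w) ≡ a + x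
        lemma₁ = solve-∀ ℚring
        step₁ : ∀ {k} (a x w : Point k) → a -ᵥ w +ᵥ (x +ᵥ w) ≡ a +ᵥ x
        step₁ [] [] [] = refl
        step₁ (a ∷ as) (x ∷ xs) (w ∷ ws) = cong₂ _∷_ (lemma₁ a x w) (step₁ as xs ws)
        lemma₂ : ∀ t x w → x + (t + 1ℚ - t) * w ≡ x + w
        lemma₂ = solve-∀ ℚring
        step₂ : ∀ {k} t (x w : Point k) → x +ᵥ (t + 1ℚ - t) · w ≡ x +ᵥ w
        step₂ t [] [] = refl
        step₂ t (x ∷ xs) (w ∷ ws) = cong₂ _∷_ (lemma₂ t x w) (step₂ t xs ws)
        comb-us : comb us W ≡ comb ts W +ᵥ w
        comb-us = trans (comb-update W ts j _) (step₂ (lookup ts j) (comb ts W) w)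
        us>0 : 0ℚ < head (comb us W)
        us>0 = subst (0ℚ <_) (sym (trans (cong head comb-us) (head-+ (comb ts W) w)))
          (ℚP.+-mono-<-≤ {0ℚ} ts>0 (ℚP.≤-trans (ℚP.<⇒≤ (ℚP.positive⁻¹ 1ℚ)) (ℚP.≤-reflexive (sym (VAllP.lookup⁺ heads j)))))

      -- The product evaluates `cone` at `a` minus sums of generators other than `w₀`, and all these
      -- points are again missing.
      missing-vanish : ∀ js → All.All (_≢ i₀) js → ∀ a → Missing a → differences (points js) cone a ≡ 0ℚ
      missing-vanish [] [] a missing = indicator-no (inCone? W a) (missing⇒∉cone missing)
      missing-vanish (j ∷ js) (j≢ ∷ js≢) a missing = trans (differences-difference (points js) (lookup W j) cone a)
        (trans (cong₂ _-_ (missing-vanish js js≢ a missing) (missing-vanish js js≢ _ (missing-minus j j≢ missing))) (ℚP.+-inverseʳ 0ℚ))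

      missing-first : ∀ j → j ≢ i₀ → ∀ s → Missing (s · w₀ -ᵥ lookup W j)
      missing-first j j≢i₀ s = 0ᵥ [ j ]≔ 1ℚ , nonneg-update j (zeros m) (ℚP.<⇒≤ (ℚP.positive⁻¹ 1ℚ)) ,
        trans (lookup∘update′ (j≢i₀ ∘ sym) 0ᵥ 1ℚ) (lookup-replicate i₀ 0ℚ) ,
        subst (0ℚ <_) (sym (trans (cong head comb-e) (VAllP.lookup⁺ heads j))) (ℚP.positive⁻¹ 1ℚ) ,
        s , trans (cong ((s · w₀ -ᵥ lookup W j) +ᵥ_) comb-e) (step₁ (s · w₀) (lookup W j))
        where
        step₁ : ∀ {k} (a w : Point k) → a -ᵥ w +ᵥ w ≡ a
        step₁ [] [] = refl
        step₁ (a ∷ as) (w ∷ ws) = cong₂ _∷_ (minus-plus a w) (step₁ as ws)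
        comb-e : comb (0ᵥ [ j ]≔ 1ℚ) W ≡ lookup W j
        comb-e = trans (comb-unit W j 1ℚ) (·-identityˡ (lookup W j))

      vertex-ray : ∀ {s} → 0ℚ ≤ s → InCone W (s · w₀)
      vertex-ray {s} 0≤s = 0ᵥ [ i₀ ]≔ s , nonneg-update i₀ (zeros m) 0≤s , comb-unit W i₀ s

      -- Of the expanded product only the unshifted term lies in the cone; each other term has lost
      -- some generator different from `w₀` and is missing.
      vertex-differences : ∀ js → All.All (_≢ i₀) js → ∀ {s} → 0ℚ ≤ s → differences (points js) cone (s · w₀) ≡ 1ℚ
      vertex-differences [] [] 0≤s = indicator-yes (inCone? W _) (vertex-ray 0≤s)
      vertex-differences (j ∷ js) (j≢ ∷ js≢) {s} 0≤s = trans (differences-difference (points js) (lookup W j) cone _)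
        (trans (cong₂ _-_ (vertex-differences js js≢ 0≤s) (missing-vanish js js≢ _ (missing-first j j≢ s))) (ℚP.+-identityʳ 1ℚ))

  -- Natural numbers in ℚ, finite sums and enumerations of lattice points

  ℕ→ℚ-* : ∀ a b → ℕ→ℚ (a ℕ.* b) ≡ ℕ→ℚ a * ℕ→ℚ b
  ℕ→ℚ-* zero b = sym (ℚP.*-zeroˡ (ℕ→ℚ b))
  ℕ→ℚ-* (suc a) b = trans (ℕ→ℚ-+ b (a ℕ.* b)) (trans (cong (_+_ (ℕ→ℚ b)) (ℕ→ℚ-* a b))
    (trans (lemma (ℕ→ℚ a) (ℕ→ℚ b)) (cong (_* ℕ→ℚ b) (sym (ℕ→ℚ-suc a)))))
    where
    lemma : ∀ a b → b + a * b ≡ (a + 1ℚ) * b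
    lemma = solve-∀ ℚring

  ℕ→ℚ-mono : ∀ {a b} → a ℕ.≤ b → ℕ→ℚ a ≤ ℕ→ℚ b
  ℕ→ℚ-mono {a} {b} a≤b = subst₂ _≤_ (ℚP.+-identityʳ (ℕ→ℚ a)) (trans (sym (ℕ→ℚ-+ a (b ℕ.∸ a))) (cong ℕ→ℚ (ℕP.m+[n∸m]≡n a≤b)))
    (ℚP.+-monoʳ-≤ (ℕ→ℚ a) (ℕ→ℚ-nonneg (b ℕ.∸ a)))

  ℕ→ℚ-mono-< : ∀ {a b} → a ℕ.< b → ℕ→ℚ a < ℕ→ℚ b
  ℕ→ℚ-mono-< {a} {b} a<b = ℚP.<-≤-trans (subst₂ _<_ (ℚP.+-identityʳ (ℕ→ℚ a)) (sym (ℕ→ℚ-suc a))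
    (ℚP.+-monoʳ-< (ℕ→ℚ a) (ℚP.positive⁻¹ 1ℚ))) (ℕ→ℚ-mono a<b)

  ℕ→ℚ-reflect-≤ : ∀ {a b} → ℕ→ℚ a ≤ ℕ→ℚ b → a ℕ.≤ b
  ℕ→ℚ-reflect-≤ {a} {b} h with a ℕ.≤? b
  ... | yes a≤b = a≤b
  ... | no a≰b = ⊥-elim (ℚP.<-irrefl refl (ℚP.<-≤-trans (ℕ→ℚ-mono-< (ℕP.≰⇒> a≰b)) h))

  lookup-ext : {A : Set} {k : ℕ} {x y : Vec A k} → (∀ i → lookup x i ≡ lookup y i) → x ≡ y
  lookup-ext {x = x} {y} e = trans (sym (tabulate∘lookup x)) (trans (tabulate-cong e) (tabulate∘lookup y))

  sumFin-cong : ∀ {m} {f g : Fin m → ℚ} → (∀ i → f i ≡ g i) → sumFin f ≡ sumFin g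
  sumFin-cong {zero} e = refl
  sumFin-cong {suc m} e = cong₂ _+_ (e zero) (sumFin-cong (e ∘ suc))

  sumFin-scale : ∀ {m} c (f : Fin m → ℚ) → sumFin (λ i → c * f i) ≡ c * sumFin f
  sumFin-scale {zero} c f = sym (ℚP.*-zeroʳ c)
  sumFin-scale {suc m} c f = trans (cong (_+_ (c * f zero)) (sumFin-scale c (f ∘ suc))) (sym (ℚP.*-distribˡ-+ c (f zero) _))

  sumFin-mono : ∀ {m} {f g : Fin m → ℚ} → (∀ i → f i ≤ g i) → sumFin f ≤ sumFin g
  sumFin-mono {zero} h = ℚP.≤-refl
  sumFin-mono {suc m} {f} {g} h = ℚP.+-mono-≤ {f zero} {g zero} (h zero) (sumFin-mono {m} {f ∘ suc} {g ∘ suc} (h ∘ suc))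

  sumFin-nonneg : ∀ {m} {f : Fin m → ℚ} → (∀ i → 0ℚ ≤ f i) → 0ℚ ≤ sumFin f
  sumFin-nonneg {zero} h = ℚP.≤-refl
  sumFin-nonneg {suc m} h = 0≤+ (h zero) (sumFin-nonneg (h ∘ suc))

  lookup-comb : ∀ {k m} (V : Vec (Point k) m) (ts : Vec ℚ m) (j : Fin k) →
    lookup (comb ts V) j ≡ sumFin (λ i → lookup ts i * lookup (lookup V i) j)
  lookup-comb [] [] j = lookup-replicate j 0ℚ
  lookup-comb (w ∷ V) (t ∷ ts) j = trans (lookup-zipWith _+_ j (t · w) (comb ts V))
    (cong₂ _+_ (lookup-map j (t *_) w) (lookup-comb V ts j))

  coeffP-sigmaP-∉ : {N : ℕ} (S : List (Vec ℕ N)) (γ : Vec ℕ N) → γ ∉ S → coeffP (sigmaP S) γ ≡ 0ℚ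
  coeffP-sigmaP-∉ [] γ γ∉ = refl
  coeffP-sigmaP-∉ (α ∷ S) γ γ∉ with ≡-dec ℕP._≟_ α γ
  ... | yes refl = ⊥-elim (γ∉ (here refl))
  ... | no _ = coeffP-sigmaP-∉ S γ (γ∉ ∘ there)

  coeffP-sigmaP-∈ : {N : ℕ} (S : List (Vec ℕ N)) (γ : Vec ℕ N) → Unique S → γ ∈ S → coeffP (sigmaP S) γ ≡ 1ℚ
  coeffP-sigmaP-∈ (α ∷ S) γ (α∉ ∷ u) γ∈ with ≡-dec ℕP._≟_ α γ
  ... | yes refl = trans (cong (_+_ 1ℚ) (coeffP-sigmaP-∉ S γ (λ γ∈S → All.lookup α∉ γ∈S refl))) (ℚP.+-identityʳ 1ℚ)
  coeffP-sigmaP-∈ (α ∷ S) γ (α∉ ∷ u) (here refl) | no α≢γ = ⊥-elim (α≢γ refl)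
  coeffP-sigmaP-∈ (α ∷ S) γ (α∉ ∷ u) (there γ∈) | no _ = coeffP-sigmaP-∈ S γ u γ∈

  -- Without repetitions in `S` a coefficient of its generating function is 0 or 1, hence an
  -- indicator.
  coeffP-sigmaP : {N : ℕ} {P : Set} (S : List (Vec ℕ N)) (γ : Vec ℕ N) → Unique S → (P? : Dec P) →
    (γ ∈ S → P) → (P → γ ∈ S) → coeffP (sigmaP S) γ ≡ indicator P?
  coeffP-sigmaP S γ u (yes p) f g = coeffP-sigmaP-∈ S γ u (g p)
  coeffP-sigmaP S γ u (no ¬p) f g = coeffP-sigmaP-∉ S γ (¬p ∘ f)

  cube : ℕ → (N : ℕ) → List (Vec ℕ N)
  cube B zero = [] ∷ []
  cube B (suc N) = cartesianProductWith _∷_ (upTo (suc B)) (cube B N)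

  cube-unique : ∀ B N → Unique (cube B N)
  cube-unique B zero = [] ∷ []
  cube-unique B (suc N) = Uniq.cartesianProductWith⁺ _∷_ ∷-injective (Uniq.upTo⁺ (suc B)) (cube-unique B N)

  ∈-cube : ∀ {B N} (a : Vec ℕ N) → (∀ k → lookup a k ℕ.≤ B) → a ∈ cube B N
  ∈-cube [] h = here refl
  ∈-cube (x ∷ a) h = ∈-cartesianProductWith⁺ _∷_ (∈-upTo⁺ (ℕ.s≤s (h zero))) (∈-cube a (h ∘ suc))

  lookup≤sum : ∀ {n} (a : Vec ℕ n) k → lookup a k ℕ.≤ Vec.sum a
  lookup≤sum (x ∷ a) zero = ℕP.m≤m+n x _
  lookup≤sum (x ∷ a) (suc k) = ℕP.≤-trans (lookup≤sum a k) (ℕP.m≤n+m _ x)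

  ≤maxFin : ∀ {m} (f : Fin m → ℕ) i → f i ℕ.≤ maxFin f
  ≤maxFin f zero = ℕP.m≤m⊔n _ _
  ≤maxFin f (suc i) = ℕP.≤-trans (≤maxFin (f ∘ suc) i) (ℕP.m≤n⊔m (f zero) _)

  -- The dilates of a polytope as slices of a cone

  module Polytope {N m : ℕ} (v : Fin m → Vec ℕ N) where

    lattice : ℚ → Vec ℕ N → Point (suc N)
    lattice t a = t ∷ Vec.map ℕ→ℚ a

    W : Vec (Point (suc N)) m
    W = Vec.tabulate (λ i → lattice 1ℚ (v i))

    lookup-W : ∀ i → lookup W i ≡ lattice 1ℚ (v i)
    lookup-W = lookup∘tabulate (λ i → lattice 1ℚ (v i))

    heads : VAll.All (λ w → head w ≡ 1ℚ) W
    heads = VAllP.tabulate⁺ (λ i → refl)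

    open Cone W heads public

    comb-height : ∀ ts → lookup (comb ts W) zero ≡ sumFin (lookup ts)
    comb-height ts = trans (lookup-comb W ts zero) (sumFin-cong
      (λ i → trans (cong (λ w → lookup ts i * lookup w zero) (lookup-W i)) (ℚP.*-identityʳ (lookup ts i))))

    comb-coordinate : ∀ ts k → lookup (comb ts W) (suc k) ≡ sumFin (λ i → lookup ts i * ℕ→ℚ (lookup (v i) k))
    comb-coordinate ts k = trans (lookup-comb W ts (suc k)) (sumFin-cong (λ i → cong (lookup ts i *_)
      (trans (cong (λ w → lookup w (suc k)) (lookup-W i)) (lookup-map k ℕ→ℚ (v i)))))

    generator : ∀ i → InCone W (lookup W i)
    generator i = 0ᵥ [ i ]≔ 1ℚ , nonneg-update i (zeros m) (ℚP.<⇒≤ (ℚP.positive⁻¹ 1ℚ)) ,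
      trans (comb-unit W i 1ℚ) (·-identityˡ (lookup W i))

    InDilate⇒InCone : ∀ n a → InDilate v n a → InCone W (lattice (ℕ→ℚ n) a)
    InDilate⇒InCone n a (λs , (λs≥0 , λs-sum) , e) = ts , VAllP.tabulate⁺ (λ i → 0≤* (ℕ→ℚ-nonneg n) (λs≥0 i)) , lookup-ext equal
      where
      ts : Vec ℚ m
      ts = Vec.tabulate (λ i → ℕ→ℚ n * λs i)
      lookup-ts : ∀ i → lookup ts i ≡ ℕ→ℚ n * λs i
      lookup-ts = lookup∘tabulate (λ i → ℕ→ℚ n * λs i)
      equal : ∀ j → lookup (comb ts W) j ≡ lookup (lattice (ℕ→ℚ n) a) j
      equal zero = trans (comb-height ts) (trans (sumFin-cong lookup-ts) (trans (sumFin-scale (ℕ→ℚ n) λs)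
        (trans (cong (ℕ→ℚ n *_) λs-sum) (ℚP.*-identityʳ (ℕ→ℚ n)))))
      equal (suc k) = trans (comb-coordinate ts k) (trans (sumFin-cong (λ i → trans (cong (_* ℕ→ℚ (lookup (v i) k)) (lookup-ts i))
        (ℚP.*-assoc (ℕ→ℚ n) (λs i) (ℕ→ℚ (lookup (v i) k))))) (trans (sumFin-scale (ℕ→ℚ n) (λ i → λs i * ℕ→ℚ (lookup (v i) k)))
        (trans (sym (e k)) (sym (lookup-map k ℕ→ℚ a)))))

    -- The convex weights are the cone coefficients divided by the height, which is why the height
    -- is a successor.
    InCone⇒InDilate : ∀ n a → InCone W (lattice (ℕ→ℚ (suc n)) a) → InDilate v (suc n) a
    InCone⇒InDilate n a (ts , ts≥0 , e) = λs , ((λ i → 0≤* 0≤r (VAllP.lookup⁺ ts≥0 i)) , λs-sum) , coordinates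
      where
      q = divide 1ℚ (ℕ→ℚ (suc n)) (ℕ→ℚ-pos n)
      r : ℚ
      r = proj₁ q
      0≤r : 0ℚ ≤ r
      0≤r = 0≤*-cancel (ℕ→ℚ-pos n) (0≤-resp (trans (sym (proj₂ q)) (ℚP.*-comm r (ℕ→ℚ (suc n)))) (ℚP.<⇒≤ (ℚP.positive⁻¹ 1ℚ)))
      λs : Fin m → ℚ
      λs i = r * lookup ts i
      λs-sum : sumFin λs ≡ 1ℚ
      λs-sum = trans (sumFin-scale r (lookup ts)) (trans (cong (r *_) (trans (sym (comb-height ts)) (cong (λ b → lookup b zero) e))) (proj₂ q))
      coordinates : ∀ k → ℕ→ℚ (lookup a k) ≡ ℕ→ℚ (suc n) * sumFin (λ i → λs i * ℕ→ℚ (lookup (v i) k))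
      coordinates k = sym (trans (cong (ℕ→ℚ (suc n) *_) (trans (sumFin-cong (λ i → ℚP.*-assoc r (lookup ts i) (ℕ→ℚ (lookup (v i) k))))
        (sumFin-scale r (λ i → lookup ts i * ℕ→ℚ (lookup (v i) k)))))
        (trans (sym (ℚP.*-assoc (ℕ→ℚ (suc n)) r s)) (trans (cong (_* s) (trans (ℚP.*-comm (ℕ→ℚ (suc n)) r) (proj₂ q)))
        (trans (ℚP.*-identityˡ s) (trans (sym (comb-coordinate ts k)) (trans (cong (λ b → lookup b (suc k)) e) (lookup-map k ℕ→ℚ a)))))))
        where
        s : ℚ
        s = sumFin (λ i → lookup ts i * ℕ→ℚ (lookup (v i) k))

    -- A crude bound for every coordinate of every vertex: the coordinates are nonnegative, so each
    -- is at most their sum.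
    maxCoordinate : ℕ
    maxCoordinate = maxFin (λ i → Vec.sum (v i))

    inCone-bounded : ∀ n a → InCone W (lattice (ℕ→ℚ n) a) → ∀ k → lookup a k ℕ.≤ n ℕ.* maxCoordinate
    inCone-bounded n a (ts , ts≥0 , e) k = ℕ→ℚ-reflect-≤ (subst₂ _≤_
      (trans (sym (comb-coordinate ts k)) (trans (cong (λ b → lookup b (suc k)) e) (lookup-map k ℕ→ℚ a)))
      (trans (sumFin-cong (λ i → ℚP.*-comm (lookup ts i) M)) (trans (sumFin-scale M (lookup ts))
        (trans (cong (M *_) (trans (sym (comb-height ts)) (cong (λ b → lookup b zero) e)))
          (trans (ℚP.*-comm M (ℕ→ℚ n)) (sym (ℕ→ℚ-* n maxCoordinate))))))
      (sumFin-mono (λ i → ℚP.*-monoˡ-≤-nonNeg (lookup ts i) {{ℚ.nonNegative (VAllP.lookup⁺ ts≥0 i)}}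
        (ℕ→ℚ-mono (ℕP.≤-trans (lookup≤sum (v i) k) (≤maxFin (λ i → Vec.sum (v i)) i))))))
      where
      M : ℚ
      M = ℕ→ℚ maxCoordinate

    inCone-nonneg : ∀ {a} → InCone W a → ∀ j → 0ℚ ≤ lookup a j
    inCone-nonneg (ts , ts≥0 , refl) j = 0≤-resp (sym (lookup-comb W ts j)) (sumFin-nonneg (λ i → 0≤* (VAllP.lookup⁺ ts≥0 i) (W≥0 i j)))
      where
      lattice≥0 : ∀ a j → 0ℚ ≤ lookup (lattice 1ℚ a) j
      lattice≥0 a zero = ℚP.<⇒≤ (ℚP.positive⁻¹ 1ℚ)
      lattice≥0 a (suc k) = 0≤-resp (sym (lookup-map k ℕ→ℚ a)) (ℕ→ℚ-nonneg (lookup a k))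
      W≥0 : ∀ i j → 0ℚ ≤ lookup (lookup W i) j
      W≥0 i j = 0≤-resp (cong (λ w → lookup w j) (sym (lookup-W i))) (lattice≥0 (v i) j)

    -- The recurrence needs a generating function at every height, so an enumeration is built by
    -- testing all points of a large enough cube. Any other enumeration of the same points has the
    -- same coefficients.
    latticePoints : ℕ → List (Vec ℕ N)
    latticePoints n = filter (λ a → inCone? W (lattice (ℕ→ℚ n) a)) (cube (n ℕ.* maxCoordinate) N)

    coeffP-latticePoints : ∀ n γ → coeffP (sigmaP (latticePoints n)) γ ≡ cone (lattice (ℕ→ℚ n) γ)
    coeffP-latticePoints n γ = coeffP-sigmaP (latticePoints n) γ (Uniq.filter⁺ P? (cube-unique (n ℕ.* maxCoordinate) N)) (P? γ)
      (λ γ∈ → proj₂ (∈-filter⁻ P? {xs = cube (n ℕ.* maxCoordinate) N} γ∈))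
      (λ c → ∈-filter⁺ P? (∈-cube γ (inCone-bounded n γ c)) c)
      where
      P? : ∀ a → Dec (InCone W (lattice (ℕ→ℚ n) a))
      P? a = inCone? W (lattice (ℕ→ℚ n) a)

    coeffP-LatticeEnum : ∀ n S → LatticeEnum v (suc n) S → ∀ γ → coeffP (sigmaP S) γ ≡ cone (lattice (ℕ→ℚ (suc n)) γ)
    coeffP-LatticeEnum n S (u , enum) γ = coeffP-sigmaP S γ u (inCone? W (lattice (ℕ→ℚ (suc n)) γ))
      (λ γ∈ → InDilate⇒InCone (suc n) γ (proj₁ (enum γ) γ∈))
      (λ c → proj₂ (enum γ) (InCone⇒InDilate n γ c))

    isVertexList⇒Vertex : IsVertexList v → ∀ i → Vertex i
    isVertexList⇒Vertex vl i (ts , ts≥0 , tsᵢ , e) = vl i (lookup ts , (VAllP.lookup⁺ ts≥0 ,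
        trans (sym (comb-height ts)) (cong (λ b → lookup b zero) e')) , tsᵢ ,
        (λ k → trans (sym (trans (cong (λ b → lookup b (suc k)) e') (lookup-map k ℕ→ℚ (v i)))) (comb-coordinate ts k)))
      where
      e' : comb ts W ≡ lattice 1ℚ (v i)
      e' = trans e (lookup-W i)

    -- If the two agreed, the generator of `j` alone would represent that of `i`, against
    -- extremality. This makes the roots of the recurrence distinct.
    vertices-distinct : (∀ i → Vertex i) → ∀ {i j} → i ≢ j → v i ≢ v j
    vertices-distinct vertex {i} {j} i≢j e = vertex i (0ᵥ [ j ]≔ 1ℚ , nonneg-update j (zeros m) (ℚP.<⇒≤ (ℚP.positive⁻¹ 1ℚ)) ,
      trans (lookup∘update′ i≢j 0ᵥ 1ℚ) (lookup-replicate i 0ℚ) ,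
      trans (comb-unit W j 1ℚ) (trans (·-identityˡ (lookup W j)) (trans (lookup-W j) (trans (cong (lattice 1ℚ) (sym e)) (sym (lookup-W i))))))

  -- Multiplication by monomials and the passage to fractions

  mono : {N : ℕ} → Exponent N → Poly N
  mono α = (1ℚ , α) ∷ []

  ⊕-cancelˡ : {N : ℕ} (α : Exponent N) {β γ : Exponent N} → α ⊕ β ≡ α ⊕ γ → β ≡ γ
  ⊕-cancelˡ [] {[]} {[]} e = refl
  ⊕-cancelˡ (a ∷ α) {b ∷ β} {c ∷ γ} e with ∷-injective e
  ... | e₁ , e₂ = cong₂ _∷_ (ℕP.+-cancelˡ-≡ a b c e₁) (⊕-cancelˡ α e₂)

  -- Divisibility of monomials; in the second case `γ - α` has a negative coordinate.
  subtract : {N : ℕ} (α γ : Exponent N) → (∃ λ β → α ⊕ β ≡ γ) ⊎ (∃ λ k → lookup γ k ℕ.< lookup α k)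
  subtract [] [] = inj₁ ([] , refl)
  subtract (a ∷ α) (c ∷ γ) with a ℕP.≤? c
  ... | no a≰c = inj₂ (zero , ℕP.≰⇒> a≰c)
  ... | yes a≤c with subtract α γ
  ...   | inj₁ (β , e) = inj₁ (c ℕ.∸ a ∷ β , cong₂ _∷_ (ℕP.m+[n∸m]≡n a≤c) e)
  ...   | inj₂ (k , lt) = inj₂ (suc k , lt)

  ⟦mono*⟧ : {N : ℕ} (α : Exponent N) (p : Poly N) (φ : Exponent N → ℚ) → ⟦ mulP (mono α) p ⟧ φ ≡ ⟦ p ⟧ (λ β → φ (α ⊕ β))
  ⟦mono*⟧ α p φ = trans (⟦⟧-mul (mono α) p φ) (trans (ℚP.+-identityʳ _) (ℚP.*-identityˡ _))

  coeffP-mono*-⊕ : {N : ℕ} (α β : Exponent N) (p : Poly N) → coeffP (mulP (mono α) p) (α ⊕ β) ≡ coeffP p β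
  coeffP-mono*-⊕ {N} α β p = trans (coeffP-δ (mulP (mono α) p) (α ⊕ β)) (trans (⟦mono*⟧ α p (δ (α ⊕ β)))
    (trans (⟦⟧-ext p δ-shift) (sym (coeffP-δ p β))))
    where
    δ-shift : ∀ γ → δ (α ⊕ β) (α ⊕ γ) ≡ δ β γ
    δ-shift γ with ≡-dec ℕP._≟_ γ β
    ... | yes refl = δ-refl (α ⊕ γ)
    ... | no γ≢β = δ-≢ {γ = α ⊕ β} {α ⊕ γ} (γ≢β ∘ ⊕-cancelˡ α)

  coeffP-mono*-< : {N : ℕ} (α γ : Exponent N) (p : Poly N) {k : Fin N} → lookup γ k ℕ.< lookup α k → coeffP (mulP (mono α) p) γ ≡ 0ℚ
  coeffP-mono*-< α γ p {k} lt = trans (coeffP-δ (mulP (mono α) p) γ) (trans (⟦mono*⟧ α p (δ γ))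
    (⟦⟧-vanish p (All.universal (λ t → δ-≢ {γ = γ} {α ⊕ proj₂ t} (λ e → ℕP.<⇒≱ lt
      (ℕP.≤-trans (ℕP.m≤m+n (lookup α k) (lookup (proj₂ t) k))
        (ℕP.≤-reflexive (trans (sym (lookup-zipWith ℕ._+_ k α (proj₂ t))) (cong (λ γ → lookup γ k) e)))))) p)))

  coeffP-mono : {N : ℕ} (α : Exponent N) → coeffP (mono α) α ≡ 1ℚ
  coeffP-mono α = trans (coeffP-δ (mono α) α) (cong (λ x → 1ℚ * x + 0ℚ) (δ-refl α))

  coeffP-mono-≢ : {N : ℕ} {α γ : Exponent N} → α ≢ γ → coeffP (mono α) γ ≡ 0ℚ
  coeffP-mono-≢ {α = α} {γ} α≢γ = trans (coeffP-δ (mono α) γ) (cong (λ x → 1ℚ * x + 0ℚ) (δ-≢ {γ = γ} {α} α≢γ))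

  module PolyRecurrence (N : ℕ) = Recurrence (Poly-commutativeRing N)
  module RationalRecurrence (N : ℕ) = Recurrence (Rational-commutativeRing N)

  module _ {N : ℕ} where
    private
      module P = PolyRecurrence N
      module Q = RationalRecurrence N
      module K = RationalRing N
    open K using () renaming (trans to ≃-trans; sym to ≃-sym)

    fromPolyK-annihilate : (xs : List (Poly N)) (u : ℕ → Poly N) (n : ℕ) →
      Q.annihilate (List.map fromPolyK xs) (fromPolyK ∘ u) n ≃ fromPolyK (P.annihilate xs u n)
    fromPolyK-annihilate [] u n = K.refl
    fromPolyK-annihilate (x ∷ xs) u n = ≃-trans (Q.annihilate-cong (List.map fromPolyK xs) step n)
      (fromPolyK-annihilate xs (P.shiftDiff x u) n)
      where
      step : ∀ n → Q.shiftDiff (fromPolyK x) (fromPolyK ∘ u) n ≃ fromPolyK (P.shiftDiff x u n)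
      step n = ≃-trans (K.+-congˡ {fromPolyK (u (suc n))} (≃-trans (K.-‿cong (fromPolyK-* x (u n))) (fromPolyK-neg (mulP x (u n)))))
        (fromPolyK-+ (u (suc n)) (negP (mulP x (u n))))

  -- The recurrence for the lattice point series and its solution

  module EhrhartSequence {N m : ℕ} (v : Fin m → Vec ℕ N) (vertex : ∀ i → Polytope.Vertex v i) where
    open Polytope v
    private
      module P = PolyRecurrence N
      module Q = RationalRecurrence N
      module K = RationalRing N

    -- The terms are indexed from n = 1: the sequence only obeys the recurrence from there on.
    u : ℕ → Poly N
    u n = sigmaP (latticePoints (suc n))

    OutsideOrthant : Point (suc N) → Set
    OutsideOrthant a = ∃ λ k → lookup a k < 0ℚ

    -- `r` counts the operators applied so far, each of which raises the height read at index `n` by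
    -- one. Since `G` is also evaluated at points with negative coordinates, where a polynomial has
    -- no coefficient, `outside` makes it vanish there.
    record Represents (r : ℕ) (w : ℕ → Poly N) (G : Point (suc N) → ℚ) : Set where
      field
        coefficient : ∀ n γ → coeffP (w n) γ ≡ G (lattice (ℕ→ℚ (suc (n ℕ.+ r))) γ)
        outside : ∀ a → OutsideOrthant a → G a ≡ 0ℚ
    open Represents

    u-represents : Represents 0 u cone
    u-represents = record
      { coefficient = λ n γ → trans (coeffP-latticePoints (suc n) γ)
          (cong (λ k → cone (lattice (ℕ→ℚ (suc k)) γ)) (sym (ℕP.+-identityʳ n)))
      ; outside = λ a (k , neg) → indicator-no (inCone? W a) (λ c → ℚP.<-irrefl refl (ℚP.<-≤-trans neg (inCone-nonneg c k))) }

    lattice-minus : ∀ t α β → lattice (t + 1ℚ) (α ⊕ β) -ᵥ lattice 1ℚ α ≡ lattice t β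
    lattice-minus t α β = cong₂ _∷_ (lemma₁ t 1ℚ) (step α β)
      where
      lemma₁ : ∀ t x → t + x - x ≡ t
      lemma₁ = solve-∀ ℚring
      lemma₂ : ∀ x y → x + y - x ≡ y
      lemma₂ = solve-∀ ℚring
      step : ∀ {k} (α β : Vec ℕ k) → Vec.map ℕ→ℚ (α ⊕ β) -ᵥ Vec.map ℕ→ℚ α ≡ Vec.map ℕ→ℚ β
      step [] [] = refl
      step (a ∷ α) (b ∷ β) = cong₂ _∷_ (trans (cong (_- ℕ→ℚ a) (ℕ→ℚ-+ a b)) (lemma₂ (ℕ→ℚ a) (ℕ→ℚ b))) (step α β)

    represents-shiftDiff : ∀ {r w G} i → Represents r w G → Represents (suc r) (P.shiftDiff (mono (v i)) w) (difference (lookup W i) G)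
    represents-shiftDiff {r} {w} {G} i rep = record { coefficient = coefficient' ; outside = outside' }
      where
      coefficient' : ∀ n γ → coeffP (P.shiftDiff (mono (v i)) w n) γ ≡ difference (lookup W i) G (lattice (ℕ→ℚ (suc (n ℕ.+ suc r))) γ)
      coefficient' n γ = trans (coeffP-++ (w (suc n)) (negP (mulP (mono (v i)) (w n))) γ)
        (cong₂ _+_ (trans (coefficient rep (suc n) γ) (cong (λ k → G (lattice (ℕ→ℚ (suc k)) γ)) (sym (ℕP.+-suc n r))))
          (trans (coeffP-neg (mulP (mono (v i)) (w n)) γ) (cong -_ shifted)))
        where
        t : ℚ
        t = ℕ→ℚ (suc (n ℕ.+ r))
        height : ℕ→ℚ (suc (n ℕ.+ suc r)) ≡ t + 1ℚ
        height = trans (cong (λ k → ℕ→ℚ (suc k)) (ℕP.+-suc n r)) (ℕ→ℚ-suc (suc (n ℕ.+ r)))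
        shifted : coeffP (mulP (mono (v i)) (w n)) γ ≡ G (lattice (ℕ→ℚ (suc (n ℕ.+ suc r))) γ -ᵥ lookup W i)
        shifted with subtract (v i) γ
        ... | inj₁ (β , refl) = trans (coeffP-mono*-⊕ (v i) β (w n)) (trans (coefficient rep n β)
          (cong G (sym (trans (cong₂ (λ s x → lattice s (v i ⊕ β) -ᵥ x) height (lookup-W i)) (lattice-minus t (v i) β)))))
        ... | inj₂ (k , lt) = trans (coeffP-mono*-< (v i) γ (w n) lt) (sym (outside rep _ (suc k , negative)))
          where
          negative : lookup (lattice (ℕ→ℚ (suc (n ℕ.+ suc r))) γ -ᵥ lookup W i) (suc k) < 0ℚ
          negative = subst (λ x → lookup (lattice (ℕ→ℚ (suc (n ℕ.+ suc r))) γ -ᵥ x) (suc k) < 0ℚ) (sym (lookup-W i))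
            (subst (_< 0ℚ) (sym (trans (lookup-zipWith _-_ k (Vec.map ℕ→ℚ γ) (Vec.map ℕ→ℚ (v i)))
              (cong₂ _-_ (lookup-map k ℕ→ℚ γ) (lookup-map k ℕ→ℚ (v i)))))
              (subst (ℕ→ℚ (lookup γ k) - ℕ→ℚ (lookup (v i) k) <_) (ℚP.+-inverseʳ (ℕ→ℚ (lookup (v i) k)))
                (ℚP.+-monoˡ-< (- ℕ→ℚ (lookup (v i) k)) (ℕ→ℚ-mono-< lt))))
      outside' : ∀ a → OutsideOrthant a → difference (lookup W i) G a ≡ 0ℚ
      outside' a (k , neg) = trans (cong₂ _-_ (outside rep a (k , neg)) (outside rep (a -ᵥ lookup W i) (k , neg'))) (ℚP.+-inverseʳ 0ℚ)
        where
        neg' : lookup (a -ᵥ lookup W i) k < 0ℚ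
        neg' = subst (_< 0ℚ) (sym (lookup-zipWith _-_ k a (lookup W i)))
          (subst (lookup a k - lookup (lookup W i) k <_) (ℚP.+-identityʳ 0ℚ)
            (ℚP.+-mono-<-≤ {lookup a k} {0ℚ} neg (ℚP.neg-antimono-≤ (inCone-nonneg (generator i) k))))

    represents-annihilate : ∀ is {r w G} → Represents r w G →
      Represents (length is ℕ.+ r) (P.annihilate (List.map (mono ∘ v) is) w) (differences (points is) G)
    represents-annihilate [] rep = rep
    represents-annihilate (i ∷ is) {r} {w} {G} rep = subst
      (λ s → Represents s (P.annihilate (List.map (mono ∘ v) (i ∷ is)) w) (differences (points (i ∷ is)) G))
      (ℕP.+-suc (length is) r) (represents-annihilate is (represents-shiftDiff i rep))

    X : Fin m → Rational N
    X i = fromPolyK (mono (v i))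

    annihilated : ∀ n → Q.annihilate (List.tabulate X) (fromPolyK ∘ u) n ≃ 0K
    annihilated n = subst (λ xs → Q.annihilate xs (fromPolyK ∘ u) n ≃ 0K)
      (trans (sym (map-∘ (allFin m))) (map-tabulate id X))
      (K.trans (fromPolyK-annihilate (List.map (mono ∘ v) (allFin m)) u n) (fromPolyK-cong (≈0⇒≋[] _ zero-coefficient)))
      where
      zero-coefficient : ∀ γ → coeffP (P.annihilate (List.map (mono ∘ v) (allFin m)) u n) γ ≡ 0ℚ
      zero-coefficient γ = trans (coefficient (represents-annihilate (allFin m) u-represents) n γ)
        -- After `m` operators the term at index `n` is read at height `n + 1 + m`, above the bound
        -- `m`. Starting the sequence at dilation factor 1 is just enough.
        (cone-vanish _ (ℕ→ℚ-mono-< (ℕ.s≤s (ℕP.≤-trans (ℕP.≤-reflexive (sym (trans (ℕP.+-identityʳ _) (length-tabulate {n = m} id))))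
          (ℕP.m≤n+m _ n)))))

    X-difference⁻¹ : ∀ i j → i ≢ j → ∃ λ y → y ⊠ (X i ⊞ ⊟ X j) ≃ 1K
    X-difference⁻¹ i j i≢j = inverse (fromPolyK d) d≢0 , K.trans (K.*-congˡ {inverse (fromPolyK d) d≢0}
      (K.trans (K.+-congˡ {X i} (fromPolyK-neg (mono (v j)))) (fromPolyK-+ (mono (v i)) (negP (mono (v j))))))
      (inverseˡ (fromPolyK d) d≢0)
      where
      d : Poly N
      d = addP (mono (v i)) (negP (mono (v j)))
      d≢0 : NonzeroP d
      d≢0 = v i , λ z → ℚP.1≢0 (trans (sym (trans (coeffP-++ (mono (v i)) (negP (mono (v j))) (v i))
        (cong₂ _+_ (coeffP-mono (v i)) (trans (coeffP-neg (mono (v j)) (v i))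
          (cong -_ (coeffP-mono-≢ (λ e → vertices-distinct vertex i≢j (sym e)))))))) z)

    abstract
      solution : Σ (Fin m → Rational N) λ f → ∀ n → fromPolyK (u n) ≃ Q.expSum f X n
      solution = Q.solveRecurrence X X-difference⁻¹ (fromPolyK ∘ u) annihilated

    others : Fin m → List (Fin m)
    others i = filter (λ j → ¬? (j Fin.≟ i)) (allFin m)

    solution-nonzero : ∀ i → ¬ (proj₁ solution i ≃ 0K)
    solution-nonzero i f≃0 = ℚP.1≢0 (trans (sym one) (≋⇒≈P (fromPolyK-injective {r = []} zero-others) γ))
      where
      js : List (Fin m)
      js = others i
      -- `s` is the height at which index 0 is read after the operators of `js`; at this height `γ`
      -- lies on the ray of the vertex `v i`.
      s : ℕ
      s = suc (length js ℕ.+ 0)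
      γ : Vec ℕ N
      γ = Vec.map (s ℕ.*_) (v i)
      covered : ∀ j → proj₁ solution j ≃ 0K ⊎ j ∈ js
      covered j = by-cases (j Fin.≟ i)
        where
        by-cases : Dec (j ≡ i) → proj₁ solution j ≃ 0K ⊎ j ∈ js
        by-cases (yes refl) = inj₁ f≃0
        by-cases (no j≢i) = inj₂ (∈-filter⁺ (λ j → ¬? (j Fin.≟ i)) (∈-allFin j) j≢i)
      js≢i : All.All (_≢ i) js
      js≢i = AllP.all-filter (λ j → ¬? (j Fin.≟ i)) (allFin m)
      zero-others : fromPolyK (P.annihilate (List.map (mono ∘ v) js) u 0) ≃ 0K
      zero-others = K.trans (K.sym (fromPolyK-annihilate (List.map (mono ∘ v) js) u 0))
        (subst (λ xs → Q.annihilate xs (fromPolyK ∘ u) 0 ≃ 0K) (map-∘ js)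
          (K.trans (Q.annihilate-cong (List.map X js) (proj₂ solution) 0) (Q.annihilate-expSum X js (proj₁ solution) covered 0)))
      ray : ∀ {k} (a : Vec ℕ k) → Vec.map ℕ→ℚ (Vec.map (s ℕ.*_) a) ≡ ℕ→ℚ s · Vec.map ℕ→ℚ a
      ray [] = refl
      ray (x ∷ a) = cong₂ _∷_ (ℕ→ℚ-* s x) (ray a)
      lattice-ray : lattice (ℕ→ℚ s) γ ≡ ℕ→ℚ s · lookup W i
      lattice-ray = trans (cong₂ _∷_ (sym (ℚP.*-identityʳ (ℕ→ℚ s))) (ray (v i))) (cong (ℕ→ℚ s ·_) (sym (lookup-W i)))
      one : coeffP (P.annihilate (List.map (mono ∘ v) js) u 0) γ ≡ 1ℚ
      one = trans (coefficient (represents-annihilate js u-represents) 0 γ)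
        (trans (cong (differences (points js) cone) lattice-ray)
          (AtVertex.vertex-differences i (vertex i) js js≢i (ℕ→ℚ-nonneg s)))

open Geometry

-- The polynomial L

Terms : ℕ → ℕ → Set
Terms N M = List (Rational N × Vec ℕ M)

forget : {N : ℕ} → Terms N N → PolyX N
forget = List.map (λ t → proj₁ (proj₁ t) , proj₂ t)

incHead : {M : ℕ} → Vec ℕ (suc M) → Vec ℕ (suc M)
incHead (a ∷ α) = suc a ∷ α

oneMinusQ : {N : ℕ} → Fin N → Rational N
oneMinusQ k = fromPolyK (addP (constP 1ℚ) (negP (qPow k 1)))

-- The raised copy comes first, so that the term of highest degree stays at the head of the list.
timesBinomial : {N M : ℕ} → Fin N → Terms N (suc M) → Terms N (suc M)
timesBinomial k L = List.map (λ t → (⊟ oneMinusQ k) ⊠ proj₁ t , incHead (proj₂ t)) L ++ L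

-- The product of (1 - (1 - q_k) x_k)^(v_k), where ι says which indeterminate of ℚ(q) belongs to each x.
-- At x_k = [n]_{q_k} it takes the value q^(n v), since 1 - (1 - q)[n]_q = q^n.
expand : {N M : ℕ} → (Fin M → Fin N) → Vec ℕ M → Terms N M
expand ι [] = (1K , []) ∷ []
expand ι (zero ∷ v) = List.map (λ t → proj₁ t , 0 ∷ proj₂ t) (expand (ι ∘ suc) v)
expand ι (suc e ∷ v) = timesBinomial (ι zero) (expand ι (e ∷ v))

Invertible : {N : ℕ} → Rational N → Set
Invertible x = ∃ λ y → y ⊠ x ≃ 1K

-- Invertibility of the head coefficient, rather than mere nonvanishing, lets it be cancelled from a
-- product. The strict bound on the rest keeps it from meeting the top terms of maximal degree.
TopTerm : {N M : ℕ} → Vec ℕ M → Terms N M → Set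
TopTerm {N} {M} v L = ∃ λ c → Invertible c × ∃ λ (rest : Terms N M) →
  L ≡ (c , v) ∷ rest × All (λ t → Vec.sum (proj₂ t) ℕ.< Vec.sum v) rest

module _ {N : ℕ} where
  private
    module Q = RationalRecurrence N
    module K = RationalRing N
  open import Algebra.Properties.Ring K.ring using (-‿distribˡ-*; -‿distribʳ-*)
  open import Relation.Binary.Reasoning.Setoid K.setoid
  open PolyRing N using () renaming (trans to ≋-trans; sym to ≋-sym)

  qInt-valid : (k : Fin N) → NonzeroP (addP (constP 1ℚ) (negP (qPow k 1)))
  qInt-valid k = replicate N 0 , λ z → ℚP.1≢0 (trans (sym value) z)
    where
    α : Exponent N
    α = replicate N 0 [ k ]≔ 1
    α≢0 : α ≢ replicate N 0
    α≢0 e = ℕP.1+n≢0 (trans (sym (lookup∘update k (replicate N 0) 1)) (trans (cong (λ γ → lookup γ k) e) (lookup-replicate k 0)))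
    value : coeffP (addP (constP 1ℚ) (negP (qPow k 1))) (replicate N 0) ≡ 1ℚ
    value = trans (coeffP-++ (constP 1ℚ) (negP (qPow k 1)) (replicate N 0)) (cong₂ ℚ._+_ (coeffP-mono (replicate N 0))
      (trans (coeffP-neg (qPow k 1) (replicate N 0)) (cong ℚ.-_ (coeffP-mono-≢ α≢0))))

  qIntK : ℕ → Fin N → Rational N
  qIntK n k = qInt k n , qInt-valid k

  Invertible-* : {x y : Rational N} → Invertible x → Invertible y → Invertible (x ⊠ y)
  Invertible-* {x} {y} (x⁻¹ , e) (y⁻¹ , f) = x⁻¹ ⊠ y⁻¹ ,
    K.trans (EvaluationIdentities.interchange (Rational-commutativeRing N) x⁻¹ y⁻¹ x y) (K.trans (K.*-cong e f) (K.*-identityˡ 1K))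

  Invertible-neg : {x : Rational N} → Invertible x → Invertible (⊟ x)
  Invertible-neg {x} (x⁻¹ , e) = ⊟ x⁻¹ , K.trans (K.sym (-‿distribˡ-* x⁻¹ (⊟ x)))
    (K.trans (K.-‿cong (K.sym (-‿distribʳ-* x⁻¹ x))) (K.trans (⁻¹-involutive (x⁻¹ ⊠ x)) e))
    where open import Algebra.Properties.Group K.+-group using (⁻¹-involutive)

  -- The head collects the term of positive degree from every binomial factor, so its coefficient is
  -- a product of units `- (1 - q_k)`. Taking 1 from some factor lowers the degree.
  topTerm : {M : ℕ} (ι : Fin M → Fin N) (v : Vec ℕ M) → TopTerm v (expand ι v)
  topTerm ι [] = 1K , (1K , K.*-identityˡ 1K) , [] , refl , []
  topTerm ι (zero ∷ v) =
    let c , c⁻¹ , rest , split , lower = topTerm (ι ∘ suc) v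
    in c , c⁻¹ , List.map (λ t → proj₁ t , 0 ∷ proj₂ t) rest ,
      cong (List.map (λ t → proj₁ t , 0 ∷ proj₂ t)) split , AllP.map⁺ lower
  topTerm ι (suc e ∷ v) =
    let c , c⁻¹ , rest , split , lower = topTerm ι (e ∷ v)
        y = oneMinusQ (ι zero)
    in ⊟ y ⊠ c , Invertible-* {⊟ y} {c} (Invertible-neg {y} (inverse y (qInt-valid (ι zero)) , inverseˡ y (qInt-valid (ι zero)))) c⁻¹ ,
      List.map (λ t → ⊟ y ⊠ proj₁ t , incHead (proj₂ t)) rest ++ (c , e ∷ v) ∷ rest ,
      cong (timesBinomial (ι zero)) split ,
      AllP.++⁺ (AllP.map⁺ (All.map (λ {t} → raise (proj₂ t)) lower)) (ℕP.≤-refl ∷ All.map ℕP.m<n⇒m<1+n lower)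
    where
    raise : ∀ {b M} (α : Vec ℕ (suc M)) → Vec.sum α ℕ.< b → Vec.sum (incHead α) ℕ.< suc b
    raise (a ∷ α) lt = ℕ.s≤s lt

  -- `monoEvalK`, `evalK` and `coeffK` repeat `monoEval`, `evalX` and `coeffX` on fractions that
  -- carry their validity, where the ring laws hold. The `forget` lemmas recover the originals by
  -- propositional equality.
  monoEvalK : (Fin N → Rational N) → {M : ℕ} → (Fin M → Fin N) → Vec ℕ M → Rational N
  monoEvalK t ι [] = 1K
  monoEvalK t ι (e ∷ β) = (t (ι zero) Q.^ e) ⊠ monoEvalK t (ι ∘ suc) β

  evalK : (Fin N → Rational N) → {M : ℕ} → (Fin M → Fin N) → Terms N M → Rational N
  evalK t ι [] = 0K
  evalK t ι ((c , β) ∷ L) = c ⊠ monoEvalK t ι β ⊞ evalK t ι L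

  coeffK : {M : ℕ} → Terms N M → Vec ℕ M → Rational N
  coeffK [] β = 0K
  coeffK ((c , α) ∷ L) β with ≡-dec ℕP._≟_ α β
  ... | yes _ = c ⊞ coeffK L β
  ... | no _ = coeffK L β

  powR-forget : (x : Rational N) (e : ℕ) → powR (proj₁ x) e ≡ proj₁ (x Q.^ e)
  powR-forget x zero = refl
  powR-forget x (suc e) = cong (mulR (proj₁ x)) (powR-forget x e)

  monoEval-forget : (t : Fin N → Rational N) {M : ℕ} (ι : Fin M → Fin N) (β : Vec ℕ M) →
    monoEval (proj₁ ∘ t) ι β ≡ proj₁ (monoEvalK t ι β)
  monoEval-forget t ι [] = refl
  monoEval-forget t ι (e ∷ β) = cong₂ mulR (powR-forget (t (ι zero)) e) (monoEval-forget t (ι ∘ suc) β)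

  evalX-forget : (t : Fin N → Rational N) (L : Terms N N) → evalX (forget L) (proj₁ ∘ t) ≡ proj₁ (evalK t id L)
  evalX-forget t [] = refl
  evalX-forget t ((c , β) ∷ L) = cong₂ (λ x y → addR (mulR (proj₁ c) x) y) (monoEval-forget t id β) (evalX-forget t L)

  coeffX-forget : (L : Terms N N) (β : Vec ℕ N) → coeffX (forget L) β ≡ proj₁ (coeffK L β)
  coeffX-forget [] β = refl
  coeffX-forget ((c , α) ∷ L) β with ≡-dec ℕP._≟_ α β
  ... | yes _ = cong (addR (proj₁ c)) (coeffX-forget L β)
  ... | no _ = coeffX-forget L β

  forget-valid : (L : Terms N N) → ValidX (forget L)
  forget-valid [] = []
  forget-valid ((c , β) ∷ L) = proj₂ c ∷ forget-valid L

  scale : {M : ℕ} → Rational N → Terms N M → Terms N M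
  scale c = List.map (λ t → c ⊠ proj₁ t , proj₂ t)

  evalK-++ : ∀ t {M} (ι : Fin M → Fin N) (L L' : Terms N M) → evalK t ι (L ++ L') ≃ evalK t ι L ⊞ evalK t ι L'
  evalK-++ t ι [] L' = K.sym (K.+-identityˡ _)
  evalK-++ t ι ((c , β) ∷ L) L' = K.trans (K.+-congˡ {c ⊠ monoEvalK t ι β} (evalK-++ t ι L L'))
    (K.sym (K.+-assoc (c ⊠ monoEvalK t ι β) (evalK t ι L) (evalK t ι L')))

  evalK-scale : ∀ t {M} (ι : Fin M → Fin N) c (L : Terms N M) → evalK t ι (scale c L) ≃ c ⊠ evalK t ι L
  evalK-scale t ι c [] = K.sym (K.zeroʳ c)
  evalK-scale t ι c ((d , β) ∷ L) = K.trans (K.+-congˡ {c ⊠ d ⊠ monoEvalK t ι β} (evalK-scale t ι c L))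
    (EvaluationIdentities.scale-identity (Rational-commutativeRing N) c d (monoEvalK t ι β) (evalK t ι L))

  evalK-0∷ : ∀ t {M} (ι : Fin (suc M) → Fin N) (L : Terms N M) →
    evalK t ι (List.map (λ s → proj₁ s , 0 ∷ proj₂ s) L) ≃ evalK t (ι ∘ suc) L
  evalK-0∷ t ι [] = K.refl
  evalK-0∷ t ι ((c , β) ∷ L) = K.+-cong (K.*-congˡ {c} (K.*-identityˡ (monoEvalK t (ι ∘ suc) β))) (evalK-0∷ t ι L)

  evalK-incHead : ∀ t {M} (ι : Fin (suc M) → Fin N) s (L : Terms N (suc M)) →
    evalK t ι (List.map (λ r → s ⊠ proj₁ r , incHead (proj₂ r)) L) ≃ (s ⊠ t (ι zero)) ⊠ evalK t ι L
  evalK-incHead t ι s [] = K.sym (K.zeroʳ (s ⊠ t (ι zero)))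
  evalK-incHead t ι s ((c , e ∷ β) ∷ L) =
    K.trans (K.+-congˡ {s ⊠ c ⊠ (x ⊠ x Q.^ e ⊠ monoEvalK t (ι ∘ suc) β)} (evalK-incHead t ι s L))
      (EvaluationIdentities.shift-identity (Rational-commutativeRing N) s c x (x Q.^ e) (monoEvalK t (ι ∘ suc) β) (evalK t ι L))
    where
    x : Rational N
    x = t (ι zero)

  evalK-timesBinomial : ∀ t {M} (ι : Fin (suc M) → Fin N) (L : Terms N (suc M)) →
    evalK t ι (timesBinomial (ι zero) L) ≃ ((⊟ oneMinusQ (ι zero)) ⊠ t (ι zero) ⊞ 1K) ⊠ evalK t ι L
  evalK-timesBinomial t ι L = begin
    evalK t ι (timesBinomial (ι zero) L)
      ≈⟨ evalK-++ t ι (List.map (λ r → (⊟ oneMinusQ (ι zero)) ⊠ proj₁ r , incHead (proj₂ r)) L) L ⟩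
    evalK t ι (List.map (λ r → (⊟ oneMinusQ (ι zero)) ⊠ proj₁ r , incHead (proj₂ r)) L) ⊞ evalK t ι L
      ≈⟨ K.+-cong (evalK-incHead t ι (⊟ oneMinusQ (ι zero)) L) (K.sym (K.*-identityˡ (evalK t ι L))) ⟩
    ((⊟ oneMinusQ (ι zero)) ⊠ t (ι zero)) ⊠ evalK t ι L ⊞ 1K ⊠ evalK t ι L
      ≈⟨ K.distribʳ (evalK t ι L) ((⊟ oneMinusQ (ι zero)) ⊠ t (ι zero)) 1K ⟨
    ((⊟ oneMinusQ (ι zero)) ⊠ t (ι zero) ⊞ 1K) ⊠ evalK t ι L ∎

  qInt-binomial : ∀ n k → (⊟ oneMinusQ k) ⊠ qIntK n k ⊞ 1K ≃ fromPolyK (qPow k n)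
  qInt-binomial n k = begin
    (⊟ y) ⊠ qIntK n k ⊞ 1K ≈⟨ K.+-congʳ {1K} (K.sym (-‿distribˡ-* y (qIntK n k))) ⟩
    ⊟ (y ⊠ qIntK n k) ⊞ 1K ≈⟨ K.+-congʳ {1K} (K.-‿cong product) ⟩
    ⊟ fromPolyK r ⊞ 1K ≈⟨ K.+-congʳ {1K} (fromPolyK-neg r) ⟩
    fromPolyK (negP r) ⊞ 1K ≈⟨ fromPolyK-+ (negP r) (constP 1ℚ) ⟩
    fromPolyK (addP (negP r) (constP 1ℚ)) ≈⟨ fromPolyK-cong cancel ⟩
    fromPolyK (qPow k n) ∎
    where
    open PolyRing N using (*-comm; *-congˡ; *-identityˡ; *-identityʳ)
    y : Rational N
    y = oneMinusQ k
    d r : Poly N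
    d = addP (constP 1ℚ) (negP (qPow k 1))
    r = addP (constP 1ℚ) (negP (qPow k n))
    product : y ⊠ qIntK n k ≃ fromPolyK r
    product = wrap (≋-trans (*-identityʳ (mulP d r)) (≋-trans (*-comm d r) (*-congˡ {r} (≋-sym (*-identityˡ d)))))
    lemma : ∀ a b → (ℚ.- 1ℚ) ℚ.* a ℚ.+ ((ℚ.- (ℚ.- 1ℚ)) ℚ.* b ℚ.+ (1ℚ ℚ.* a ℚ.+ 0ℚ)) ≡ 1ℚ ℚ.* b ℚ.+ 0ℚ
    lemma = solve-∀ ℚring
    cancel : addP (negP r) (constP 1ℚ) ≋ qPow k n
    cancel = wrap (λ φ → lemma (φ (replicate N 0)) (φ (replicate N 0 [ k ]≔ n)))

  -- The exponent of the product of the `q_(ι k)` to the powers `v_k`. A general `ι` is kept because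
  -- `expand` recurses along `ι ∘ suc`; at `id` it is `v` itself.
  scatter : {M : ℕ} → (Fin M → Fin N) → Vec ℕ M → Vec ℕ N
  scatter ι [] = replicate N 0
  scatter ι (e ∷ v) = (replicate N 0 [ ι zero ]≔ e) ⊕ scatter (ι ∘ suc) v

dilate : {N : ℕ} → ℕ → Vec ℕ N → Vec ℕ N
dilate n = Vec.map (n ℕ.*_)

update-zero : {N : ℕ} (k : Fin N) → replicate N 0 [ k ]≔ 0 ≡ replicate N 0
update-zero zero = refl
update-zero (suc k) = cong (0 ∷_) (update-zero k)

⊕-identityˡ : {N : ℕ} (γ : Exponent N) → replicate N 0 ⊕ γ ≡ γ
⊕-identityˡ = zipWith-identityˡ ℕP.+-identityˡ

dilate-step : {N : ℕ} (n e : ℕ) (k : Fin N) (γ : Exponent N) →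
  (replicate N 0 [ k ]≔ n) ⊕ dilate n ((replicate N 0 [ k ]≔ e) ⊕ γ) ≡ dilate n ((replicate N 0 [ k ]≔ suc e) ⊕ γ)
dilate-step n e zero (c ∷ γ) = cong₂ _∷_ (sym (ℕP.*-suc n (e ℕ.+ c))) (⊕-identityˡ _)
dilate-step n e (suc k) (c ∷ γ) = cong (n ℕ.* c ∷_) (dilate-step n e k γ)

scatter-suc : {N M : ℕ} (ι : Fin M → Fin N) (v : Vec ℕ M) → scatter (suc ∘ ι) v ≡ 0 ∷ scatter ι v
scatter-suc ι [] = refl
scatter-suc {N} ι (e ∷ v) = cong ((replicate (suc N) 0 [ suc (ι zero) ]≔ e) ⊕_) (scatter-suc (ι ∘ suc) v)

scatter-id : {N : ℕ} (v : Vec ℕ N) → scatter id v ≡ v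
scatter-id [] = refl
scatter-id {suc N} (e ∷ v) = trans (cong ((e ∷ replicate N 0) ⊕_) (scatter-suc id v))
  (cong₂ _∷_ (ℕP.+-identityʳ e) (trans (⊕-identityˡ _) (scatter-id v)))

module _ {N : ℕ} where
  private
    module Q = RationalRecurrence N
    module K = RationalRing N
  open import Relation.Binary.Reasoning.Setoid K.setoid

  mono-* : (α β : Exponent N) → fromPolyK (mono α) ⊠ fromPolyK (mono β) ≃ fromPolyK (mono (α ⊕ β))
  mono-* α β = fromPolyK-* (mono α) (mono β)

  mono-^ : (α : Exponent N) (n : ℕ) → fromPolyK (mono α) Q.^ n ≃ fromPolyK (mono (dilate n α))
  mono-^ α zero = subst (λ γ → 1K ≃ fromPolyK (mono γ)) (sym (zero-dilate α)) K.refl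
    where
    zero-dilate : {M : ℕ} (α : Exponent M) → dilate 0 α ≡ replicate M 0
    zero-dilate [] = refl
    zero-dilate (a ∷ α) = cong (0 ∷_) (zero-dilate α)
  mono-^ α (suc n) = K.trans (K.*-congˡ {fromPolyK (mono α)} (mono-^ α n))
    (K.trans (mono-* α (dilate n α)) (K.reflexive (cong (λ γ → fromPolyK (mono γ)) (suc-dilate α))))
    where
    suc-dilate : {M : ℕ} (α : Exponent M) → α ⊕ dilate n α ≡ dilate (suc n) α
    suc-dilate [] = refl
    suc-dilate (a ∷ α) = cong (a ℕ.+ n ℕ.* a ∷_) (suc-dilate α)

  evalK-expand : ∀ n {M} (ι : Fin M → Fin N) (v : Vec ℕ M) →
    evalK (qIntK n) ι (expand ι v) ≃ fromPolyK (mono (dilate n (scatter ι v)))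
  evalK-expand n ι [] = K.trans (K.+-identityʳ (1K ⊠ 1K)) (K.trans (K.*-identityˡ 1K)
    (K.reflexive (cong (λ γ → fromPolyK (mono γ)) (sym (dilate-zero N)))))
    where
    dilate-zero : ∀ M → dilate n (replicate M 0) ≡ replicate M 0
    dilate-zero zero = refl
    dilate-zero (suc M) = cong₂ _∷_ (ℕP.*-zeroʳ n) (dilate-zero M)
  evalK-expand n ι (zero ∷ v) = K.trans (evalK-0∷ (qIntK n) ι (expand (ι ∘ suc) v)) (K.trans (evalK-expand n (ι ∘ suc) v)
    (K.reflexive (cong (λ γ → fromPolyK (mono (dilate n γ)))
      (sym (trans (cong (_⊕ scatter (ι ∘ suc) v) (update-zero (ι zero))) (⊕-identityˡ _))))))
  evalK-expand n ι (suc e ∷ v) = begin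
    evalK (qIntK n) ι (timesBinomial (ι zero) (expand ι (e ∷ v)))
      ≈⟨ evalK-timesBinomial (qIntK n) ι (expand ι (e ∷ v)) ⟩
    ((⊟ oneMinusQ (ι zero)) ⊠ qIntK n (ι zero) ⊞ 1K) ⊠ evalK (qIntK n) ι (expand ι (e ∷ v))
      ≈⟨ K.*-cong (qInt-binomial n (ι zero)) (evalK-expand n ι (e ∷ v)) ⟩
    fromPolyK (qPow (ι zero) n) ⊠ fromPolyK (mono (dilate n (scatter ι (e ∷ v))))
      ≈⟨ mono-* (replicate N 0 [ ι zero ]≔ n) (dilate n (scatter ι (e ∷ v))) ⟩
    fromPolyK (mono ((replicate N 0 [ ι zero ]≔ n) ⊕ dilate n (scatter ι (e ∷ v))))
      ≡⟨ cong (λ γ → fromPolyK (mono γ)) (dilate-step n e (ι zero) (scatter (ι ∘ suc) v)) ⟩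
    fromPolyK (mono (dilate n (scatter ι (suc e ∷ v)))) ∎

  evalK-expand-id : ∀ n (v : Vec ℕ N) → evalK (qIntK n) id (expand id v) ≃ fromPolyK (mono v) Q.^ n
  evalK-expand-id n v = K.trans (evalK-expand n id v) (K.trans
    (K.reflexive (cong (λ γ → fromPolyK (mono (dilate n γ))) (scatter-id v))) (K.sym (mono-^ v n)))

  evalK-concat : ∀ t {m} (g : Fin m → Terms N N) → evalK t id (concat (tabulate g)) ≃ Q.sum (λ i → evalK t id (g i))
  evalK-concat t {zero} g = K.refl
  evalK-concat t {suc m} g = K.trans (evalK-++ t id (g zero) (concat (tabulate (g ∘ suc))))
    (K.+-congˡ {evalK t id (g zero)} (evalK-concat t (g ∘ suc)))

  coeffK-absent : (L : Terms N N) {β : Vec ℕ N} → All (λ t → proj₂ t ≢ β) L → coeffK L β ≡ 0K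
  coeffK-absent [] [] = refl
  coeffK-absent ((c , α) ∷ L) {β} (α≢β ∷ L≢β) with ≡-dec ℕP._≟_ α β
  ... | yes α≡β = ⊥-elim (α≢β α≡β)
  ... | no _ = coeffK-absent L L≢β

  coeffK-head : (c : Rational N) (L : Terms N N) {β : Vec ℕ N} → All (λ t → proj₂ t ≢ β) L → coeffK ((c , β) ∷ L) β ≃ c
  coeffK-head c L {β} L≢β with ≡-dec ℕP._≟_ β β
  ... | yes _ = K.trans (K.+-congˡ {c} (K.reflexive (coeffK-absent L L≢β))) (K.+-identityʳ c)
  ... | no β≢β = ⊥-elim (β≢β refl)

  coeffK-++ : (L L' : Terms N N) (β : Vec ℕ N) → coeffK (L ++ L') β ≃ coeffK L β ⊞ coeffK L' β
  coeffK-++ [] L' β = K.sym (K.+-identityˡ (coeffK L' β))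
  coeffK-++ ((c , α) ∷ L) L' β with ≡-dec ℕP._≟_ α β
  ... | yes _ = K.trans (K.+-congˡ {c} (coeffK-++ L L' β)) (K.sym (K.+-assoc c (coeffK L β) (coeffK L' β)))
  ... | no _ = coeffK-++ L L' β

  coeffK-concat-absent : ∀ {m} (g : Fin m → Terms N N) β → (∀ j → All (λ t → proj₂ t ≢ β) (g j)) →
    coeffK (concat (tabulate g)) β ≡ 0K
  coeffK-concat-absent g β absent = coeffK-absent (concat (tabulate g)) (AllP.concat⁺ (AllP.tabulate⁺ absent))

  coeffK-concat-single : ∀ {m} (g : Fin m → Terms N N) β i → (∀ j → j ≢ i → All (λ t → proj₂ t ≢ β) (g j)) →
    coeffK (concat (tabulate g)) β ≃ coeffK (g i) β
  coeffK-concat-single {suc m} g β zero absent = K.trans (coeffK-++ (g zero) _ β)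
    (K.trans (K.+-congˡ {coeffK (g zero) β} (K.reflexive (coeffK-concat-absent (g ∘ suc) β (λ j → absent (suc j) (λ ())))))
      (K.+-identityʳ (coeffK (g zero) β)))
  coeffK-concat-single {suc m} g β (suc i) absent = K.trans (coeffK-++ (g zero) _ β)
    (K.trans (K.+-cong (K.reflexive (coeffK-absent (g zero) (absent zero (λ ()))))
        (coeffK-concat-single (g ∘ suc) β i (λ j j≢i → absent (suc j) (λ { refl → j≢i refl }))))
      (K.+-identityˡ (coeffK (g (suc i)) β)))

argmax : ∀ {m} (f : Fin (suc m) → ℕ) → ∃ λ i → f i ≡ maxFin f
argmax {zero} f = zero , sym (ℕP.⊔-identityʳ (f zero))
argmax {suc m} f with argmax (f ∘ suc) | ℕP.⊔-sel (f zero) (maxFin (f ∘ suc))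
... | _ | inj₁ e = zero , sym e
... | i , e' | inj₂ e = suc i , trans e' (sym e)

-- Values and degree of the polynomial

open import Data.Nat using (_≤_)
open import Data.Vec using (sum)

mono-nonzero : {N : ℕ} (α : Exponent N) → NonzeroP (mono α)
mono-nonzero α = α , λ z → ℚP.1≢0 (trans (sym (coeffP-mono α)) z)

cancel-invertible : {N : ℕ} (x : Rational N) {y : Rational N} → Invertible y → x ⊠ y ≃ 0K → x ≃ 0K
cancel-invertible {N} x {y} (y⁻¹ , e) xy≃0 = K.trans (K.sym (K.*-identityʳ x)) (K.trans (K.*-congˡ {x} (K.trans (K.sym e) (K.*-comm y⁻¹ y)))
  (K.trans (K.sym (K.*-assoc x y y⁻¹)) (K.trans (K.*-congʳ {y⁻¹} xy≃0) (K.zeroˡ y⁻¹))))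
  where module K = RationalRing N

module EhrhartPolynomial {N m : ℕ} (v : Fin m → Vec ℕ N) (vertex : ∀ i → Polytope.Vertex v i) where
  open Polytope v
  open EhrhartSequence v vertex
  private
    module Q = RationalRecurrence N
    module K = RationalRing N

  f : Fin m → Rational N
  f = proj₁ solution

  X-nonzero : ∀ i → NonzeroP (num (proj₁ (X i)))
  X-nonzero i = mono-nonzero (v i)

  X⁻¹ : Fin m → Rational N
  X⁻¹ i = inverse (X i) (X-nonzero i)

  -- The factor `X⁻¹ i` corrects the index: `u n` belongs to the dilation factor `n + 1`, at which
  -- `expand` takes the value `X i` to the power `n + 1`.
  terms : Fin m → Terms N N
  terms i = scale (f i ⊠ X⁻¹ i) (expand id (v i))

  polynomial : Terms N N
  polynomial = concat (tabulate terms)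

  eval-terms : ∀ n i → evalK (qIntK (suc n)) id (terms i) ≃ f i ⊠ X i Q.^ n
  eval-terms n i = K.trans (evalK-scale (qIntK (suc n)) id (f i ⊠ X⁻¹ i) (expand id (v i)))
    (K.trans (K.*-congˡ {f i ⊠ X⁻¹ i} (evalK-expand-id (suc n) (v i)))
    (K.trans (EvaluationIdentities.regroup (Rational-commutativeRing N) (f i) (X⁻¹ i) (X i) (X i Q.^ n))
    (K.*-congˡ {f i} (K.trans (K.*-congʳ {X i Q.^ n} (inverseˡ (X i) (X-nonzero i))) (K.*-identityˡ (X i Q.^ n))))))

  eval-polynomial : ∀ n S → LatticeEnum v (suc n) S → evalK (qIntK (suc n)) id polynomial ≃ fromPolyK (sigmaP S)
  eval-polynomial n S enum = K.trans (evalK-concat (qIntK (suc n)) terms)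
    (K.trans (Q.sum-cong-≋ (eval-terms n)) (K.trans (K.sym (proj₂ solution n))
    (fromPolyK-cong (≈P⇒≋ (λ γ → trans (coeffP-latticePoints (suc n) γ) (sym (coeffP-LatticeEnum n S enum γ)))))))

  D : ℕ
  D = maxFin (λ i → sum (v i))

  top : Fin m → Rational N
  top i = proj₁ (topTerm id (v i))

  terms-split : ∀ i → ∃ λ rest → terms i ≡ (f i ⊠ X⁻¹ i ⊠ top i , v i) ∷ rest × All (λ t → sum (proj₂ t) ℕ.< sum (v i)) rest
  terms-split i =
    let c , _ , rest , split , lower = topTerm id (v i)
    in scale (f i ⊠ X⁻¹ i) rest , cong (scale (f i ⊠ X⁻¹ i)) split , AllP.map⁺ lower

  terms-degree : ∀ i → All (λ t → sum (proj₂ t) ≤ D) (terms i)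
  terms-degree i = let rest , split , lower = terms-split i in
    subst (All _) (sym split) (v≤D ∷ All.map (λ lt → ℕP.≤-trans (ℕP.<⇒≤ lt) v≤D) lower)
    where
    v≤D : sum (v i) ≤ D
    v≤D = ≤maxFin (λ i → sum (v i)) i

  degree-bound : ∀ β → D ℕ.< sum β → coeffK polynomial β ≡ 0K
  degree-bound β D<β = coeffK-concat-absent terms β
    (λ i → All.map (λ { t≤D refl → ℕP.<⇒≱ D<β t≤D }) (terms-degree i))

  module _ (i₀ : Fin m) (maximal : sum (v i₀) ≡ D) where

    -- The top exponent of another vertex differs from `v i₀`, and its other terms have degree below
    -- the maximum. So nothing cancels at `v i₀`, even if several vertices attain the maximum.
    absent : ∀ j → j ≢ i₀ → All (λ t → proj₂ t ≢ v i₀) (terms j)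
    absent j j≢i₀ = let rest , split , lower = terms-split j in
      subst (All _) (sym split) (vertices-distinct vertex j≢i₀ ∷ All.map (λ { lt refl → ℕP.<⇒≱ lt
        (subst (sum (v j) ≤_) (sym maximal) (≤maxFin (λ i → sum (v i)) j)) }) lower)

    top-coefficient : coeffK polynomial (v i₀) ≃ f i₀ ⊠ X⁻¹ i₀ ⊠ top i₀
    top-coefficient = let rest , split , lower = terms-split i₀ in
      K.trans (coeffK-concat-single terms (v i₀) i₀ absent)
        (K.trans (K.reflexive (cong (λ L → coeffK L (v i₀)) split))
          (coeffK-head (f i₀ ⊠ X⁻¹ i₀ ⊠ top i₀) rest {v i₀} (All.map (λ { lt refl → ℕP.<-irrefl refl lt }) lower)))

    -- The coefficient is `f i₀` times two units, which are cancelled in turn.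
    top-nonzero : ¬ (coeffK polynomial (v i₀) ≃ 0K)
    top-nonzero z = solution-nonzero i₀ (cancel-invertible (f i₀) (X i₀ , X-inverse)
      (cancel-invertible (f i₀ ⊠ X⁻¹ i₀) (proj₁ (proj₂ (topTerm id (v i₀)))) (K.trans (K.sym top-coefficient) z)))
      where
      X-inverse : X i₀ ⊠ X⁻¹ i₀ ≃ 1K
      X-inverse = K.trans (K.*-comm (X i₀) (X⁻¹ i₀)) (inverseˡ (X i₀) (X-nonzero i₀))

theorem2p3 : (N m : ℕ) (v : Fin m → Vec ℕ N) → 1 ≤ m → IsVertexList v →
    Σ (PolyX N) (λ L → ValidX L × TotalDegree L (maxFin (λ i → sum (v i))) ×
    ((n : ℕ) → 1 ≤ n → (S : List (Vec ℕ N)) → LatticeEnum v n S →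
    evalX L (λ k → qInt k n) ≈R fromPoly (sigmaP S)))
theorem2p3 N (suc m) v _ vertices = forget polynomial , forget-valid polynomial ,
  ((v i₀ , maximal , λ z → top-nonzero i₀ maximal (≈R⇒≃ (subst (_≈R zeroR) (coeffX-forget polynomial (v i₀)) z))) , bound) , value
  where
  vertex : ∀ i → Polytope.Vertex v i
  vertex = Polytope.isVertexList⇒Vertex v vertices
  open EhrhartPolynomial v vertex
  -- There is at least one vertex, so the maximal coordinate sum is attained.
  i₀ : Fin (suc m)
  i₀ = proj₁ (argmax (λ i → sum (v i)))
  maximal : sum (v i₀) ≡ D
  maximal = proj₂ (argmax (λ i → sum (v i)))
  bound : ∀ β → ¬ (coeffX (forget polynomial) β ≈R zeroR) → sum β ≤ D
  bound β nz with sum β ℕP.≤? D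
  ... | yes β≤D = β≤D
  ... | no β≰D = ⊥-elim (nz (subst (_≈R zeroR) (sym (trans (coeffX-forget polynomial β) (cong proj₁ (degree-bound β (ℕP.≰⇒> β≰D)))))
    (λ γ → refl)))
  value : (n : ℕ) → 1 ≤ n → (S : List (Vec ℕ N)) → LatticeEnum v n S →
    evalX (forget polynomial) (λ k → qInt k n) ≈R fromPoly (sigmaP S)
  value (suc n) _ S enum = subst (_≈R fromPoly (sigmaP S)) (sym (evalX-forget (qIntK (suc n)) polynomial))
    (≃⇒≈R (eval-polynomial n S enum))
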